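{- For all integers $n\geq 0$, $$a_{1^{3}3^{ -1}4^{ -4}}(4n)>0,\quad a_{1^{3}3^{ -1}4^{ -4}}(4n+1)<0,\quad a_{1^{3}3^{ -1}4^{ -4}}(4n+2)=0,\quad a_{1^{3}3^{ -1}4^{ -4}}(4n+3)>0.$$
   Context: For $|q|<1$ (or as formal power series in $q$) let $f_j:=(q^j;q^j)_\infty=\prod_{k\ge 1}(1-q^{jk})$ for each positive integer $j$. The integers $a_{1^{3}3^{ -1}4^{ -4}}(n)$, $n\ge 0$, are defined by $\sum_{n=0}^\infty a_{1^{3}3^{ -1}4^{ -4}}(n)q^n=\dfrac{f_1^3}{f_3f_4^4}$. -}

module Defs where

open import Data.Bool.Base using (if_then_else_)
open import Data.Fin.Base using (Fin; zero; suc; toℕ)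
open import Data.Integer.Base using (ℤ; 0ℤ; 1ℤ; -_; _+_; _-_; _*_)
open import Data.Integer.Properties using
  (+-*-semiring; +-identityʳ; +-inverseˡ; *-identityˡ)
open import Data.Nat.Base as ℕ using (ℕ; zero; suc; _∸_; _≡ᵇ_; _≤′_; ≤′-refl; ≤′-step; NonZero)
import Data.Nat.Properties as ℕ
open import Data.Vec.Functional using (Vector)
open import Algebra.Properties.Semiring.Sum +-*-semiring
  using (sum; sum⁺-syntax; sum-cong-≗; sum-replicate-zero)
open import Relation.Binary.PropositionalEquality

-- Formal power series in q over ℤ, as coefficient sequences; their equality is
-- pointwise equality _≗_.
Series : Set
Series = ℕ → ℤ

infixl 7 _⊛_
infixl 6 _⊖_
infixr 8 _^_

q^_ : ℕ → Series
(q^ m) n = if n ≡ᵇ m then 1ℤ else 0ℤ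

one : Series
one = q^ 0

_⊖_ : Series → Series → Series
(g ⊖ h) n = g n - h n

_⊛_ : Series → Series → Series
(g ⊛ h) n = ∑[ i ≤ n ] (g (toℕ i) * h (n ∸ toℕ i))

_^_ : Series → ℕ → Series
g ^ zero  = one
g ^ suc k = g ⊛ (g ^ k)

-- The coefficients b₀, b₁, … of 1/g for g with constant term 1 satisfy
-- b₀ = 1 and bₙ₊₁ = - Σ_{i ≤ n} gᵢ₊₁ bₙ₋ᵢ.  The vector  reciprocalPrefix g n
-- lists bₙ, bₙ₋₁, …, b₀ in this order.
reciprocalPrefix : Series → (n : ℕ) → Vector ℤ (suc n)
reciprocalPrefix g zero    _       = 1ℤ
reciprocalPrefix g (suc n) zero    = - (∑[ i ≤ n ] (g (suc (toℕ i)) * reciprocalPrefix g n i))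
reciprocalPrefix g (suc n) (suc i) = reciprocalPrefix g n i

reciprocal : (g : Series) → .(g 0 ≡ 1ℤ) → Series
reciprocal g _ n = reciprocalPrefix g n zero

reciprocalPrefix-lookup : ∀ g .(g₀ : g 0 ≡ 1ℤ) n (i : Fin (suc n)) →
                          reciprocalPrefix g n i ≡ reciprocal g g₀ (n ∸ toℕ i)
reciprocalPrefix-lookup g g₀ zero    zero    = refl
reciprocalPrefix-lookup g g₀ (suc n) zero    = refl
reciprocalPrefix-lookup g g₀ (suc n) (suc i) = reciprocalPrefix-lookup g g₀ n i

⊛-reciprocal : ∀ g (g₀ : g 0 ≡ 1ℤ) → g ⊛ reciprocal g g₀ ≗ one
⊛-reciprocal g g₀ zero rewrite g₀ = refl
⊛-reciprocal g g₀ (suc n) = begin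
  g 0 * - s + (∑[ i ≤ n ] (g (suc (toℕ i)) * reciprocal g g₀ (n ∸ toℕ i)))
    ≡⟨ cong₂ _+_ (trans (cong (_* - s) g₀) (*-identityˡ (- s)))
                 (sum-cong-≗ λ i → cong (g (suc (toℕ i)) *_)
                                        (sym (reciprocalPrefix-lookup g g₀ n i))) ⟩
  - s + s
    ≡⟨ +-inverseˡ s ⟩
  0ℤ ∎
  where
  open ≡-Reasoning
  s = ∑[ i ≤ n ] (g (suc (toℕ i)) * reciprocalPrefix g n i)

-- ∏_{k=1}^{N} (1 - q^{jk})
partialProduct : ℕ → ℕ → Series
partialProduct j zero    = one
partialProduct j (suc N) = (one ⊖ q^ (j ℕ.* suc N)) ⊛ partialProduct j N

-- f j = (q^j;q^j)_∞.  The factors with k > n do not affect the coefficient of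
-- qⁿ, so that coefficient is read off the n-th partial product; see f-limit.
f : (j : ℕ) → .{{NonZero j}} → Series
f j n = partialProduct j n n

private
  ≡ᵇ-false : ∀ {m n} → m ℕ.< n → (q^ n) m ≡ 0ℤ
  ≡ᵇ-false {zero}  {suc n} _           = refl
  ≡ᵇ-false {suc m} {suc n} (ℕ.s≤s m<n) = ≡ᵇ-false m<n

  factor-⊛ : ∀ m g n → n ℕ.< m → ((one ⊖ q^ m) ⊛ g) n ≡ g n
  factor-⊛ m g n n<m = begin
    (1ℤ - (q^ m) 0) * g n + sum tail
      ≡⟨ cong₂ _+_ (cong (λ z → (1ℤ - z) * g n) (≡ᵇ-false (ℕ.≤-<-trans ℕ.z≤n n<m)))
                   (trans (sum-cong-≗ tail≡0) (sum-replicate-zero n)) ⟩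
    1ℤ * g n + 0ℤ
      ≡⟨ trans (+-identityʳ (1ℤ * g n)) (*-identityˡ (g n)) ⟩
    g n ∎
    where
    open ≡-Reasoning
    tail : Vector ℤ n
    tail i = (one ⊖ q^ m) (suc (toℕ i)) * g (n ∸ suc (toℕ i))
    tail≡0 : ∀ i → tail i ≡ 0ℤ
    tail≡0 i = cong (λ z → (0ℤ - z) * g (n ∸ suc (toℕ i)))
                    (≡ᵇ-false (ℕ.≤-<-trans (toℕ<n i) n<m))
      where open import Data.Fin.Properties using (toℕ<n)

f-limit : ∀ j .{{_ : NonZero j}} {n N} → n ≤′ N → partialProduct j N n ≡ f j n
f-limit j ≤′-refl = refl
f-limit j {n} {suc N} (≤′-step n≤N) =
  trans (factor-⊛ (j ℕ.* suc N) (partialProduct j N) n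
           (ℕ.<-≤-trans (ℕ.s≤s (ℕ.≤′⇒≤ n≤N)) (ℕ.m≤n*m (suc N) j)))
        (f-limit j n≤N)

-- The coefficients of f₁³ / (f₃ f₄⁴).
a-1³3⁻¹4⁻⁴ : ℕ → ℤ
a-1³3⁻¹4⁻⁴ = f 1 ^ 3 ⊛ reciprocal (f 3 ⊛ f 4 ^ 4) refl

{-# OPTIONS --safe #-}
module Submission where

-- By the Jacobi triple product, products of two theta functions are double
-- series over ℤ², and splitting ℤ² along a sublattice of index 2 or 3 dissects
-- them.  Five such dissections combine to
--   f₁³ / f₃ = f₄³ / f₁₂ - 3 q (f₄ / f₁₂) g²,
-- where g is the theta function of -q² and -q¹⁰.  Here f₄ / f₁₂ is a product of
-- factors 1 - q⁴ᵏ, and one more dissection gives g² = u - 2 q² v with u and v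
-- series in q⁴.  After division by f₄⁴ the residue classes 0, 1 and 3 modulo 4
-- carry 1, -3 and +6 times products of factors 1 + q⁴ᵏ and 1 / (1 - q⁴ᵏ)
-- containing 1 / (1 - q⁴), and the class 2 is empty.

open import Defs
open import Algebra.Bundles using (AbelianGroup; CommutativeRing)
import Algebra.Properties.Group as GroupProperties
import Algebra.Solver.Ring as RingSolver
open import Algebra.Solver.Ring.AlmostCommutativeRing using (fromCommutativeRing; Induced-equivalence; _-Raw-AlmostCommutative⟶_)
open import Algebra.Structures using (IsCommutativeRing)
open import Data.Fin.Base as Fin using (Fin; zero; suc; toℕ; fromℕ<)
import Data.Fin.Properties as Fin
open import Data.Integer.Base as ℤ using (ℤ; +_; -[1+_]; 0ℤ; 1ℤ; -1ℤ; -_; _+_; _-_; _*_; ∣_∣; _≤_; _<_; _>_)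
open import Data.Integer.DivMod using (_%ℕ_; _/ℕ_; n%ℕd<d; a≡a%ℕn+[a/ℕn]*n)
import Data.Integer.Properties as ℤ
open import Data.Integer.Tactic.RingSolver using (solve-∀)
open import Data.List.Base as List using (List; []; _∷_; _++_; applyUpTo; cartesianProduct)
open import Data.List.Membership.Propositional using (_∈_)
import Data.List.Membership.Propositional.Properties as ∈
open import Data.List.Membership.Propositional.Properties.WithK using (unique∧set⇒bag)
open import Data.List.Relation.Binary.BagAndSetEquality using (∼bag⇒↭)
open import Data.List.Relation.Binary.Permutation.Propositional using (↭⇒↭ₛ)
import Data.List.Relation.Binary.Permutation.Propositional.Properties as ↭
import Data.List.Relation.Binary.Permutation.Setoid.Properties as ↭ₛ
open import Data.List.Relation.Unary.Unique.Propositional using (Unique; [])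
import Data.List.Relation.Unary.Unique.Propositional.Properties as Unique
open import Data.Nat.Base as ℕ using (ℕ; zero; suc; _∸_; z≤n; s≤s; NonZero)
open import Data.Nat.Divisibility using (_∣_; divides; _∣?_; _∣0; ∣-refl; ∣⇒≤; ∣m∣n⇒∣m+n; ∣m+n∣m⇒∣n; ∣n⇒∣m*n)
open import Data.Nat.DivMod using (_%_; [m+kn]%n≡m%n)
open import Data.Nat.Induction using (<-rec)
import Data.Nat.Properties as ℕ
import Data.Nat.Tactic.RingSolver as ℕSolver
open import Data.Product.Base using (_×_; _,_; proj₁; proj₂)
open import Data.Sum.Base as Sum using (_⊎_; inj₁; inj₂)
import Data.Vec.Functional as Vector
open import Function.Base using (_∘_; it)
open import Function.Bundles using (mk⇔)
open import Level using (0ℓ)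
open import Relation.Binary.Bundles using (Setoid)
open import Relation.Binary.Definitions using (WeaklyDecidable; tri<; tri≈; tri>)
open import Relation.Binary.PropositionalEquality
import Relation.Binary.Reasoning.Setoid as SetoidReasoning
open import Relation.Nullary using (yes; no; ¬_; contradiction)
open import Relation.Nullary.Decidable using (map′; dec⇒maybe; ¬?)
open import Algebra.Properties.CommutativeMonoid.Sum ℤ.+-0-commutativeMonoid using (sum-cong-≗)

-- The ring of formal power series

-- The quotient f₁³ / f₃ is not itself a product of two theta functions. Dissections apply because
-- f₁³ `p₆` = `p₃` `J₁`² (`J₁` `J₃`) (`x₁` `x₂`)³, where `J₁`² and `J₁` `J₃` are such products and
-- every other factor except `p₃` is a series in q². Multiplying the two dissections produces an
-- even and an odd part in q, each a sum of two terms. The even sum is the dissection of a square,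
-- read backwards. The odd sum is rewritten by two further dissections; their terms with q² cancel
-- because `x₁` `y₁` `y₂` = 1, a form of Euler's theorem on odd and distinct parts. The surviving
-- terms agree up to the weights 1 and 2, and this is the origin of the 3. Positivity cannot be read
-- off before the division by f₄⁴, since products of factors 1 - q⁴ᵏ have coefficients of both
-- signs. The division absorbs each of them into a denominator.

infixl 6 _⊕_
infixl 7 _⊗_

-- The ring operations are opaque so that unification does not unfold them to
-- coefficients.
opaque
  _⊕_ : Series → Series → Series
  (g ⊕ h) n = g n + h n

  ⊝_ : Series → Series
  (⊝ g) n = - g n

  _⊗_ : Series → Series → Series
  _⊗_ = _⊛_

  ⊕-at : ∀ g h n → (g ⊕ h) n ≡ g n + h n
  ⊕-at g h n = refl

  ⊝-at : ∀ g n → (⊝ g) n ≡ - g n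
  ⊝-at g n = refl

  ⊗-at : ∀ g h n → (g ⊗ h) n ≡ (g ⊛ h) n
  ⊗-at g h n = refl

zeroˢ : Series
zeroˢ _ = 0ℤ

const : ℤ → Series
const c zero    = c
const c (suc _) = 0ℤ

tail : Series → Series
tail g = g ∘ suc

-- Only indices up to n enter coefficient n of a product; compatibility of `⊗` with congruence
-- modulo q^N rests on this.
⊛-cong-upTo : ∀ n {g g′ h h′ : Series} → (∀ {i} → i ℕ.≤ n → g i ≡ g′ i) →
              (∀ {i} → i ℕ.≤ n → h i ≡ h′ i) → (g ⊛ h) n ≡ (g′ ⊛ h′) n
⊛-cong-upTo n g≡g′ h≡h′ = sum-cong-≗ λ i →
  cong₂ _*_ (g≡g′ (Fin.toℕ≤pred[n] i)) (h≡h′ (ℕ.m∸n≤m n (toℕ i)))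

⊛-cong : ∀ {g g′ h h′ : Series} → g ≗ g′ → h ≗ h′ → g ⊛ h ≗ g′ ⊛ h′
⊛-cong g≗g′ h≗h′ n = ⊛-cong-upTo n (λ {i} _ → g≗g′ i) (λ {i} _ → h≗h′ i)

const-⊛ : ∀ c g n → (const c ⊛ g) n ≡ c * g n
const-⊛ c g zero    = ℤ.+-identityʳ _
const-⊛ c g (suc n) = trans (cong (_+_ (c * g (suc n))) (rest n)) (ℤ.+-identityʳ _)
  where
  rest : ∀ n → (tail (const c) ⊛ g) n ≡ 0ℤ
  rest zero    = refl
  rest (suc n) = trans (ℤ.+-identityˡ _) (rest n)

one≗const : one ≗ const 1ℤ
one≗const zero    = refl
one≗const (suc _) = refl

⊛-identityˡ : ∀ g → one ⊛ g ≗ g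
⊛-identityˡ g n = trans (⊛-cong {h = g} one≗const (λ _ → refl) n)
                        (trans (const-⊛ 1ℤ g n) (ℤ.*-identityˡ (g n)))

-- The defining sum peels off the leading coefficient of g. Splitting off that of h at the other end
-- gives the mirrored recursion, and `⊛-comm` compares the two.
⊛-snoc : ∀ g h n → (g ⊛ h) (suc n) ≡ (g ⊛ tail h) n + g (suc n) * h 0
⊛-snoc g h zero    = lemma (g 0 * h 1) (g 1 * h 0)
  where
  lemma : ∀ x y → x + (y + 0ℤ) ≡ (x + 0ℤ) + y
  lemma = solve-∀
⊛-snoc g h (suc n) = trans (cong (_+_ (g 0 * h (suc (suc n)))) (⊛-snoc (tail g) h n))
                           (sym (ℤ.+-assoc (g 0 * h (suc (suc n))) ((tail g ⊛ tail h) n) _))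

⊛-comm : ∀ g h → g ⊛ h ≗ h ⊛ g
⊛-comm g h zero    = cong (_+ 0ℤ) (ℤ.*-comm (g 0) (h 0))
⊛-comm g h (suc n) = begin
  g 0 * h (suc n) + (tail g ⊛ h) n  ≡⟨ cong₂ _+_ (ℤ.*-comm (g 0) _) (⊛-comm (tail g) h n) ⟩
  h (suc n) * g 0 + (h ⊛ tail g) n  ≡⟨ ℤ.+-comm (h (suc n) * g 0) _ ⟩
  (h ⊛ tail g) n + h (suc n) * g 0  ≡⟨ ⊛-snoc h g n ⟨
  (h ⊛ g) (suc n)                   ∎
  where open ≡-Reasoning

opaque
  unfolding _⊕_ _⊗_

  ⊛-distribʳ : ∀ k g h → (g ⊕ h) ⊛ k ≗ (g ⊛ k) ⊕ (h ⊛ k)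
  ⊛-distribʳ k g h zero    = lemma (g 0) (h 0) (k 0)
    where
    lemma : ∀ x y z → (x + y) * z + 0ℤ ≡ (x * z + 0ℤ) + (y * z + 0ℤ)
    lemma = solve-∀
  ⊛-distribʳ k g h (suc n) = trans
    (cong (_+_ ((g 0 + h 0) * k (suc n))) (⊛-distribʳ k (tail g) (tail h) n))
    (lemma (g 0) (h 0) (k (suc n)) ((tail g ⊛ k) n) ((tail h ⊛ k) n))
    where
    lemma : ∀ x y z u v → (x + y) * z + (u + v) ≡ (x * z + u) + (y * z + v)
    lemma = solve-∀

  ⊛-assoc : ∀ g h k → (g ⊛ h) ⊛ k ≗ g ⊛ (h ⊛ k)
  ⊛-assoc g h k zero    = lemma (g 0) (h 0) (k 0)
    where
    lemma : ∀ x y z → (x * y + 0ℤ) * z + 0ℤ ≡ x * (y * z + 0ℤ) + 0ℤ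
    lemma = solve-∀
  ⊛-assoc g h k (suc n) = begin
    (g ⊛ h) 0 * k (suc n) + (tail (g ⊛ h) ⊛ k) n
      ≡⟨ cong (_+_ ((g ⊛ h) 0 * k (suc n))) (⊛-cong {h = k} tail-⊛ (λ _ → refl) n) ⟩
    (g ⊛ h) 0 * k (suc n) + ((const (g 0) ⊛ tail h ⊕ tail g ⊛ h) ⊛ k) n
      ≡⟨ cong (_+_ ((g ⊛ h) 0 * k (suc n))) (⊛-distribʳ k (const (g 0) ⊛ tail h) (tail g ⊛ h) n) ⟩
    (g ⊛ h) 0 * k (suc n) + (((const (g 0) ⊛ tail h) ⊛ k) n + ((tail g ⊛ h) ⊛ k) n)
      ≡⟨ cong (_+_ ((g ⊛ h) 0 * k (suc n))) (cong₂ _+_ (scale (tail h) n) (⊛-assoc (tail g) h k n)) ⟩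
    (g ⊛ h) 0 * k (suc n) + (g 0 * (tail h ⊛ k) n + (tail g ⊛ (h ⊛ k)) n)
      ≡⟨ lemma (g 0) (h 0) (k (suc n)) ((tail h ⊛ k) n) ((tail g ⊛ (h ⊛ k)) n) ⟩
    g 0 * (h 0 * k (suc n) + (tail h ⊛ k) n) + (tail g ⊛ (h ⊛ k)) n ∎
    where
    open ≡-Reasoning
    tail-⊛ : tail (g ⊛ h) ≗ const (g 0) ⊛ tail h ⊕ tail g ⊛ h
    tail-⊛ m = cong (_+ (tail g ⊛ h) m) (sym (const-⊛ (g 0) (tail h) m))
    scale : ∀ h′ m → ((const (g 0) ⊛ h′) ⊛ k) m ≡ g 0 * (h′ ⊛ k) m
    scale h′ zero = trans (cong (λ z → z * k 0 + 0ℤ) (const-⊛ (g 0) h′ 0)) (eq (g 0) (h′ 0) (k 0))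
      where
      eq : ∀ x y z → x * y * z + 0ℤ ≡ x * (y * z + 0ℤ)
      eq = solve-∀
    scale h′ (suc m) = trans
      (cong₂ _+_ (cong (_* k (suc m)) (const-⊛ (g 0) h′ 0))
                 (trans (⊛-cong {h = k} (λ i → trans (const-⊛ (g 0) h′ (suc i))
                                                     (sym (const-⊛ (g 0) (tail h′) i)))
                                (λ _ → refl) m)
                        (scale (tail h′) m)))
      (eq (g 0) (h′ 0) (k (suc m)) _)
      where
      eq : ∀ x y z u → x * y * z + x * u ≡ x * (y * z + u)
      eq = solve-∀
    lemma : ∀ x y z u v → (x * y + 0ℤ) * z + (x * u + v) ≡ x * (y * z + u) + v
    lemma = solve-∀

-- Unlike the function type _≗_, this record lets Agda infer both sides.
record _≋_ (g h : Series) : Set where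
  constructor pointwise
  field at : g ≗ h
open _≋_

infix 4 _≋_

opaque
  unfolding _⊕_ ⊝_ _⊗_

  isCommutativeRing : IsCommutativeRing _≋_ _⊕_ _⊗_ ⊝_ zeroˢ one
  isCommutativeRing = record
    { isRing = record
      { +-isAbelianGroup = record
        { isGroup = record
          { isMonoid = record
            { isSemigroup = record
              { isMagma = record
                { isEquivalence = record
                  { refl  = pointwise λ _ → refl
                  ; sym   = λ g≋h → pointwise λ n → sym (at g≋h n)
                  ; trans = λ g≋h h≋k → pointwise λ n → trans (at g≋h n) (at h≋k n)
                  }
                ; ∙-cong = λ g≋g′ h≋h′ → pointwise λ n → cong₂ _+_ (at g≋g′ n) (at h≋h′ n)
                }
              ; assoc = λ g h k → pointwise λ n → ℤ.+-assoc (g n) (h n) (k n)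
              }
            ; identity = (λ g → pointwise λ n → ℤ.+-identityˡ (g n))
                       , (λ g → pointwise λ n → ℤ.+-identityʳ (g n))
            }
          ; inverse = (λ g → pointwise λ n → ℤ.+-inverseˡ (g n))
                    , (λ g → pointwise λ n → ℤ.+-inverseʳ (g n))
          ; ⁻¹-cong = λ g≋h → pointwise λ n → cong -_ (at g≋h n)
          }
        ; comm = λ g h → pointwise λ n → ℤ.+-comm (g n) (h n)
        }
      ; *-cong     = λ g≋g′ h≋h′ → pointwise (⊛-cong (at g≋g′) (at h≋h′))
      ; *-assoc    = λ g h k → pointwise (⊛-assoc g h k)
      ; *-identity = (λ g → pointwise (⊛-identityˡ g))
                   , λ g → pointwise λ n → trans (⊛-comm g one n) (⊛-identityˡ g n)
      ; distrib    = (λ k g h → pointwise λ n → trans (⊛-comm k (g ⊕ h) n)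
                       (trans (⊛-distribʳ k g h n) (cong₂ _+_ (⊛-comm g k n) (⊛-comm h k n))))
                   , λ k g h → pointwise (⊛-distribʳ k g h)
      }
    ; *-comm = λ g h → pointwise (⊛-comm g h)
    }

seriesRing : CommutativeRing 0ℓ 0ℓ
seriesRing = record { isCommutativeRing = isCommutativeRing }

one≋const : one ≋ const 1ℤ
one≋const = pointwise one≗const

module S = CommutativeRing seriesRing
module ≋-Reasoning = SetoidReasoning S.setoid

const-⊗ : ∀ c g n → (const c ⊗ g) n ≡ c * g n
const-⊗ c g n = trans (⊗-at (const c) g n) (const-⊛ c g n)

const-⊗-homo : ∀ c d → const (c * d) ≋ const c ⊗ const d
const-⊗-homo c d = pointwise λ n → sym (trans (const-⊗ c (const d) n) (lemma n))
  where
  lemma : ∀ n → c * const d n ≡ const (c * d) n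
  lemma zero    = refl
  lemma (suc n) = ℤ.*-zeroʳ c

-- Integer constants enter the ring solver through this map, so the solver knows 1 only as
-- `const 1ℤ`. As `one` is `q^ 0`, proofs that compute with 1 pass through `one≋const`.
const-morphism : CommutativeRing.rawRing ℤ.+-*-commutativeRing
                 -Raw-AlmostCommutative⟶ fromCommutativeRing seriesRing
const-morphism = record
  { ⟦_⟧    = const
  ; +-homo = λ c d → pointwise λ { zero → sym (⊕-at (const c) (const d) 0)
                                   ; (suc n) → sym (⊕-at (const c) (const d) (suc n)) }
  ; *-homo = const-⊗-homo
  ; -‿homo = λ c → pointwise λ { zero → sym (⊝-at (const c) 0) ; (suc n) → sym (⊝-at (const c) (suc n)) }
  ; 0-homo = pointwise λ { zero → refl ; (suc n) → refl }
  ; 1-homo = S.sym one≋const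
  }

const≟ : WeaklyDecidable (Induced-equivalence const-morphism)
const≟ c d = dec⇒maybe (map′ (λ { refl → S.refl }) (λ c≋d → at c≋d 0) (c ℤ.≟ d))

module Solver = RingSolver (CommutativeRing.rawRing ℤ.+-*-commutativeRing)
  (fromCommutativeRing seriesRing) const-morphism const≟
open Solver using (solve; _:=_; _:+_; _:*_; con)

⊗-medial : ∀ g h k l → (g ⊗ h) ⊗ (k ⊗ l) ≋ (g ⊗ k) ⊗ (h ⊗ l)
⊗-medial = solve 4 (λ g h k l → (g :* h) :* (k :* l) := (g :* k) :* (h :* l)) S.refl

⊗-swap : ∀ g h k → g ⊗ (h ⊗ k) ≋ h ⊗ (g ⊗ k)
⊗-swap = solve 3 (λ g h k → g :* (h :* k) := h :* (g :* k)) S.refl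

-- Congruence modulo q^N and infinite products

record _≈[_]_ (g : Series) (N : ℕ) (h : Series) : Set where
  constructor mod-q
  field coeff : ∀ {n} → n ℕ.< N → g n ≡ h n
open _≈[_]_

infix 4 _≈[_]_

≋⇒≈ : ∀ {N g h} → g ≋ h → g ≈[ N ] h
≋⇒≈ g≋h = mod-q λ {n} _ → at g≋h n

≈⇒≋ : ∀ {g h} → (∀ N → g ≈[ N ] h) → g ≋ h
≈⇒≋ g≈h = pointwise λ n → coeff (g≈h (suc n)) ℕ.≤-refl

≈-setoid : ℕ → Setoid 0ℓ 0ℓ
≈-setoid N = record
  { Carrier       = Series
  ; _≈_           = _≈[ N ]_
  ; isEquivalence = record
    { refl  = mod-q λ _ → refl
    ; sym   = λ g≈h → mod-q λ n<N → sym (coeff g≈h n<N)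
    ; trans = λ g≈h h≈k → mod-q λ n<N → trans (coeff g≈h n<N) (coeff h≈k n<N)
    }
  }

module _ {N : ℕ} where
  open Setoid (≈-setoid N) public using ()
    renaming (refl to ≈-refl; sym to ≈-sym; trans to ≈-trans)

≈-weaken : ∀ {M N g h} → M ℕ.≤ N → g ≈[ N ] h → g ≈[ M ] h
≈-weaken M≤N g≈h = mod-q λ n<M → coeff g≈h (ℕ.<-≤-trans n<M M≤N)

⊕-≈ : ∀ {N g g′ h h′} → g ≈[ N ] g′ → h ≈[ N ] h′ → g ⊕ h ≈[ N ] g′ ⊕ h′
⊕-≈ {g = g} {g′} {h} {h′} g≈g′ h≈h′ = mod-q λ {n} n<N →
  subst₂ _≡_ (sym (⊕-at g h n)) (sym (⊕-at g′ h′ n)) (cong₂ _+_ (coeff g≈g′ n<N) (coeff h≈h′ n<N))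

⊗-≈ : ∀ {N g g′ h h′} → g ≈[ N ] g′ → h ≈[ N ] h′ → g ⊗ h ≈[ N ] g′ ⊗ h′
⊗-≈ {g = g} {g′} {h} {h′} g≈g′ h≈h′ = mod-q λ {n} n<N →
  subst₂ _≡_ (sym (⊗-at g h n)) (sym (⊗-at g′ h′ n))
    (⊛-cong-upTo n {g} {g′} {h} {h′} (λ i≤n → coeff g≈g′ (ℕ.≤-<-trans i≤n n<N))
                                     (λ i≤n → coeff h≈h′ (ℕ.≤-<-trans i≤n n<N)))

q^-< : ∀ {n e} → n ℕ.< e → (q^ e) n ≡ 0ℤ
q^-< {zero}  {suc e} _         = refl
q^-< {suc n} {suc e} (s≤s n<e) = q^-< n<e

q^-suc-⊗-zero : ∀ e g → (q^ suc e ⊗ g) 0 ≡ 0ℤ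
q^-suc-⊗-zero e g = ⊗-at (q^ suc e) g 0

q^-suc-⊗-suc : ∀ e g n → (q^ suc e ⊗ g) (suc n) ≡ (q^ e ⊗ g) n
q^-suc-⊗-suc e g n = begin
  (q^ suc e ⊗ g) (suc n)  ≡⟨ ⊗-at (q^ suc e) g (suc n) ⟩
  0ℤ + (q^ e ⊛ g) n       ≡⟨ ℤ.+-identityˡ ((q^ e ⊛ g) n) ⟩
  (q^ e ⊛ g) n            ≡⟨ ⊗-at (q^ e) g n ⟨
  (q^ e ⊗ g) n            ∎
  where open ≡-Reasoning

-- The error is multiplied by q^e as well, hence the gain of e in precision. Both `poch-gauss` and
-- the passage to the limit in the triple product live on this gain.
q^-⊗-≈ : ∀ e {N g h} → g ≈[ N ] h → q^ e ⊗ g ≈[ e ℕ.+ N ] q^ e ⊗ h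
q^-⊗-≈ zero    g≈h = ⊗-≈ ≈-refl g≈h
q^-⊗-≈ (suc e) {N} {g} {h} g≈h = mod-q go
  where
  go : ∀ {n} → n ℕ.< suc e ℕ.+ N → (q^ suc e ⊗ g) n ≡ (q^ suc e ⊗ h) n
  go {zero}  _         = trans (q^-suc-⊗-zero e g) (sym (q^-suc-⊗-zero e h))
  go {suc n} (s≤s n<N) = trans (q^-suc-⊗-suc e g n) (trans (coeff (q^-⊗-≈ e g≈h) n<N) (sym (q^-suc-⊗-suc e h n)))

q^-+ : ∀ m n → q^ (m ℕ.+ n) ≋ q^ m ⊗ q^ n
q^-+ zero    n = S.sym (S.*-identityˡ (q^ n))
q^-+ (suc m) n = pointwise λ
  { zero    → sym (q^-suc-⊗-zero m (q^ n))
  ; (suc i) → trans (at (q^-+ m n) i) (sym (q^-suc-⊗-suc m (q^ n) i)) }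

1+_q^_ : ℤ → ℕ → Series
1+ ε q^ c = one ⊕ const ε ⊗ q^ c

1+q^-≈ : ∀ ε {c N} → N ℕ.≤ c → 1+ ε q^ c ≈[ N ] one
1+q^-≈ ε {c} N≤c = mod-q λ {n} n<N → begin
  (1+ ε q^ c) n               ≡⟨ ⊕-at one (const ε ⊗ q^ c) n ⟩
  one n + (const ε ⊗ q^ c) n  ≡⟨ cong (_+_ (one n)) (const-⊗ ε (q^ c) n) ⟩
  one n + ε * (q^ c) n        ≡⟨ cong (λ z → one n + ε * z) (q^-< (ℕ.<-≤-trans n<N N≤c)) ⟩
  one n + ε * 0ℤ              ≡⟨ cong (_+_ (one n)) (ℤ.*-zeroʳ ε) ⟩
  one n + 0ℤ                  ≡⟨ ℤ.+-identityʳ (one n) ⟩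
  one n                       ∎
  where open ≡-Reasoning

-- Coefficient n is read at index n + 1 because `s N` is guaranteed to be final only modulo q^N. For
-- `poch` with a = 0 the step from index 0 to index 1 does change the constant term.
limit : (ℕ → Series) → Series
limit s n = s (suc n) n

limit-≈ : ∀ s → (∀ N → s (suc N) ≈[ N ] s N) → ∀ N → s N ≈[ N ] limit s
limit-≈ s step N = mod-q λ {n} n<N → go (ℕ.≤⇒≤′ n<N)
  where
  go : ∀ {n N} → suc n ℕ.≤′ N → s N n ≡ limit s n
  go ℕ.≤′-refl          = refl
  go (ℕ.≤′-step {N} n<N) = trans (coeff (step N) (ℕ.≤′⇒≤ n<N)) (go n<N)

poch : ℤ → ℕ → ℕ → ℕ → Series
poch ε a M zero    = one
poch ε a M (suc N) = (1+ ε q^ (a ℕ.+ N ℕ.* M)) ⊗ poch ε a M N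

P : ℤ → (a M : ℕ) → .{{NonZero M}} → Series
P ε a M = limit (poch ε a M)

one-⊗-≈ : ∀ {N g} h → g ≈[ N ] one → g ⊗ h ≈[ N ] h
one-⊗-≈ h g≈1 = ≈-trans (⊗-≈ g≈1 ≈-refl) (≋⇒≈ (S.*-identityˡ h))

poch-≈ : ∀ ε a M .{{_ : NonZero M}} N → poch ε a M N ≈[ N ] P ε a M
poch-≈ ε a M = limit-≈ (poch ε a M) λ N →
  one-⊗-≈ _ (1+q^-≈ ε (ℕ.≤-trans (ℕ.m≤m*n N M) (ℕ.m≤n+m _ a)))

one⊖q^≋ : ∀ c → one ⊖ q^ c ≋ 1+ -1ℤ q^ c
one⊖q^≋ c = pointwise λ n → sym (trans (⊕-at one (const -1ℤ ⊗ q^ c) n)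
  (cong (_+_ (one n)) (trans (const-⊗ -1ℤ (q^ c) n) (ℤ.-1*i≡-i ((q^ c) n)))))

f≋P : ∀ j .{{_ : NonZero j}} → f j ≋ P -1ℤ j j
-- For coefficient n, `f` takes n factors and `limit` takes n + 1; `f-limit` bridges the difference.
f≋P j = pointwise λ n → trans (sym (f-limit j (ℕ.≤′-step ℕ.≤′-refl))) (at (finite (suc n)) n)
  where
  finite : ∀ N → partialProduct j N ≋ poch -1ℤ j j N
  finite zero    = S.refl
  finite (suc N) = S.trans
    (pointwise λ n → sym (⊗-at (one ⊖ q^ (j ℕ.* suc N)) (partialProduct j N) n))
    (S.*-cong (S.trans (S.reflexive (cong (λ c → one ⊖ q^ c) (ℕ.*-comm j (suc N))))
                       (one⊖q^≋ (suc N ℕ.* j)))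
              (finite N))

-- Identities between infinite products are checked on truncations. For each N a congruence modulo
-- q^N suffices, so the two sides may be cut at different lengths.
P-product : ∀ (g : Series) (h k : ℕ → Series) {h∞ k∞ : Series} →
            (∀ N → h N ≈[ N ] h∞) → (∀ N → k N ≈[ N ] k∞) →
            (∀ N → g ≈[ N ] h N ⊗ k N) → g ≋ h∞ ⊗ k∞
P-product g h k h≈ k≈ g≈hk = ≈⇒≋ λ N → ≈-trans (g≈hk N) (⊗-≈ (h≈ N) (k≈ N))

P-head : ∀ ε a M .{{_ : NonZero M}} → P ε a M ≋ (1+ ε q^ a) ⊗ P ε (a ℕ.+ M) M
P-head ε a M = P-product (P ε a M) (λ _ → 1+ ε q^ a) (poch ε (a ℕ.+ M) M) (λ _ → ≈-refl)
  (poch-≈ ε (a ℕ.+ M) M)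
  λ N → ≈-trans (≈-sym (≈-weaken (ℕ.n≤1+n N) (poch-≈ ε a M (suc N)))) (≋⇒≈ (finite N))
  where
  eq : ∀ a N M → a ℕ.+ (M ℕ.+ N ℕ.* M) ≡ a ℕ.+ M ℕ.+ N ℕ.* M
  eq = ℕSolver.solve-∀
  finite : ∀ N → poch ε a M (suc N) ≋ (1+ ε q^ a) ⊗ poch ε (a ℕ.+ M) M N
  finite zero    = S.*-congʳ (S.reflexive (cong (1+ ε q^_) (ℕ.+-identityʳ a)))
  finite (suc N) = begin
    u ⊗ poch ε a M (suc N)                              ≈⟨ S.*-cong (S.reflexive (cong (1+ ε q^_) (eq a N M))) (finite N) ⟩
    v ⊗ ((1+ ε q^ a) ⊗ w)                               ≈⟨ ⊗-swap v (1+ ε q^ a) w ⟩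
    (1+ ε q^ a) ⊗ (v ⊗ w)                               ∎
    where
    open ≋-Reasoning
    u v w : Series
    u = 1+ ε q^ (a ℕ.+ suc N ℕ.* M)
    v = 1+ ε q^ (a ℕ.+ M ℕ.+ N ℕ.* M)
    w = poch ε (a ℕ.+ M) M N

P-bisect : ∀ ε a M .{{_ : NonZero M}} .{{_ : NonZero (2 ℕ.* M)}} →
           P ε a M ≋ P ε a (2 ℕ.* M) ⊗ P ε (a ℕ.+ M) (2 ℕ.* M)
P-bisect ε a M = P-product (P ε a M) (poch ε a (2 ℕ.* M)) (poch ε (a ℕ.+ M) (2 ℕ.* M))
  (poch-≈ ε a (2 ℕ.* M)) (poch-≈ ε (a ℕ.+ M) (2 ℕ.* M))
  λ N → ≈-trans (≈-sym (≈-weaken (ℕ.m≤m*n N 2) (poch-≈ ε a M (N ℕ.* 2)))) (≋⇒≈ (finite N))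
  where
  e₀ : ∀ a N M → a ℕ.+ N ℕ.* 2 ℕ.* M ≡ a ℕ.+ N ℕ.* (2 ℕ.* M)
  e₀ = ℕSolver.solve-∀
  e₁ : ∀ a N M → a ℕ.+ (M ℕ.+ N ℕ.* 2 ℕ.* M) ≡ a ℕ.+ M ℕ.+ N ℕ.* (2 ℕ.* M)
  e₁ = ℕSolver.solve-∀
  interleave : ∀ x y z w → y ⊗ (x ⊗ (z ⊗ w)) ≋ (x ⊗ z) ⊗ (y ⊗ w)
  interleave = solve 4 (λ x y z w → y :* (x :* (z :* w)) := (x :* z) :* (y :* w)) S.refl
  finite : ∀ N → poch ε a M (N ℕ.* 2) ≋ poch ε a (2 ℕ.* M) N ⊗ poch ε (a ℕ.+ M) (2 ℕ.* M) N
  finite zero    = S.sym (S.*-identityˡ one)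
  finite (suc N) = S.trans
    (S.*-cong (S.reflexive (cong (1+ ε q^_) (e₁ a N M)))
      (S.*-cong (S.reflexive (cong (1+ ε q^_) (e₀ a N M))) (finite N)))
    (interleave _ _ _ _)

P-trisect : ∀ ε a M .{{_ : NonZero M}} .{{_ : NonZero (3 ℕ.* M)}} →
            P ε a M ≋ (P ε a (3 ℕ.* M) ⊗ P ε (a ℕ.+ M) (3 ℕ.* M)) ⊗ P ε (a ℕ.+ 2 ℕ.* M) (3 ℕ.* M)
P-trisect ε a M = P-product (P ε a M) (λ N → p₀ N ⊗ p₁ N) p₂
  (λ N → ⊗-≈ (poch-≈ ε a (3 ℕ.* M) N) (poch-≈ ε (a ℕ.+ M) (3 ℕ.* M) N))
  (poch-≈ ε (a ℕ.+ 2 ℕ.* M) (3 ℕ.* M))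
  λ N → ≈-trans (≈-sym (≈-weaken (ℕ.m≤m*n N 3) (poch-≈ ε a M (N ℕ.* 3)))) (≋⇒≈ (finite N))
  where
  p₀ p₁ p₂ : ℕ → Series
  p₀ = poch ε a (3 ℕ.* M)
  p₁ = poch ε (a ℕ.+ M) (3 ℕ.* M)
  p₂ = poch ε (a ℕ.+ 2 ℕ.* M) (3 ℕ.* M)
  e₀ : ∀ a N M → a ℕ.+ N ℕ.* 3 ℕ.* M ≡ a ℕ.+ N ℕ.* (3 ℕ.* M)
  e₀ = ℕSolver.solve-∀
  e₁ : ∀ a N M → a ℕ.+ (M ℕ.+ N ℕ.* 3 ℕ.* M) ≡ a ℕ.+ M ℕ.+ N ℕ.* (3 ℕ.* M)
  e₁ = ℕSolver.solve-∀
  e₂ : ∀ a N M → a ℕ.+ (M ℕ.+ (M ℕ.+ N ℕ.* 3 ℕ.* M)) ≡ a ℕ.+ 2 ℕ.* M ℕ.+ N ℕ.* (3 ℕ.* M)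
  e₂ = ℕSolver.solve-∀
  interleave : ∀ x y z u v w →
               z ⊗ (y ⊗ (x ⊗ ((u ⊗ v) ⊗ w))) ≋ ((x ⊗ u) ⊗ (y ⊗ v)) ⊗ (z ⊗ w)
  interleave = solve 6 (λ x y z u v w → z :* (y :* (x :* ((u :* v) :* w)))
                                        := ((x :* u) :* (y :* v)) :* (z :* w)) S.refl
  finite : ∀ N → poch ε a M (N ℕ.* 3) ≋ (p₀ N ⊗ p₁ N) ⊗ p₂ N
  finite zero    = S.sym (S.trans (S.*-identityʳ _) (S.*-identityˡ one))
  finite (suc N) = S.trans
    (S.*-cong (S.reflexive (cong (1+ ε q^_) (e₂ a N M)))
      (S.*-cong (S.reflexive (cong (1+ ε q^_) (e₁ a N M)))
        (S.*-cong (S.reflexive (cong (1+ ε q^_) (e₀ a N M))) (finite N))))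
    (interleave _ _ _ _ _ _)

-- Factor by factor this is 1 - x² = (1 - x)(1 + x) with x = q^(a + N M).
P-∓ : ∀ a M .{{_ : NonZero M}} .{{_ : NonZero (2 ℕ.* M)}} →
      P -1ℤ (2 ℕ.* a) (2 ℕ.* M) ≋ P -1ℤ a M ⊗ P 1ℤ a M
P-∓ a M = P-product (P -1ℤ (2 ℕ.* a) (2 ℕ.* M)) (poch -1ℤ a M) (poch 1ℤ a M)
  (poch-≈ -1ℤ a M) (poch-≈ 1ℤ a M)
  λ N → ≈-trans (≈-sym (poch-≈ -1ℤ (2 ℕ.* a) (2 ℕ.* M) N)) (≋⇒≈ (finite N))
  where
  eq : ∀ a N M → 2 ℕ.* a ℕ.+ N ℕ.* (2 ℕ.* M) ≡ (a ℕ.+ N ℕ.* M) ℕ.+ (a ℕ.+ N ℕ.* M)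
  eq = ℕSolver.solve-∀
  square : ∀ x → one ⊕ const -1ℤ ⊗ (x ⊗ x) ≋ (one ⊕ const -1ℤ ⊗ x) ⊗ (one ⊕ const 1ℤ ⊗ x)
  square x = S.trans (S.+-congʳ one≋const)
    (S.trans (eq′ x) (S.*-cong (S.+-congʳ (S.sym one≋const)) (S.+-congʳ (S.sym one≋const))))
    where
    eq′ : ∀ x → const 1ℤ ⊕ const -1ℤ ⊗ (x ⊗ x) ≋ (const 1ℤ ⊕ const -1ℤ ⊗ x) ⊗ (const 1ℤ ⊕ const 1ℤ ⊗ x)
    eq′ = solve 1 (λ x → con 1ℤ :+ con -1ℤ :* (x :* x)
                       := (con 1ℤ :+ con -1ℤ :* x) :* (con 1ℤ :+ con 1ℤ :* x)) S.refl
  factor : ∀ c → 1+ -1ℤ q^ (c ℕ.+ c) ≋ (1+ -1ℤ q^ c) ⊗ (1+ 1ℤ q^ c)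
  factor c = S.trans (S.+-congˡ (S.*-congˡ (q^-+ c c))) (square (q^ c))
  finite : ∀ N → poch -1ℤ (2 ℕ.* a) (2 ℕ.* M) N ≋ poch -1ℤ a M N ⊗ poch 1ℤ a M N
  finite zero    = S.sym (S.*-identityˡ one)
  finite (suc N) = S.trans
    (S.*-cong (S.trans (S.reflexive (cong (1+ -1ℤ q^_) (eq a N M))) (factor _)) (finite N))
    (⊗-medial _ _ _ _)

-- Summable families

∑ : {I : Set} → List I → (I → Series) → Series
∑ []      F = zeroˢ
∑ (i ∷ L) F = F i ⊕ ∑ L F

sumℤ : {I : Set} → List I → (I → ℤ) → ℤ
sumℤ L g = List.foldr _+_ 0ℤ (List.map g L)

∑-at : ∀ {I : Set} L (F : I → Series) n → ∑ L F n ≡ sumℤ L (λ i → F i n)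
∑-at []      F n = refl
∑-at (i ∷ L) F n = trans (⊕-at (F i) (∑ L F) n) (cong (_+_ (F i n)) (∑-at L F n))

-- Removing the indices of value 0 leaves two duplicate-free lists with the same elements, hence
-- permutations of each other.
sumℤ-support : ∀ {I : Set} (g : I → ℤ) {L L′} → Unique L → Unique L′ →
               (∀ i → i ∈ L ⊎ g i ≡ 0ℤ) → (∀ i → i ∈ L′ ⊎ g i ≡ 0ℤ) → sumℤ L g ≡ sumℤ L′ g
sumℤ-support {I} g {L} {L′} uniq uniq′ covers covers′ = begin
  sumℤ L g            ≡⟨ sumℤ-filter L ⟨
  sumℤ (support L) g  ≡⟨ ↭ₛ.foldr-commMonoid (setoid ℤ) ℤ.+-0-isCommutativeMonoid (↭⇒↭ₛ (↭.map⁺ g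
                           (∼bag⇒↭ (unique∧set⇒bag (Unique.filter⁺ g≢0? uniq) (Unique.filter⁺ g≢0? uniq′)
                             (mk⇔ (move L covers′) (move L′ covers)))))) ⟩
  sumℤ (support L′) g ≡⟨ sumℤ-filter L′ ⟩
  sumℤ L′ g           ∎
  where
  open ≡-Reasoning
  g≢0? = λ i → ¬? (g i ℤ.≟ 0ℤ)
  support : List I → List I
  support = List.filter g≢0?
  move : ∀ L {L′} → (∀ i → i ∈ L′ ⊎ g i ≡ 0ℤ) → ∀ {i} → i ∈ support L → i ∈ support L′
  move L covers′ {i} i∈ with ∈.∈-filter⁻ g≢0? {xs = L} i∈ | covers′ i
  ... | _ , gi≢0 | inj₁ i∈L′ = ∈.∈-filter⁺ g≢0? i∈L′ gi≢0
  ... | _ , gi≢0 | inj₂ gi≡0 = contradiction gi≡0 gi≢0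
  sumℤ-filter : ∀ L → sumℤ (support L) g ≡ sumℤ L g
  sumℤ-filter [] = refl
  sumℤ-filter (i ∷ L) with g i ℤ.≟ 0ℤ
  ... | no  _    = cong (_+_ (g i)) (sumℤ-filter L)
  ... | yes gi≡0 = trans (sumℤ-filter L) (sym (trans (cong (_+ sumℤ L g) gi≡0) (ℤ.+-identityˡ (sumℤ L g))))

-- This is unordered q-adic summation: modulo q^N finitely many indices matter, and any
-- duplicate-free list containing them computes the sum. Since no order on the indices is fixed, a
-- double series can be rearranged along any bijection.
record Enumeration {I : Set} (N : ℕ) (F : I → Series) (s : Series) : Set where
  field
    list   : List I
    unique : Unique list
    covers : ∀ i → i ∈ list ⊎ F i ≈[ N ] zeroˢ
    total  : s ≈[ N ] ∑ list F
open Enumeration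

SumsTo : {I : Set} → (I → Series) → Series → Set
SumsTo F s = ∀ N → Enumeration N F s

-- Every dissection is an appeal to this: one double family is summed once as a product and once
-- class by class.
SumsTo-unique : ∀ {I : Set} {F : I → Series} {s t} → SumsTo F s → SumsTo F t → s ≋ t
SumsTo-unique {F = F} {s} {t} F→s F→t = ≈⇒≋ λ N → mod-q (go (F→s N) (F→t N))
  where
  go : ∀ {N} → Enumeration N F s → Enumeration N F t → ∀ {n} → n ℕ.< N → s n ≡ t n
  go e e′ {n} n<N = begin
    s n                            ≡⟨ coeff (total e) n<N ⟩
    ∑ (list e) F n                 ≡⟨ ∑-at (list e) F n ⟩
    sumℤ (list e) (λ i → F i n)    ≡⟨ sumℤ-support (λ i → F i n) (unique e) (unique e′) (at-n e) (at-n e′) ⟩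
    sumℤ (list e′) (λ i → F i n)   ≡⟨ ∑-at (list e′) F n ⟨
    ∑ (list e′) F n                ≡⟨ coeff (total e′) n<N ⟨
    t n                            ∎
    where
    open ≡-Reasoning
    at-n : ∀ {u} (e : Enumeration _ F u) i → i ∈ list e ⊎ F i n ≡ 0ℤ
    at-n e i with covers e i
    ... | inj₁ i∈L = inj₁ i∈L
    ... | inj₂ F≈0 = inj₂ (coeff F≈0 n<N)

∑-≋ : ∀ {I : Set} L {F G : I → Series} → (∀ i → F i ≋ G i) → ∑ L F ≋ ∑ L G
∑-≋ []      F≋G = S.refl
∑-≋ (i ∷ L) F≋G = S.+-cong (F≋G i) (∑-≋ L F≋G)

∑-⊗ˡ : ∀ {I : Set} (s : Series) L (F : I → Series) → s ⊗ ∑ L F ≋ ∑ L (λ i → s ⊗ F i)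
∑-⊗ˡ s []      F = S.zeroʳ s
∑-⊗ˡ s (i ∷ L) F = S.trans (S.distribˡ s (F i) (∑ L F)) (S.+-congˡ (∑-⊗ˡ s L F))

∑-++ : ∀ {I : Set} L L′ (F : I → Series) → ∑ (L ++ L′) F ≋ ∑ L F ⊕ ∑ L′ F
∑-++ []      L′ F = S.sym (S.+-identityˡ (∑ L′ F))
∑-++ (i ∷ L) L′ F = S.trans (S.+-congˡ (∑-++ L L′ F)) (S.sym (S.+-assoc (F i) (∑ L F) (∑ L′ F)))

∑-map : ∀ {I J : Set} (f : J → I) L (F : I → Series) → ∑ (List.map f L) F ≋ ∑ L (F ∘ f)
∑-map f []      F = S.refl
∑-map f (j ∷ L) F = S.+-congˡ (∑-map f L F)

∑-product : ∀ {I J : Set} L L′ (F : I → Series) (G : J → Series) →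
            ∑ L F ⊗ ∑ L′ G ≋ ∑ (cartesianProduct L L′) (λ ij → F (proj₁ ij) ⊗ G (proj₂ ij))
∑-product []      L′ F G = S.zeroˡ (∑ L′ G)
∑-product (i ∷ L) L′ F G = begin
  (F i ⊕ ∑ L F) ⊗ ∑ L′ G             ≈⟨ S.distribʳ (∑ L′ G) (F i) (∑ L F) ⟩
  F i ⊗ ∑ L′ G ⊕ ∑ L F ⊗ ∑ L′ G      ≈⟨ S.+-cong (S.trans (∑-⊗ˡ (F i) L′ G) (S.sym (∑-map (i ,_) L′ FG)))
                                                 (∑-product L L′ F G) ⟩
  ∑ (List.map (i ,_) L′) FG ⊕ ∑ (cartesianProduct L L′) FG  ≈⟨ ∑-++ (List.map (i ,_) L′) _ FG ⟨
  ∑ (cartesianProduct (i ∷ L) L′) FG ∎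
  where
  open ≋-Reasoning
  FG = λ ij → F (proj₁ ij) ⊗ G (proj₂ ij)

SumsTo-cong : ∀ {I : Set} {F G : I → Series} {s t} → (∀ i → F i ≋ G i) → s ≋ t →
              SumsTo F s → SumsTo G t
SumsTo-cong F≋G s≋t F→s N = record
  { list   = list e
  ; unique = unique e
  ; covers = λ i → Sum.map₂ (≈-trans (≋⇒≈ (S.sym (F≋G i)))) (covers e i)
  ; total  = ≈-trans (≋⇒≈ (S.sym s≋t)) (≈-trans (total e) (≋⇒≈ (∑-≋ (list e) F≋G)))
  }
  where
  e = F→s N

⊗-≈-zeroˡ : ∀ {N g} h → g ≈[ N ] zeroˢ → g ⊗ h ≈[ N ] zeroˢ
⊗-≈-zeroˡ h g≈0 = ≈-trans (⊗-≈ g≈0 ≈-refl) (≋⇒≈ (S.zeroˡ h))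

⊗-≈-zeroʳ : ∀ {N h} g → h ≈[ N ] zeroˢ → g ⊗ h ≈[ N ] zeroˢ
⊗-≈-zeroʳ g h≈0 = ≈-trans (⊗-≈ ≈-refl h≈0) (≋⇒≈ (S.zeroʳ g))

SumsTo-⊗ : ∀ {I J : Set} {F : I → Series} {G : J → Series} {s t} → SumsTo F s → SumsTo G t →
           SumsTo (λ ij → F (proj₁ ij) ⊗ G (proj₂ ij)) (s ⊗ t)
SumsTo-⊗ {F = F} {G} F→s G→t N = record
  { list   = cartesianProduct (list e) (list e′)
  ; unique = Unique.cartesianProduct⁺ (unique e) (unique e′)
  ; covers = λ (i , j) → cover i j (covers e i) (covers e′ j)
  ; total  = ≈-trans (⊗-≈ (total e) (total e′)) (≋⇒≈ (∑-product (list e) (list e′) F G))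
  }
  where
  e = F→s N
  e′ = G→t N
  cover : ∀ i j → i ∈ list e ⊎ F i ≈[ N ] zeroˢ → j ∈ list e′ ⊎ G j ≈[ N ] zeroˢ →
          (i , j) ∈ cartesianProduct (list e) (list e′) ⊎ F i ⊗ G j ≈[ N ] zeroˢ
  cover i j (inj₁ i∈) (inj₁ j∈) = inj₁ (∈.∈-cartesianProduct⁺ i∈ j∈)
  cover i j (inj₂ F≈) _         = inj₂ (⊗-≈-zeroˡ (G j) F≈)
  cover i j _         (inj₂ G≈) = inj₂ (⊗-≈-zeroʳ (F i) G≈)

SumsTo-scale : ∀ {I : Set} {F : I → Series} {s} c → SumsTo F s → SumsTo (λ i → c ⊗ F i) (c ⊗ s)
SumsTo-scale {F = F} c F→s N = record
  { list   = list e
  ; unique = unique e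
  ; covers = λ i → Sum.map₂ (⊗-≈-zeroʳ c) (covers e i)
  ; total  = ≈-trans (⊗-≈ ≈-refl (total e)) (≋⇒≈ (∑-⊗ˡ c (list e) F))
  }
  where
  e = F→s N

SumsTo-reindex : ∀ {I J : Set} {F : I → Series} {s} (f : J → I) (f⁻¹ : I → J) →
                 (∀ {j k} → f j ≡ f k → j ≡ k) → (∀ i → f (f⁻¹ i) ≡ i) →
                 SumsTo (F ∘ f) s → SumsTo F s
SumsTo-reindex {F = F} f f⁻¹ injective inverse F→s N = record
  { list   = List.map f (list e)
  ; unique = Unique.map⁺ injective (unique e)
  ; covers = cover
  ; total  = ≈-trans (total e) (≋⇒≈ (S.sym (∑-map f (list e) F)))
  }
  where
  e = F→s N
  cover : ∀ i → i ∈ List.map f (list e) ⊎ F i ≈[ N ] zeroˢ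
  cover i with covers e (f⁻¹ i)
  ... | inj₁ ∈L = inj₁ (subst (_∈ List.map f (list e)) (inverse i) (∈.∈-map⁺ f ∈L))
  ... | inj₂ F≈ = inj₂ (subst (λ i → F i ≈[ N ] zeroˢ) (inverse i) F≈)

∑Fin : ∀ {d} → (Fin d → Series) → Series
∑Fin = Vector.foldr _⊕_ zeroˢ

SumsTo-Fin : ∀ {J : Set} d {F : Fin d → J → Series} {s : Fin d → Series} →
             (∀ ρ → SumsTo (F ρ) (s ρ)) → SumsTo (λ ρj → F (proj₁ ρj) (proj₂ ρj)) (∑Fin s)
SumsTo-Fin zero    F→s N = record
  { list = [] ; unique = [] ; covers = λ () ; total = ≈-refl }
SumsTo-Fin {J} (suc d) {F} F→s N = record
  { list   = List.map inl (list e) ++ List.map inr (list e′)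
  ; unique = Unique.++⁺ (Unique.map⁺ (λ { refl → refl }) (unique e))
                        (Unique.map⁺ (λ { refl → refl }) (unique e′)) disjoint
  ; covers = λ { (zero , j) → cover₀ j ; (suc ρ , j) → cover₁ ρ j }
  ; total  = ≈-trans (⊕-≈ (total e) (total e′)) (≋⇒≈ (S.sym (S.trans
               (∑-++ (List.map inl (list e)) (List.map inr (list e′)) F′)
               (S.+-cong (∑-map inl (list e) F′) (∑-map inr (list e′) F′)))))
  }
  where
  e  = F→s zero N
  e′ = SumsTo-Fin d (F→s ∘ suc) N
  F′ : Fin (suc d) × J → Series
  F′ (ρ , j) = F ρ j
  inl : J → Fin (suc d) × J
  inl j = zero , j
  inr : Fin d × J → Fin (suc d) × J
  inr (ρ , j) = suc ρ , j
  disjoint : ∀ {x} → ¬ (x ∈ List.map inl (list e) × x ∈ List.map inr (list e′))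
  disjoint (∈₀ , ∈₁) with ∈.∈-map⁻ inl ∈₀ | ∈.∈-map⁻ inr ∈₁
  ... | _ , _ , refl | _ , _ , ()
  cover₀ : ∀ j → (zero , j) ∈ List.map inl (list e) ++ List.map inr (list e′) ⊎ F zero j ≈[ N ] zeroˢ
  cover₀ j = Sum.map₁ (λ j∈ → ∈.∈-++⁺ˡ (∈.∈-map⁺ inl j∈)) (covers e j)
  cover₁ : ∀ ρ j → (suc ρ , j) ∈ List.map inl (list e) ++ List.map inr (list e′) ⊎ F (suc ρ) j ≈[ N ] zeroˢ
  cover₁ ρ j = Sum.map₁ (λ j∈ → ∈.∈-++⁺ʳ (List.map inl (list e)) (∈.∈-map⁺ inr j∈))
                                  (covers e′ (ρ , j))

-- The Jacobi triple product

triangle : ℕ → ℕ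
triangle zero    = 0
triangle (suc n) = suc n ℕ.+ triangle n

-- tri j = j (j + 1) / 2
tri : ℤ → ℕ
tri (+ n)    = triangle n
tri -[1+ n ] = triangle n

triangle-double : ∀ n → + 2 * + triangle n ≡ + n * + n + + n
triangle-double zero    = refl
triangle-double (suc n) = trans (step (+ n) (+ triangle n)) (trans (cong (_+_ (+ 2 * (1ℤ + + n))) (triangle-double n)) (step′ (+ n)))
  where
  step : ∀ x t → + 2 * ((1ℤ + x) + t) ≡ + 2 * (1ℤ + x) + + 2 * t
  step = solve-∀
  step′ : ∀ x → + 2 * (1ℤ + x) + (x * x + x) ≡ (1ℤ + x) * (1ℤ + x) + (1ℤ + x)
  step′ = solve-∀

tri-double : ∀ j → + 2 * + tri j ≡ j * j + j
tri-double (+ n)    = triangle-double n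
tri-double -[1+ n ] = trans (triangle-double n) (negate (+ n))
  where
  negate : ∀ x → x * x + x ≡ (- (1ℤ + x)) * (- (1ℤ + x)) + (- (1ℤ + x))
  negate = solve-∀

expo : ℕ → ℕ → ℤ → ℕ
expo a b j = a ℕ.* tri j ℕ.+ b ℕ.* tri (- j)

-- Doubling removes the division by 2 from the triangular numbers, so a comparison of exponents
-- becomes a polynomial identity over ℤ; `halve` leads back to ℕ.
expo-double : ∀ a b j → + 2 * + expo a b j ≡ + a * (j * j + j) + + b * (j * j - j)
expo-double a b j = begin
  + 2 * (+ (a ℕ.* tri j) + + (b ℕ.* tri (- j)))
    ≡⟨ cong₂ (λ x y → + 2 * (x + y)) (ℤ.pos-* a (tri j)) (ℤ.pos-* b (tri (- j))) ⟩
  + 2 * (+ a * + tri j + + b * + tri (- j))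
    ≡⟨ distribute (+ a) (+ b) (+ tri j) (+ tri (- j)) ⟩
  + a * (+ 2 * + tri j) + + b * (+ 2 * + tri (- j))
    ≡⟨ cong₂ (λ x y → + a * x + + b * y) (tri-double j) (tri-double (- j)) ⟩
  + a * (j * j + j) + + b * ((- j) * (- j) + (- j))
    ≡⟨ cong (λ x → + a * (j * j + j) + + b * x) (even j) ⟩
  + a * (j * j + j) + + b * (j * j - j) ∎
  where
  open ≡-Reasoning
  distribute : ∀ a b x y → + 2 * (a * x + b * y) ≡ a * (+ 2 * x) + b * (+ 2 * y)
  distribute = solve-∀
  even : ∀ j → (- j) * (- j) + (- j) ≡ j * j - j
  even = solve-∀

halve : ∀ {m n} → + 2 * + m ≡ + 2 * + n → m ≡ n
halve {m} {n} eq = ℤ.+-injective (ℤ.*-cancelˡ-≡ (+ 2) (+ m) (+ n) eq)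

-- Both j(j + 1)/2 and j(j - 1)/2 are at least ∣j∣ - 1, and one of a, b is positive. This growth
-- makes theta series summable.
∣j∣≤1+expo : ∀ a b .{{_ : NonZero (a ℕ.+ b)}} j → ∣ j ∣ ℕ.≤ suc (expo a b j)
∣j∣≤1+expo a b j = go a b {{it}} (bound j) (subst (λ x → x ℕ.≤ suc (tri (- j))) (ℤ.∣-i∣≡∣i∣ j) (bound (- j)))
  where
  n≤triangle : ∀ n → n ℕ.≤ triangle n
  n≤triangle zero    = z≤n
  n≤triangle (suc n) = ℕ.m≤m+n (suc n) (triangle n)
  bound : ∀ j → ∣ j ∣ ℕ.≤ suc (tri j)
  bound (+ n)    = ℕ.m≤n⇒m≤1+n (n≤triangle n)
  bound -[1+ n ] = s≤s (n≤triangle n)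
  go : ∀ a b .{{_ : NonZero (a ℕ.+ b)}} {x y z} → x ℕ.≤ suc y → x ℕ.≤ suc z → x ℕ.≤ suc (a ℕ.* y ℕ.+ b ℕ.* z)
  go (suc a) b       {x} {y} {z} x≤y x≤z = ℕ.≤-trans x≤y (s≤s (ℕ.≤-trans (ℕ.m≤n*m y (suc a)) (ℕ.m≤m+n _ (b ℕ.* z))))
  go zero    (suc b) {x} {y} {z} x≤y x≤z = ℕ.≤-trans x≤z (s≤s (ℕ.m≤n*m z (suc b)))

-- The signs satisfy ε² = 1, so ε^∣j∣ serves as ε^j for negative j too and no inverse has to be
-- formed.
pow : ℤ → ℤ → ℤ
pow ε j = ε ℤ.^ ∣ j ∣

θ-term : ℤ → ℕ → ℕ → ℤ → Series
θ-term ε a b j = const (pow ε j) ⊗ q^ (expo a b j)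

monomial-⊗ : ∀ c m d n → (const c ⊗ q^ m) ⊗ (const d ⊗ q^ n) ≋ const (c * d) ⊗ q^ (m ℕ.+ n)
monomial-⊗ c m d n = S.trans (⊗-medial (const c) (q^ m) (const d) (q^ n))
  (S.*-cong (S.sym (const-⊗-homo c d)) (S.sym (q^-+ m n)))

monomial-≡ : ∀ {c m d n} → c ≡ d → m ≡ n → const c ⊗ q^ m ≋ const d ⊗ q^ n
monomial-≡ refl refl = S.refl

pow-suc : ∀ {ε} → ε * ε ≡ 1ℤ → ∀ j → pow ε (1ℤ + j) ≡ ε * pow ε j
pow-suc ε²≡1 (+ n)          = refl
pow-suc {ε} ε²≡1 -[1+ zero ]  = sym (trans (cong (ε *_) (ℤ.*-identityʳ ε)) ε²≡1)
pow-suc {ε} ε²≡1 -[1+ suc n ] = sym (begin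
  ε * (ε * (ε * (ε ℤ.^ n)))  ≡⟨ ℤ.*-assoc ε ε (ε * (ε ℤ.^ n)) ⟨
  ε * ε * (ε * (ε ℤ.^ n))    ≡⟨ cong (_* (ε * (ε ℤ.^ n))) ε²≡1 ⟩
  1ℤ * (ε * (ε ℤ.^ n))       ≡⟨ ℤ.*-identityˡ (ε * (ε ℤ.^ n)) ⟩
  ε * (ε ℤ.^ n)              ∎)
  where open ≡-Reasoning

pow-neg : ∀ ε j → pow ε (- j) ≡ pow ε j
pow-neg ε j = cong (ε ℤ.^_) (ℤ.∣-i∣≡∣i∣ j)

pow-+-nonNeg : ∀ {ε} → ε * ε ≡ 1ℤ → ∀ n j → pow ε (+ n + j) ≡ pow ε (+ n) * pow ε j
pow-+-nonNeg {ε} ε²≡1 zero j = trans (cong (pow ε) (ℤ.+-identityˡ j)) (sym (ℤ.*-identityˡ (pow ε j)))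
pow-+-nonNeg {ε} ε²≡1 (suc n) j = begin
  pow ε (+ suc n + j)        ≡⟨ cong (pow ε) (ℤ.+-assoc 1ℤ (+ n) j) ⟩
  pow ε (1ℤ + (+ n + j))     ≡⟨ pow-suc ε²≡1 (+ n + j) ⟩
  ε * pow ε (+ n + j)        ≡⟨ cong (ε *_) (pow-+-nonNeg ε²≡1 n j) ⟩
  ε * (pow ε (+ n) * pow ε j) ≡⟨ ℤ.*-assoc ε (pow ε (+ n)) (pow ε j) ⟨
  pow ε (+ suc n) * pow ε j  ∎
  where open ≡-Reasoning

pow-+ : ∀ {ε} → ε * ε ≡ 1ℤ → ∀ i j → pow ε (i + j) ≡ pow ε i * pow ε j
pow-+ ε²≡1 (+ n) j = pow-+-nonNeg ε²≡1 n j
pow-+ {ε} ε²≡1 -[1+ n ] j = begin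
  pow ε (-[1+ n ] + j)          ≡⟨ pow-neg ε (-[1+ n ] + j) ⟨
  pow ε (- (-[1+ n ] + j))      ≡⟨ cong (pow ε) (ℤ.neg-distrib-+ -[1+ n ] j) ⟩
  pow ε (+ suc n + (- j))       ≡⟨ pow-+-nonNeg ε²≡1 (suc n) (- j) ⟩
  pow ε (+ suc n) * pow ε (- j) ≡⟨ cong (pow ε (+ suc n) *_) (pow-neg ε j) ⟩
  pow ε -[1+ n ] * pow ε j      ∎
  where open ≡-Reasoning

-- Antidiagonal sums and Gaussian binomial coefficients

antidiag : (ℕ → ℕ → Series) → ℕ → Series
antidiag h zero    = h 0 0
antidiag h (suc n) = h 0 (suc n) ⊕ antidiag (λ i → h (suc i)) n

antidiag-≈ : ∀ {N h h′} n → (∀ {i i′} → i ℕ.+ i′ ≡ n → h i i′ ≈[ N ] h′ i i′) →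
             antidiag h n ≈[ N ] antidiag h′ n
antidiag-≈ zero    h≈h′ = h≈h′ refl
antidiag-≈ (suc n) h≈h′ = ⊕-≈ (h≈h′ refl) (antidiag-≈ n λ i+i′≡n → h≈h′ (cong suc i+i′≡n))

antidiag-≋ : ∀ {h h′} n → (∀ {i i′} → i ℕ.+ i′ ≡ n → h i i′ ≋ h′ i i′) →
             antidiag h n ≋ antidiag h′ n
antidiag-≋ n h≋h′ = ≈⇒≋ λ N → antidiag-≈ n λ i+i′≡n → ≋⇒≈ (h≋h′ i+i′≡n)

antidiag-⊗ : ∀ s h n → s ⊗ antidiag h n ≋ antidiag (λ i i′ → s ⊗ h i i′) n
antidiag-⊗ s h zero    = S.refl
antidiag-⊗ s h (suc n) = S.trans (S.distribˡ s (h 0 (suc n)) (antidiag (λ i → h (suc i)) n))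
                                 (S.+-congˡ (antidiag-⊗ s (λ i → h (suc i)) n))

-- w is the contribution that the recursion carries along the first row.
antidiag-pascal : ∀ {h u v : ℕ → ℕ → Series} {w : ℕ → Series} →
                  (∀ i′ → h 0 (suc i′) ≋ u 0 i′ ⊕ w (suc i′)) → h 0 0 ≋ w 0 →
                  (∀ i → h (suc i) 0 ≋ v i 0) →
                  (∀ i i′ → h (suc i) (suc i′) ≋ u (suc i) i′ ⊕ v i (suc i′)) →
                  ∀ n → antidiag h (suc n) ≋ w (suc n) ⊕ antidiag (λ i i′ → u i i′ ⊕ v i i′) n
antidiag-pascal {h} {u} {v} {w} h₀ h₀₀ hᵢ₀ hᵢ zero =
  S.trans (S.+-cong (h₀ 0) (hᵢ₀ 0)) (rearrange (u 0 0) (w 1) (v 0 0))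
  where
  rearrange : ∀ x y z → (x ⊕ y) ⊕ z ≋ y ⊕ (x ⊕ z)
  rearrange = solve 3 (λ x y z → (x :+ y) :+ z := y :+ (x :+ z)) S.refl
antidiag-pascal {h} {u} {v} {w} h₀ h₀₀ hᵢ₀ hᵢ (suc n) =
  S.trans (S.+-cong (h₀ (suc n))
            (antidiag-pascal {λ i → h (suc i)} {λ i → u (suc i)} {λ i → v (suc i)} {v 0} (λ i′ → hᵢ 0 i′) (hᵢ₀ 0) (λ i → hᵢ₀ (suc i)) (λ i → hᵢ (suc i)) n))
          (rearrange (u 0 (suc n)) (w (suc (suc n))) (v 0 (suc n)) _)
  where
  rearrange : ∀ x y z t → (x ⊕ y) ⊕ (z ⊕ t) ≋ y ⊕ ((x ⊕ z) ⊕ t)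
  rearrange = solve 4 (λ x y z t → (x :+ y) :+ (z :+ t) := y :+ ((x :+ z) :+ t)) S.refl

-- gauss k l is the Gaussian binomial coefficient of k + l over k in base q^M.
module _ (M : ℕ) where

  gauss : ℕ → ℕ → Series
  gauss zero    l       = one
  gauss (suc k) zero    = one
  gauss (suc k) (suc l) = gauss k (suc l) ⊕ q^ (suc k ℕ.* M) ⊗ gauss (suc k) l

  private
    Q : ℕ → Series
    Q i = q^ (i ℕ.* M)

  gauss-zeroʳ : ∀ k → gauss k 0 ≋ one
  gauss-zeroʳ zero    = S.refl
  gauss-zeroʳ (suc k) = S.refl

  -- This is the mirror image of the defining Pascal rule. Expanding both sides once more reduces it
  -- to the symmetry of q^((k + l + 3) M) in k and l. The finite triple product needs both rules,
  -- one for each of its two families of factors.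
  gauss-pascal : ∀ k l → gauss (suc k) (suc l) ≋ gauss (suc k) l ⊕ q^ (suc l ℕ.* M) ⊗ gauss k (suc l)
  gauss-pascal zero zero = S.refl
  gauss-pascal zero (suc l) = begin
    one ⊕ Q 1 ⊗ gauss 1 (suc l)               ≈⟨ S.+-congˡ (S.*-congˡ (gauss-pascal 0 l)) ⟩
    one ⊕ Q 1 ⊗ (gauss 1 l ⊕ Q (suc l) ⊗ one) ≈⟨ rearrange one (Q 1) (gauss 1 l) (Q (suc l)) one ⟩
    (one ⊕ Q 1 ⊗ gauss 1 l) ⊕ (Q 1 ⊗ Q (suc l)) ⊗ one  ≈⟨ S.+-congˡ (S.*-congʳ Q-+) ⟩
    (one ⊕ Q 1 ⊗ gauss 1 l) ⊕ Q (suc (suc l)) ⊗ one ∎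
    where
    open ≋-Reasoning
    Q-+ : Q 1 ⊗ Q (suc l) ≋ Q (suc (suc l))
    Q-+ = S.trans (S.sym (q^-+ (1 ℕ.* M) (suc l ℕ.* M))) (S.reflexive (cong q^_ (sym (ℕ.*-distribʳ-+ M 1 (suc l)))))
    rearrange : ∀ x y z t u → x ⊕ y ⊗ (z ⊕ t ⊗ u) ≋ (x ⊕ y ⊗ z) ⊕ (y ⊗ t) ⊗ u
    rearrange = solve 5 (λ x y z t u → x :+ y :* (z :+ t :* u) := (x :+ y :* z) :+ (y :* t) :* u) S.refl
  gauss-pascal (suc k) zero = begin
    gauss (suc k) 1 ⊕ Q (suc (suc k)) ⊗ one              ≈⟨ S.+-congʳ (gauss-pascal k 0) ⟩
    (one ⊕ Q 1 ⊗ gauss k 1) ⊕ Q (suc (suc k)) ⊗ one      ≈⟨ S.+-congˡ (S.*-congʳ Q-+) ⟩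
    (one ⊕ Q 1 ⊗ gauss k 1) ⊕ (Q 1 ⊗ Q (suc k)) ⊗ one    ≈⟨ rearrange one (Q 1) (gauss k 1) (Q (suc k)) one ⟩
    one ⊕ Q 1 ⊗ (gauss k 1 ⊕ Q (suc k) ⊗ one)            ∎
    where
    open ≋-Reasoning
    Q-+ : Q (suc (suc k)) ≋ Q 1 ⊗ Q (suc k)
    Q-+ = S.trans (S.reflexive (cong q^_ (ℕ.*-distribʳ-+ M 1 (suc k)))) (q^-+ (1 ℕ.* M) (suc k ℕ.* M))
    rearrange : ∀ x y z t u → (x ⊕ y ⊗ z) ⊕ (y ⊗ t) ⊗ u ≋ x ⊕ y ⊗ (z ⊕ t ⊗ u)
    rearrange = solve 5 (λ x y z t u → (x :+ y :* z) :+ (y :* t) :* u := x :+ y :* (z :+ t :* u)) S.refl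
  gauss-pascal (suc k) (suc l) = begin
    gauss (suc k) (2 ℕ.+ l) ⊕ Q (2 ℕ.+ k) ⊗ gauss (2 ℕ.+ k) (suc l)
      ≈⟨ S.+-cong (gauss-pascal k (suc l)) (S.*-congˡ (gauss-pascal (suc k) l)) ⟩
    (g ⊕ Q (2 ℕ.+ l) ⊗ gauss k (2 ℕ.+ l)) ⊕ Q (2 ℕ.+ k) ⊗ (gauss (2 ℕ.+ k) l ⊕ Q (suc l) ⊗ g)
      ≈⟨ rearrange g (Q (2 ℕ.+ l)) (gauss k (2 ℕ.+ l)) (Q (2 ℕ.+ k)) (gauss (2 ℕ.+ k) l) (Q (suc l)) ⟩
    (g ⊕ Q (2 ℕ.+ k) ⊗ gauss (2 ℕ.+ k) l) ⊕ (Q (2 ℕ.+ l) ⊗ gauss k (2 ℕ.+ l) ⊕ (Q (2 ℕ.+ k) ⊗ Q (suc l)) ⊗ g)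
      ≈⟨ S.+-congˡ (S.+-congˡ (S.*-congʳ Q-comm)) ⟩
    (g ⊕ Q (2 ℕ.+ k) ⊗ gauss (2 ℕ.+ k) l) ⊕ (Q (2 ℕ.+ l) ⊗ gauss k (2 ℕ.+ l) ⊕ (Q (2 ℕ.+ l) ⊗ Q (suc k)) ⊗ g)
      ≈⟨ S.+-congˡ (rearrange′ (Q (2 ℕ.+ l)) (gauss k (2 ℕ.+ l)) (Q (suc k)) g) ⟩
    (g ⊕ Q (2 ℕ.+ k) ⊗ gauss (2 ℕ.+ k) l) ⊕ Q (2 ℕ.+ l) ⊗ (gauss k (2 ℕ.+ l) ⊕ Q (suc k) ⊗ g) ∎
    where
    open ≋-Reasoning
    g = gauss (suc k) (suc l)
    exponent : ∀ k l M → (2 ℕ.+ k) ℕ.* M ℕ.+ suc l ℕ.* M ≡ (2 ℕ.+ l) ℕ.* M ℕ.+ suc k ℕ.* M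
    exponent = ℕSolver.solve-∀
    Q-comm : Q (2 ℕ.+ k) ⊗ Q (suc l) ≋ Q (2 ℕ.+ l) ⊗ Q (suc k)
    Q-comm = S.trans (S.sym (q^-+ ((2 ℕ.+ k) ℕ.* M) (suc l ℕ.* M)))
      (S.trans (S.reflexive (cong q^_ (exponent k l M))) (q^-+ ((2 ℕ.+ l) ℕ.* M) (suc k ℕ.* M)))
    rearrange : ∀ g a b c d e → (g ⊕ a ⊗ b) ⊕ c ⊗ (d ⊕ e ⊗ g) ≋ (g ⊕ c ⊗ d) ⊕ (a ⊗ b ⊕ (c ⊗ e) ⊗ g)
    rearrange = solve 6 (λ g a b c d e → (g :+ a :* b) :+ c :* (d :+ e :* g)
                                      := (g :+ c :* d) :+ (a :* b :+ (c :* e) :* g)) S.refl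
    rearrange′ : ∀ a b c g → a ⊗ b ⊕ (a ⊗ c) ⊗ g ≋ a ⊗ (b ⊕ c ⊗ g)
    rearrange′ = solve 4 (λ a b c g → a :* b :+ (a :* c) :* g := a :* (b :+ c :* g)) S.refl

  antidiag-gaussˡ : ∀ (μ : ℕ → Series) n →
    antidiag (λ i i′ → gauss i i′ ⊗ μ i) (suc n) ≋
    antidiag (λ i i′ → gauss i i′ ⊗ μ i ⊕ gauss i i′ ⊗ (q^ (i′ ℕ.* M) ⊗ μ (suc i))) n
  antidiag-gaussˡ μ n = S.trans
    (antidiag-pascal {λ i i′ → gauss i i′ ⊗ μ i} {λ i i′ → gauss i i′ ⊗ μ i}
      {λ i i′ → gauss i i′ ⊗ (q^ (i′ ℕ.* M) ⊗ μ (suc i))} {λ { zero → one ⊗ μ 0 ; (suc _) → zeroˢ }}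
      (λ _ → S.sym (S.+-identityʳ _)) S.refl
      (λ i → S.trans (S.*-congˡ (S.sym (S.*-identityˡ (μ (suc i))))) (S.*-congʳ (S.sym (gauss-zeroʳ i))))
      (λ i i′ → S.trans (S.*-congʳ (gauss-pascal i i′))
        (distribute (gauss (suc i) i′) (q^ (suc i′ ℕ.* M)) (gauss i (suc i′)) (μ (suc i))))
      n)
    (S.+-identityˡ _)
    where
    distribute : ∀ x y z w → (x ⊕ y ⊗ z) ⊗ w ≋ x ⊗ w ⊕ z ⊗ (y ⊗ w)
    distribute = solve 4 (λ x y z w → (x :+ y :* z) :* w := x :* w :+ z :* (y :* w)) S.refl

  antidiag-gaussʳ : ∀ (μ : ℕ → Series) n →
    antidiag (λ i i′ → gauss i i′ ⊗ μ i) (suc n) ≋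
    antidiag (λ i i′ → gauss i i′ ⊗ (q^ (i ℕ.* M) ⊗ μ i) ⊕ gauss i i′ ⊗ μ (suc i)) n
  antidiag-gaussʳ μ n = S.trans
    (antidiag-pascal {λ i i′ → gauss i i′ ⊗ μ i} {λ i i′ → gauss i i′ ⊗ (q^ (i ℕ.* M) ⊗ μ i)}
      {λ i i′ → gauss i i′ ⊗ μ (suc i)} {λ { zero → one ⊗ μ 0 ; (suc _) → zeroˢ }}
      (λ _ → S.trans (S.*-congˡ (S.sym (S.*-identityˡ (μ 0)))) (S.sym (S.+-identityʳ _))) S.refl
      (λ i → S.*-congʳ (S.sym (gauss-zeroʳ i)))
      (λ i i′ → distribute (gauss i (suc i′)) (q^ (suc i ℕ.* M)) (gauss (suc i) i′) (μ (suc i)))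
      n)
    (S.+-identityˡ _)
    where
    distribute : ∀ x y z w → (x ⊕ y ⊗ z) ⊗ w ≋ z ⊗ (y ⊗ w) ⊕ x ⊗ w
    distribute = solve 4 (λ x y z w → (x :+ y :* z) :* w := z :* (y :* w) :+ x :* w) S.refl

  module _ .{{_ : NonZero M}} where

    -- The product equals (q^M;q^M)ₖ₊ₗ / (q^M;q^M)ₗ, whose factors 1 - q^(jM) all have j > l.
    poch-gauss : ∀ k l → poch -1ℤ M M k ⊗ gauss k l ≈[ suc l ] one
    poch-gauss zero    l       = ≋⇒≈ (S.*-identityˡ one)
    poch-gauss (suc k) zero    = ≈-trans (≋⇒≈ (S.*-identityʳ _)) (poch-≈one (suc k))
      where
      poch-≈one : ∀ k → poch -1ℤ M M k ≈[ 1 ] one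
      poch-≈one zero    = ≈-refl
      poch-≈one (suc k) = ≈-trans (one-⊗-≈ _ (1+q^-≈ -1ℤ (ℕ.≤-trans (ℕ.>-nonZero⁻¹ M) (ℕ.m≤m+n M (k ℕ.* M))))) (poch-≈one k)
    poch-gauss (suc k) (suc l) = begin
      (u ⊗ p) ⊗ (gauss k (suc l) ⊕ Qᵏ ⊗ gauss (suc k) l)
        ≈⟨ ≋⇒≈ (distribute u p (gauss k (suc l)) Qᵏ (gauss (suc k) l)) ⟩
      u ⊗ (p ⊗ gauss k (suc l)) ⊕ Qᵏ ⊗ ((u ⊗ p) ⊗ gauss (suc k) l)
        ≈⟨ ⊕-≈ (⊗-≈ ≈-refl (poch-gauss k (suc l)))
               -- The induction hypothesis is valid modulo q^(l + 1) only; the factor q^((k + 1) M)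
               -- with M positive supplies the missing power.
               (≈-weaken (ℕ.+-monoˡ-≤ (suc l) (ℕ.≤-trans (ℕ.>-nonZero⁻¹ M) (ℕ.m≤m+n M (k ℕ.* M))))
                 (q^-⊗-≈ (suc k ℕ.* M) (poch-gauss (suc k) l))) ⟩
      u ⊗ one ⊕ Qᵏ ⊗ one
        ≈⟨ ≋⇒≈ (cancel one Qᵏ) ⟩
      one ∎
      where
      open SetoidReasoning (≈-setoid (suc (suc l)))
      Qᵏ = q^ (suc k ℕ.* M)
      u = 1+ -1ℤ q^ (M ℕ.+ k ℕ.* M)
      p = poch -1ℤ M M k
      distribute : ∀ u p x q y → (u ⊗ p) ⊗ (x ⊕ q ⊗ y) ≋ u ⊗ (p ⊗ x) ⊕ q ⊗ ((u ⊗ p) ⊗ y)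
      distribute = solve 5 (λ u p x q y → (u :* p) :* (x :+ q :* y) := u :* (p :* x) :+ q :* ((u :* p) :* y)) S.refl
      cancel : ∀ o q → (o ⊕ const -1ℤ ⊗ q) ⊗ one ⊕ q ⊗ one ≋ o
      cancel o q = S.trans (S.+-cong (S.*-identityʳ _) (S.*-identityʳ q)) (cancel′ o q)
        where
        cancel′ : ∀ o q → (o ⊕ const -1ℤ ⊗ q) ⊕ q ≋ o
        cancel′ = solve 2 (λ o q → (o :+ con -1ℤ :* q) :+ q := o) S.refl

module ℤ-group = GroupProperties (AbelianGroup.group ℤ.+-0-abelianGroup)

q^-⊗-monomial : ∀ m c n → q^ m ⊗ (const c ⊗ q^ n) ≋ const c ⊗ q^ (m ℕ.+ n)
q^-⊗-monomial m c n = S.trans (⊗-swap (q^ m) (const c) (q^ n)) (S.*-congˡ (S.sym (q^-+ m n)))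

∑-applyUpTo : ∀ {I : Set} (φ : ℕ → I) (F : I → Series) n →
              antidiag (λ i _ → F (φ i)) n ≋ ∑ (applyUpTo φ (suc n)) F
∑-applyUpTo φ F zero    = S.sym (S.+-identityʳ (F (φ 0)))
∑-applyUpTo φ F (suc n) = S.+-congˡ (∑-applyUpTo (φ ∘ suc) F n)

-- Ramanujan's general theta function f(ε q^a, ε q^b), in product form.
θ : ℤ → (a b : ℕ) → .{{NonZero (a ℕ.+ b)}} → Series
θ ε a b = (P ε a (a ℕ.+ b) ⊗ P ε b (a ℕ.+ b)) ⊗ P -1ℤ (a ℕ.+ b) (a ℕ.+ b)

module Jacobi (ε : ℤ) (ε²≡1 : ε * ε ≡ 1ℤ) (a b : ℕ) where

  M : ℕ
  M = a ℕ.+ b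

  term : ℤ → Series
  term = θ-term ε a b

  -- From j to 1 + j the exponent of `term` grows by a + jM. Subtracting this from a + kM with k = j
  -- + i′ leaves i′M, the weight occurring in `antidiag-gaussˡ`.
  term-up : ∀ {k i′ j} → + k ≡ j + + i′ →
            (const ε ⊗ q^ (a ℕ.+ k ℕ.* M)) ⊗ term j ≋ q^ (i′ ℕ.* M) ⊗ term (1ℤ + j)
  term-up {k} {i′} {j} k≡ = S.trans (monomial-⊗ ε (a ℕ.+ k ℕ.* M) (pow ε j) (expo a b j))
    (S.trans (monomial-≡ (sym (pow-suc ε²≡1 j)) (halve exponents))
             (S.sym (q^-⊗-monomial (i′ ℕ.* M) (pow ε (1ℤ + j)) (expo a b (1ℤ + j)))))
    where
    open ≡-Reasoning
    lhs : ∀ a b j i e → + 2 * (a + (j + i) * (a + b) + e) ≡ + 2 * (a + (j + i) * (a + b)) + + 2 * e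
    lhs = solve-∀
    mid : ∀ a b j i → + 2 * (a + (j + i) * (a + b)) + (a * (j * j + j) + b * (j * j - j))
        ≡ + 2 * (i * (a + b)) + (a * ((1ℤ + j) * (1ℤ + j) + (1ℤ + j)) + b * ((1ℤ + j) * (1ℤ + j) - (1ℤ + j)))
    mid = solve-∀
    exponents : + 2 * + (a ℕ.+ k ℕ.* M ℕ.+ expo a b j) ≡ + 2 * + (i′ ℕ.* M ℕ.+ expo a b (1ℤ + j))
    exponents = begin
      + 2 * (+ a + + (k ℕ.* M) + + expo a b j)
        ≡⟨ cong (λ x → + 2 * (+ a + x + + expo a b j)) (trans (ℤ.pos-* k M) (cong (_* + M) k≡)) ⟩
      + 2 * (+ a + (j + + i′) * (+ a + + b) + + expo a b j)
        ≡⟨ lhs (+ a) (+ b) j (+ i′) (+ expo a b j) ⟩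
      + 2 * (+ a + (j + + i′) * (+ a + + b)) + + 2 * + expo a b j
        ≡⟨ cong (_+_ (+ 2 * (+ a + (j + + i′) * (+ a + + b)))) (expo-double a b j) ⟩
      + 2 * (+ a + (j + + i′) * (+ a + + b)) + (+ a * (j * j + j) + + b * (j * j - j))
        ≡⟨ mid (+ a) (+ b) j (+ i′) ⟩
      + 2 * (+ i′ * (+ a + + b)) + _
        ≡⟨ cong (_+_ (+ 2 * (+ i′ * + M))) (expo-double a b (1ℤ + j)) ⟨
      + 2 * (+ i′ * + M) + + 2 * + expo a b (1ℤ + j)
        ≡⟨ ℤ.*-distribˡ-+ (+ 2) (+ i′ * + M) (+ expo a b (1ℤ + j)) ⟨
      + 2 * (+ i′ * + M + + expo a b (1ℤ + j))
        ≡⟨ cong (λ x → + 2 * (x + + expo a b (1ℤ + j))) (ℤ.pos-* i′ M) ⟨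
      + 2 * + (i′ ℕ.* M ℕ.+ expo a b (1ℤ + j)) ∎

  -- The same growth a + jM, now added to b + lM, gives (l + j + 1) M = iM, the weight occurring in
  -- `antidiag-gaussʳ`.
  term-down : ∀ {l i j} → + l ≡ + i - (1ℤ + j) →
              (const ε ⊗ q^ (b ℕ.+ l ℕ.* M)) ⊗ term (1ℤ + j) ≋ q^ (i ℕ.* M) ⊗ term j
  term-down {l} {i} {j} l≡ = S.trans (monomial-⊗ ε (b ℕ.+ l ℕ.* M) (pow ε (1ℤ + j)) (expo a b (1ℤ + j)))
    (S.trans (monomial-≡ signs (halve exponents))
             (S.sym (q^-⊗-monomial (i ℕ.* M) (pow ε j) (expo a b j))))
    where
    open ≡-Reasoning
    signs : ε * pow ε (1ℤ + j) ≡ pow ε j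
    signs = begin
      ε * pow ε (1ℤ + j)  ≡⟨ cong (ε *_) (pow-suc ε²≡1 j) ⟩
      ε * (ε * pow ε j)   ≡⟨ ℤ.*-assoc ε ε (pow ε j) ⟨
      ε * ε * pow ε j     ≡⟨ cong (_* pow ε j) ε²≡1 ⟩
      1ℤ * pow ε j        ≡⟨ ℤ.*-identityˡ (pow ε j) ⟩
      pow ε j             ∎
    lhs : ∀ a b j i e → + 2 * (b + (i - (1ℤ + j)) * (a + b) + e) ≡ + 2 * (b + (i - (1ℤ + j)) * (a + b)) + + 2 * e
    lhs = solve-∀
    mid : ∀ a b j i → + 2 * (b + (i - (1ℤ + j)) * (a + b)) + (a * ((1ℤ + j) * (1ℤ + j) + (1ℤ + j)) + b * ((1ℤ + j) * (1ℤ + j) - (1ℤ + j)))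
        ≡ + 2 * (i * (a + b)) + (a * (j * j + j) + b * (j * j - j))
    mid = solve-∀
    exponents : + 2 * + (b ℕ.+ l ℕ.* M ℕ.+ expo a b (1ℤ + j)) ≡ + 2 * + (i ℕ.* M ℕ.+ expo a b j)
    exponents = begin
      + 2 * (+ b + + (l ℕ.* M) + + expo a b (1ℤ + j))
        ≡⟨ cong (λ x → + 2 * (+ b + x + + expo a b (1ℤ + j))) (trans (ℤ.pos-* l M) (cong (_* + M) l≡)) ⟩
      + 2 * (+ b + (+ i - (1ℤ + j)) * (+ a + + b) + + expo a b (1ℤ + j))
        ≡⟨ lhs (+ a) (+ b) j (+ i) (+ expo a b (1ℤ + j)) ⟩
      + 2 * (+ b + (+ i - (1ℤ + j)) * (+ a + + b)) + + 2 * + expo a b (1ℤ + j)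
        ≡⟨ cong (_+_ (+ 2 * (+ b + (+ i - (1ℤ + j)) * (+ a + + b)))) (expo-double a b (1ℤ + j)) ⟩
      + 2 * (+ b + (+ i - (1ℤ + j)) * (+ a + + b)) + _
        ≡⟨ mid (+ a) (+ b) j (+ i) ⟩
      + 2 * (+ i * (+ a + + b)) + (+ a * (j * j + j) + + b * (j * j - j))
        ≡⟨ cong (_+_ (+ 2 * (+ i * + M))) (expo-double a b j) ⟨
      + 2 * (+ i * + M) + + 2 * + expo a b j
        ≡⟨ ℤ.*-distribˡ-+ (+ 2) (+ i * + M) (+ expo a b j) ⟨
      + 2 * (+ i * + M + + expo a b j)
        ≡⟨ cong (λ x → + 2 * (x + + expo a b j)) (ℤ.pos-* i M) ⟨
      + 2 * + (i ℕ.* M ℕ.+ expo a b j) ∎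

  -- This is the q-binomial theorem in symmetric form. A new factor splits each summand into itself
  -- and a multiple of a neighbouring term, and a Pascal rule reassembles them: `antidiag-gaussˡ`
  -- for a factor with a, `antidiag-gaussʳ` for a factor with b.
  finite : ∀ k l → poch ε a M k ⊗ poch ε b M l ≋
                   antidiag (λ i i′ → gauss M i i′ ⊗ term (+ i - + l)) (k ℕ.+ l)
  finite zero zero = S.*-congˡ (S.sym (S.trans
    (S.*-cong (S.sym one≋const)
              (S.reflexive (cong q^_ (cong₂ ℕ._+_ (ℕ.*-zeroʳ a) (ℕ.*-zeroʳ b)))))
    (S.*-identityˡ one)))
  finite zero (suc l) = begin
    one ⊗ ((one ⊕ Y) ⊗ poch ε b M l)
      ≈⟨ ⊗-swap one (one ⊕ Y) (poch ε b M l) ⟩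
    (one ⊕ Y) ⊗ (one ⊗ poch ε b M l)
      ≈⟨ S.*-congˡ (finite zero l) ⟩
    (one ⊕ Y) ⊗ antidiag (λ i i′ → gauss M i i′ ⊗ term (+ i - + l)) l
      ≈⟨ antidiag-⊗ (one ⊕ Y) (λ i i′ → gauss M i i′ ⊗ term (+ i - + l)) l ⟩
    antidiag (λ i i′ → (one ⊕ Y) ⊗ (gauss M i i′ ⊗ term (+ i - + l))) l
      ≈⟨ antidiag-≋ l (λ {i} {i′} _ → step i i′) ⟩
    antidiag (λ i i′ → gauss M i i′ ⊗ (q^ (i ℕ.* M) ⊗ μ i) ⊕ gauss M i i′ ⊗ μ (suc i)) l
      ≈⟨ antidiag-gaussʳ M μ l ⟨
    antidiag (λ i i′ → gauss M i i′ ⊗ μ i) (suc l) ∎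
    where
    open ≋-Reasoning
    Y = const ε ⊗ q^ (b ℕ.+ l ℕ.* M)
    μ : ℕ → Series
    μ i = term (+ i - + suc l)
    index₁ : ∀ x y → x - y ≡ 1ℤ + (x - (1ℤ + y))
    index₁ = solve-∀
    index₂ : ∀ x y → (1ℤ + x) - (1ℤ + y) ≡ x - y
    index₂ = solve-∀
    index₃ : ∀ x y → y ≡ x - (1ℤ + (x - (1ℤ + y)))
    index₃ = solve-∀
    step : ∀ i i′ → (one ⊕ Y) ⊗ (gauss M i i′ ⊗ term (+ i - + l)) ≋
                    gauss M i i′ ⊗ (q^ (i ℕ.* M) ⊗ μ i) ⊕ gauss M i i′ ⊗ μ (suc i)
    step i i′ = S.trans (distribute Y (gauss M i i′) (term (+ i - + l)))
      (S.+-cong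
        (S.*-congˡ (S.trans (S.*-congˡ (S.reflexive (cong term (index₁ (+ i) (+ l)))))
                            (term-down {l} {i} {+ i - + suc l} (index₃ (+ i) (+ l)))))
        (S.*-congˡ (S.reflexive (cong term (sym (index₂ (+ i) (+ l)))))))
      where
      distribute : ∀ y g t → (one ⊕ y) ⊗ (g ⊗ t) ≋ g ⊗ (y ⊗ t) ⊕ g ⊗ t
      distribute y g t = S.trans (S.distribʳ (g ⊗ t) one y)
        (S.trans (S.+-congʳ (S.*-identityˡ (g ⊗ t))) (eq y g t))
        where
        eq : ∀ y g t → g ⊗ t ⊕ y ⊗ (g ⊗ t) ≋ g ⊗ (y ⊗ t) ⊕ g ⊗ t
        eq = solve 3 (λ y g t → g :* t :+ y :* (g :* t) := g :* (y :* t) :+ g :* t) S.refl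
  finite (suc k) l = begin
    ((one ⊕ X) ⊗ poch ε a M k) ⊗ poch ε b M l
      ≈⟨ S.*-assoc (one ⊕ X) (poch ε a M k) (poch ε b M l) ⟩
    (one ⊕ X) ⊗ (poch ε a M k ⊗ poch ε b M l)
      ≈⟨ S.*-congˡ (finite k l) ⟩
    (one ⊕ X) ⊗ antidiag (λ i i′ → gauss M i i′ ⊗ μ i) (k ℕ.+ l)
      ≈⟨ antidiag-⊗ (one ⊕ X) (λ i i′ → gauss M i i′ ⊗ μ i) (k ℕ.+ l) ⟩
    antidiag (λ i i′ → (one ⊕ X) ⊗ (gauss M i i′ ⊗ μ i)) (k ℕ.+ l)
      ≈⟨ antidiag-≋ (k ℕ.+ l) (λ {i} {i′} → step i i′) ⟩
    antidiag (λ i i′ → gauss M i i′ ⊗ μ i ⊕ gauss M i i′ ⊗ (q^ (i′ ℕ.* M) ⊗ μ (suc i))) (k ℕ.+ l)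
      ≈⟨ antidiag-gaussˡ M μ (k ℕ.+ l) ⟨
    antidiag (λ i i′ → gauss M i i′ ⊗ μ i) (suc (k ℕ.+ l)) ∎
    where
    open ≋-Reasoning
    X = const ε ⊗ q^ (a ℕ.+ k ℕ.* M)
    μ : ℕ → Series
    μ i = term (+ i - + l)
    index₁ : ∀ x y → 1ℤ + (x - y) ≡ (1ℤ + x) - y
    index₁ = solve-∀
    index₂ : ∀ x y → x ≡ (x + y) - y
    index₂ = solve-∀
    index₃ : ∀ x y z → (x + y) - z ≡ x - z + y
    index₃ = solve-∀
    step : ∀ i i′ → i ℕ.+ i′ ≡ k ℕ.+ l → (one ⊕ X) ⊗ (gauss M i i′ ⊗ μ i) ≋
                    gauss M i i′ ⊗ μ i ⊕ gauss M i i′ ⊗ (q^ (i′ ℕ.* M) ⊗ μ (suc i))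
    step i i′ i+i′≡k+l = S.trans (distribute X (gauss M i i′) (μ i))
      (S.+-congˡ (S.*-congˡ (S.trans (term-up {k} {i′} {+ i - + l} k≡)
        (S.*-congˡ (S.reflexive (cong term (index₁ (+ i) (+ l))))))))
      where
      k≡ : + k ≡ + i - + l + + i′
      k≡ = trans (index₂ (+ k) (+ l)) (trans (cong (λ x → + x - + l) (sym i+i′≡k+l)) (index₃ (+ i) (+ i′) (+ l)))
      distribute : ∀ x g t → (one ⊕ x) ⊗ (g ⊗ t) ≋ g ⊗ t ⊕ g ⊗ (x ⊗ t)
      distribute x g t = S.trans (S.distribʳ (g ⊗ t) one x)
        (S.+-cong (S.*-identityˡ (g ⊗ t)) (⊗-swap x g t))

  module _ .{{M≢0 : NonZero M}} where

    bound₁ : ∀ i K → K ℕ.≤ i ℕ.+ ∣ + i - + K ∣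
    bound₁ i K = subst (ℕ._≤ i ℕ.+ ∣ + i - + K ∣) (cong ∣_∣ (cancel (+ i) (+ K))) (ℤ.∣i-j∣≤∣i∣+∣j∣ (+ i) (+ i - + K))
      where
      cancel : ∀ x y → x - (x - y) ≡ y
      cancel = solve-∀

    bound₂ : ∀ i K → i ℕ.≤ ∣ + i - + K ∣ ℕ.+ K
    bound₂ i K = subst (ℕ._≤ ∣ + i - + K ∣ ℕ.+ K) (cong ∣_∣ (cancel (+ i) (+ K))) (ℤ.∣i+j∣≤∣i∣+∣j∣ (+ i - + K) (+ K))
      where
      cancel : ∀ x y → (x - y) + y ≡ x
      cancel = solve-∀

    triple-product : SumsTo term (θ ε a b)
    triple-product N = record
      { list   = applyUpTo φ (suc (K ℕ.+ K))
      ; unique = Unique.applyUpTo⁺₁ φ (suc (K ℕ.+ K)) λ i<j _ φi≡φj →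
                   ℕ.<⇒≢ i<j (ℤ.+-injective (ℤ-group.∙-cancelʳ (- + K) _ _ φi≡φj))
      ; covers = cover
      ; total  = partial-sum
      }
      where
      -- The additional 1 pays for the 1 in `∣j∣≤1+expo`: K ≤ i + ∣i - K∣ then yields N ≤ e + i for
      -- the exponent e of the term.
      K = suc N
      φ : ℕ → ℤ
      φ i = + i - + K

      large : ∀ {j} → N ℕ.≤ expo a b j → term j ≈[ N ] zeroˢ
      large {j} N≤e = ⊗-≈-zeroʳ (const (pow ε j)) (mod-q λ n<N → q^-< (ℕ.<-≤-trans n<N N≤e))

      listed : ∀ j i → i ℕ.≤ K ℕ.+ K → φ i ≡ j → j ∈ applyUpTo φ (suc (K ℕ.+ K))
      listed j i i≤2K φi≡j = subst (_∈ applyUpTo φ (suc (K ℕ.+ K))) φi≡j (∈.∈-applyUpTo⁺ φ (s≤s i≤2K))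

      cover : ∀ j → j ∈ applyUpTo φ (suc (K ℕ.+ K)) ⊎ term j ≈[ N ] zeroˢ
      cover j with ∣ j ∣ ℕ.≤? K
      ... | no  ∣j∣≰K = inj₂ (large {j} (ℕ.≤-pred (ℕ.≤-trans (ℕ.<⇒≤ (ℕ.≰⇒> ∣j∣≰K)) (∣j∣≤1+expo a b j))))
      cover (+ n) | yes n≤K = inj₁ (listed (+ n) (n ℕ.+ K) (ℕ.+-monoˡ-≤ K n≤K) (cancel (+ n) (+ K)))
        where
        cancel : ∀ x y → (x + y) - y ≡ x
        cancel = solve-∀
      cover -[1+ n ] | yes n<K = inj₁ (listed -[1+ n ] (K ∸ suc n) (ℕ.≤-trans (ℕ.m∸n≤m K (suc n)) (ℕ.m≤m+n K K))
        (trans (cong (_- + K) (trans (sym (ℤ.⊖-≥ n<K)) (sym (ℤ.m-n≡m⊖n K (suc n))))) (cancel (+ K) (+ suc n))))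
        where
        cancel : ∀ x y → (x - y) - x ≡ - y
        cancel = solve-∀

      -- P -1 M M ⊗ gauss M i i′ is 1 only modulo q^min(i, i′); the exponent of
      -- term (φ i), which is at least ∣ i - K ∣ - 1, makes up for the rest.
      weight : ∀ {i i′} → i ℕ.+ i′ ≡ K ℕ.+ K →
               P -1ℤ M M ⊗ (gauss M i i′ ⊗ term (φ i)) ≈[ N ] term (φ i)
      weight {i} {i′} i+i′≡2K = begin
        P∞ ⊗ (gauss M i i′ ⊗ (c ⊗ q^ e))
          ≈⟨ ≋⇒≈ (collect P∞ (gauss M i i′) c (q^ e)) ⟩
        c ⊗ (q^ e ⊗ (P∞ ⊗ gauss M i i′))
          ≈⟨ ⊗-≈ ≈-refl (≈-weaken N≤e+i (q^-⊗-≈ e (⊗-≈ (≈-sym (poch-≈ -1ℤ M M i)) ≈-refl))) ⟩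
        c ⊗ (q^ e ⊗ (poch -1ℤ M M i ⊗ gauss M i i′))
          ≈⟨ ⊗-≈ ≈-refl (≈-weaken N≤e+i′ (q^-⊗-≈ e (poch-gauss M i i′))) ⟩
        c ⊗ (q^ e ⊗ one)
          ≈⟨ ≋⇒≈ (S.*-congˡ (S.*-identityʳ (q^ e))) ⟩
        c ⊗ q^ e ∎
        where
        open SetoidReasoning (≈-setoid N)
        P∞ = P -1ℤ M M
        e = expo a b (φ i)
        c = const (pow ε (φ i))
        collect : ∀ p g c q → p ⊗ (g ⊗ (c ⊗ q)) ≋ c ⊗ (q ⊗ (p ⊗ g))
        collect = solve 4 (λ p g c q → p :* (g :* (c :* q)) := c :* (q :* (p :* g))) S.refl
        N≤e+i : N ℕ.≤ e ℕ.+ i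
        N≤e+i = ℕ.≤-pred (ℕ.≤-trans (bound₁ i K) (ℕ.≤-trans
          (ℕ.+-monoʳ-≤ i (∣j∣≤1+expo a b (φ i))) (ℕ.≤-reflexive (ℕ.+-comm i (suc e)))))
        N≤e+i′ : N ℕ.≤ e ℕ.+ suc i′
        N≤e+i′ = ℕ.≤-trans (ℕ.n≤1+n N) (ℕ.+-cancelˡ-≤ K K (e ℕ.+ suc i′)
          (ℕ.≤-trans (ℕ.≤-reflexive (sym i+i′≡2K)) (ℕ.≤-trans
            (ℕ.+-monoˡ-≤ i′ (ℕ.≤-trans (bound₂ i K) (ℕ.+-monoˡ-≤ K (∣j∣≤1+expo a b (φ i)))))
            (ℕ.≤-reflexive (rearrange e K i′)))))
          where
          rearrange : ∀ e K i → suc e ℕ.+ K ℕ.+ i ≡ K ℕ.+ (e ℕ.+ suc i)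
          rearrange = ℕSolver.solve-∀

      partial-sum : θ ε a b ≈[ N ] ∑ (applyUpTo φ (suc (K ℕ.+ K))) term
      partial-sum = begin
        (P ε a M ⊗ P ε b M) ⊗ P∞
          ≈⟨ ⊗-≈ (≈-sym (≈-weaken (ℕ.n≤1+n N) (⊗-≈ (poch-≈ ε a M K) (poch-≈ ε b M K)))) ≈-refl ⟩
        (poch ε a M K ⊗ poch ε b M K) ⊗ P∞
          ≈⟨ ≋⇒≈ (S.trans (S.*-comm _ P∞) (S.*-congˡ (finite K K))) ⟩
        P∞ ⊗ antidiag (λ i i′ → gauss M i i′ ⊗ term (φ i)) (K ℕ.+ K)
          ≈⟨ ≋⇒≈ (antidiag-⊗ P∞ (λ i i′ → gauss M i i′ ⊗ term (φ i)) (K ℕ.+ K)) ⟩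
        antidiag (λ i i′ → P∞ ⊗ (gauss M i i′ ⊗ term (φ i))) (K ℕ.+ K)
          ≈⟨ antidiag-≈ {h′ = λ i _ → term (φ i)} (K ℕ.+ K) (λ {i} {i′} → weight {i} {i′}) ⟩
        antidiag (λ i i′ → term (φ i)) (K ℕ.+ K)
          ≈⟨ ≋⇒≈ (∑-applyUpTo φ term (K ℕ.+ K)) ⟩
        ∑ (applyUpTo φ (suc (K ℕ.+ K))) term ∎
        where
        open SetoidReasoning (≈-setoid N)
        P∞ = P -1ℤ M M

jacobi-triple-product : ∀ {ε} → ε * ε ≡ 1ℤ → ∀ a b .{{_ : NonZero (a ℕ.+ b)}} →
                        SumsTo (θ-term ε a b) (θ ε a b)
jacobi-triple-product {ε} ε²≡1 a b = Jacobi.triple-product ε ε²≡1 a b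

-- Dissections of products of two theta functions

quotient-mono : ∀ {d r r′ k k′} → r ℕ.< d → k ℤ.< k′ → + r + k * + d ℤ.< + r′ + k′ * + d
quotient-mono {d} {r} {r′} {k} {k′} r<d k<k′ = begin-strict
  + r + k * + d    <⟨ ℤ.+-monoˡ-< (k * + d) (ℤ.+<+ r<d) ⟩
  + d + k * + d    ≡⟨ ℤ.suc-* k (+ d) ⟨
  ℤ.suc k * + d    ≤⟨ ℤ.*-monoʳ-≤-nonNeg (+ d) (ℤ.i<j⇒suc[i]≤j k<k′) ⟩
  k′ * + d         ≡⟨ ℤ.+-identityˡ (k′ * + d) ⟨
  0ℤ + k′ * + d    ≤⟨ ℤ.+-monoˡ-≤ (k′ * + d) (ℤ.+≤+ z≤n) ⟩
  + r′ + k′ * + d  ∎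
  where open ℤ.≤-Reasoning

quotient-unique : ∀ {d r r′ k k′} → r ℕ.< d → r′ ℕ.< d → + r + k * + d ≡ + r′ + k′ * + d → k ≡ k′
quotient-unique {d} {r} {r′} {k} {k′} r<d r′<d eq with ℤ.<-cmp k k′
... | tri< k<k′ _ _ = contradiction eq (ℤ.<⇒≢ (quotient-mono r<d k<k′))
... | tri≈ _ k≡k′ _ = k≡k′
... | tri> _ _ k′<k = contradiction (sym eq) (ℤ.<⇒≢ (quotient-mono r′<d k′<k))

module Dissection (d : ℕ) .{{_ : NonZero d}} (o : ℤ) where

  -- ℤ² is split by the residue ρ of m - n + o modulo d, where m - n + o = dk + ρ and n = s - k.
  row : Fin d → ℤ → ℤ → ℤ
  row ρ s k = s + (+ d - 1ℤ) * k + (+ toℕ ρ - o)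

  to : Fin d × (ℤ × ℤ) → ℤ × ℤ
  to (ρ , s , k) = row ρ s k , s - k

  from : ℤ × ℤ → Fin d × (ℤ × ℤ)
  from (m , n) = fromℕ< (n%ℕd<d (m - n + o) d) , n + (m - n + o) /ℕ d , (m - n + o) /ℕ d

  to-from : ∀ mn → to (from mn) ≡ mn
  to-from (m , n) = cong₂ _,_ first (cancel n k)
    where
    open ≡-Reasoning
    k = (m - n + o) /ℕ d
    r = (m - n + o) %ℕ d
    cancel : ∀ n k → n + k - k ≡ n
    cancel = solve-∀
    collect : ∀ n k d r o → n + k + (d - 1ℤ) * k + (r - o) ≡ (r + k * d) + (n - o)
    collect = solve-∀
    cancel′ : ∀ m n o → (m - n + o) + (n - o) ≡ m
    cancel′ = solve-∀
    first : n + k + (+ d - 1ℤ) * k + (+ toℕ (fromℕ< (n%ℕd<d (m - n + o) d)) - o) ≡ m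
    first = begin
      n + k + (+ d - 1ℤ) * k + (+ toℕ (fromℕ< (n%ℕd<d (m - n + o) d)) - o)
        ≡⟨ cong (λ r → n + k + (+ d - 1ℤ) * k + (+ r - o)) (Fin.toℕ-fromℕ< (n%ℕd<d (m - n + o) d)) ⟩
      n + k + (+ d - 1ℤ) * k + (+ r - o)
        ≡⟨ collect n k (+ d) (+ r) o ⟩
      (+ r + k * + d) + (n - o)
        ≡⟨ cong (_+ (n - o)) (a≡a%ℕn+[a/ℕn]*n (m - n + o) d) ⟨
      (m - n + o) + (n - o)
        ≡⟨ cancel′ m n o ⟩
      m ∎

  to-injective : ∀ {x y} → to x ≡ to y → x ≡ y
  to-injective {ρ , s , k} {ρ′ , s′ , k′} eq = cong₂ _,_ ρ≡ρ′ (cong₂ _,_ s≡s′ k≡k′)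
    where
    open ≡-Reasoning
    difference : ∀ r k s d o → r + k * d ≡ (s + (d - 1ℤ) * k + (r - o)) - (s - k) + o
    difference = solve-∀
    division : + toℕ ρ + k * + d ≡ + toℕ ρ′ + k′ * + d
    division = begin
      + toℕ ρ + k * + d                   ≡⟨ difference (+ toℕ ρ) k s (+ d) o ⟩
      row ρ s k - (s - k) + o             ≡⟨ cong₂ (λ m n → m - n + o) (cong proj₁ eq) (cong proj₂ eq) ⟩
      row ρ′ s′ k′ - (s′ - k′) + o        ≡⟨ difference (+ toℕ ρ′) k′ s′ (+ d) o ⟨
      + toℕ ρ′ + k′ * + d                 ∎
    k≡k′ : k ≡ k′
    k≡k′ = quotient-unique (Fin.toℕ<n ρ) (Fin.toℕ<n ρ′) division
    ρ≡ρ′ : ρ ≡ ρ′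
    ρ≡ρ′ = Fin.toℕ-injective (ℤ.+-injective (ℤ-group.∙-cancelʳ (k * + d) _ _
             (trans division (cong (λ k → + toℕ ρ′ + k * + d) (sym k≡k′)))))
    s≡s′ : s ≡ s′
    s≡s′ = ℤ-group.∙-cancelʳ (- k) s s′ (trans (cong proj₂ eq) (cong (λ k → s′ - k) (sym k≡k′)))

  -- Up to shifts m = s + (d - 1)k and n = s - k, so a quadratic form A m² + B n² loses its mixed
  -- term sk exactly if B = (d - 1)A. Then every residue class is again a product of two theta
  -- series, to be supplied as `R ρ`.
  dissect : ∀ {F G s t} → SumsTo F s → SumsTo G t → (R : Fin d → Series) →
            (∀ ρ → SumsTo (λ sk → F (row ρ (proj₁ sk) (proj₂ sk)) ⊗ G (proj₁ sk - proj₂ sk)) (R ρ)) →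
            s ⊗ t ≋ ∑Fin R
  dissect F→s G→t R FG→R = SumsTo-unique (SumsTo-⊗ F→s G→t)
    (SumsTo-reindex to from to-injective to-from (SumsTo-Fin d FG→R))

pow-* : ∀ ε δ j → pow (ε * δ) j ≡ pow ε j * pow δ j
pow-* ε δ j = go ∣ j ∣
  where
  swap : ∀ a b c d → (a * b) * (c * d) ≡ (a * c) * (b * d)
  swap = solve-∀
  go : ∀ n → (ε * δ) ℤ.^ n ≡ ε ℤ.^ n * δ ℤ.^ n
  go zero    = refl
  go (suc n) = trans (cong (ε * δ *_) (go n)) (swap ε δ (ε ℤ.^ n) (δ ℤ.^ n))

expo₂-double : ∀ a b m c d n → + 2 * + (expo a b m ℕ.+ expo c d n) ≡
               + a * (m * m + m) + + b * (m * m - m) + (+ c * (n * n + n) + + d * (n * n - n))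
expo₂-double a b m c d n = trans (ℤ.*-distribˡ-+ (+ 2) (+ expo a b m) (+ expo c d n))
                                 (cong₂ _+_ (expo-double a b m) (expo-double c d n))

module _ {ε δ ζ : ℤ} (c : ℤ) (e a b a₁ b₁ A B A₁ B₁ : ℕ) (m n s k : ℤ) where

  -- Both sides are signed monomials, so a dissection comes down to one sign identity and one
  -- identity of doubled exponents per residue class.
  θ-term₂-≋ :
    c * (pow ζ s * pow ζ k) ≡ pow ε m * pow δ n →
    + 2 * + e + (+ A * (s * s + s) + + B * (s * s - s) + (+ A₁ * (k * k + k) + + B₁ * (k * k - k))) ≡
    + a * (m * m + m) + + b * (m * m - m) + (+ a₁ * (n * n + n) + + b₁ * (n * n - n)) →
    (const c ⊗ q^ e) ⊗ (θ-term ζ A B s ⊗ θ-term ζ A₁ B₁ k) ≋ θ-term ε a b m ⊗ θ-term δ a₁ b₁ n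
  θ-term₂-≋ signs exponents = begin
    (const c ⊗ q^ e) ⊗ (θ-term ζ A B s ⊗ θ-term ζ A₁ B₁ k)
      ≈⟨ S.*-congˡ (monomial-⊗ (pow ζ s) (expo A B s) (pow ζ k) (expo A₁ B₁ k)) ⟩
    (const c ⊗ q^ e) ⊗ (const (pow ζ s * pow ζ k) ⊗ q^ (expo A B s ℕ.+ expo A₁ B₁ k))
      ≈⟨ monomial-⊗ c e (pow ζ s * pow ζ k) (expo A B s ℕ.+ expo A₁ B₁ k) ⟩
    const (c * (pow ζ s * pow ζ k)) ⊗ q^ (e ℕ.+ (expo A B s ℕ.+ expo A₁ B₁ k))
      ≈⟨ monomial-≡ signs (halve doubled) ⟩
    const (pow ε m * pow δ n) ⊗ q^ (expo a b m ℕ.+ expo a₁ b₁ n)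
      ≈⟨ monomial-⊗ (pow ε m) (expo a b m) (pow δ n) (expo a₁ b₁ n) ⟨
    θ-term ε a b m ⊗ θ-term δ a₁ b₁ n ∎
    where
    open ≋-Reasoning
    doubled : + 2 * + (e ℕ.+ (expo A B s ℕ.+ expo A₁ B₁ k)) ≡ + 2 * + (expo a b m ℕ.+ expo a₁ b₁ n)
    doubled = trans (ℤ.*-distribˡ-+ (+ 2) (+ e) (+ (expo A B s ℕ.+ expo A₁ B₁ k)))
      (trans (cong (_+_ (+ 2 * + e)) (expo₂-double A B s A₁ B₁ k))
        (trans exponents (sym (expo₂-double a b m a₁ b₁ n))))

SumsTo-θ₂ : ∀ {ζ} → ζ * ζ ≡ 1ℤ → ∀ c e A B .{{_ : NonZero (A ℕ.+ B)}} A₁ B₁ .{{_ : NonZero (A₁ ℕ.+ B₁)}} →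
            SumsTo (λ sk → (const c ⊗ q^ e) ⊗ (θ-term ζ A B (proj₁ sk) ⊗ θ-term ζ A₁ B₁ (proj₂ sk)))
                   ((const c ⊗ q^ e) ⊗ (θ ζ A B ⊗ θ ζ A₁ B₁))
SumsTo-θ₂ ζ²≡1 c e A B A₁ B₁ =
  SumsTo-scale (const c ⊗ q^ e) (SumsTo-⊗ (jacobi-triple-product ζ²≡1 A B) (jacobi-triple-product ζ²≡1 A₁ B₁))

const1-⊗-q^0-⊗ : ∀ g → (const 1ℤ ⊗ q^ 0) ⊗ g ≋ g
const1-⊗-q^0-⊗ g = S.trans
  (S.*-congʳ (S.trans (S.*-congʳ (S.sym one≋const)) (S.*-identityˡ one)))
  (S.*-identityˡ g)

-- Ramanujan's f(A,B) f(C,D) = f(AC,BD) f(AD,BC) + A f(B/C,AC²D) f(B/D,ACD²) for AB = CD. Here α and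
-- β are the exponents of B/C and B/D; this choice builds in AB = CD and keeps every exponent a
-- natural number.
θ-dissection₂ : ∀ {ε δ} → ε * ε ≡ 1ℤ → δ * δ ≡ 1ℤ → ∀ a′ α β → let a = suc a′ in
  θ ε a (a ℕ.+ (α ℕ.+ β)) ⊗ θ δ (a ℕ.+ β) (a ℕ.+ α) ≋
  θ (ε * δ) (2 ℕ.* a ℕ.+ β) (2 ℕ.* a ℕ.+ (2 ℕ.* α ℕ.+ β)) ⊗ θ (ε * δ) (2 ℕ.* a ℕ.+ α) (2 ℕ.* a ℕ.+ (α ℕ.+ 2 ℕ.* β))
  ⊕ (const ε ⊗ q^ a) ⊗ (θ (ε * δ) (4 ℕ.* a ℕ.+ (α ℕ.+ 2 ℕ.* β)) α ⊗ θ (ε * δ) (4 ℕ.* a ℕ.+ (2 ℕ.* α ℕ.+ β)) β)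
θ-dissection₂ {ε} {δ} ε²≡1 δ²≡1 a′ α β = S.trans
  (dissect (jacobi-triple-product ε²≡1 a b) (jacobi-triple-product δ²≡1 a₁ b₁) R sums)
  (S.+-cong (const1-⊗-q^0-⊗ _) (S.+-identityʳ _))
  where
  open Dissection 2 0ℤ
  a = suc a′
  b = a ℕ.+ (α ℕ.+ β)
  a₁ = a ℕ.+ β
  b₁ = a ℕ.+ α
  A₀ = 2 ℕ.* a ℕ.+ β
  B₀ = 2 ℕ.* a ℕ.+ (2 ℕ.* α ℕ.+ β)
  C₀ = 2 ℕ.* a ℕ.+ α
  D₀ = 2 ℕ.* a ℕ.+ (α ℕ.+ 2 ℕ.* β)
  A₁ = 4 ℕ.* a ℕ.+ (α ℕ.+ 2 ℕ.* β)
  C₁ = 4 ℕ.* a ℕ.+ (2 ℕ.* α ℕ.+ β)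
  εδ²≡1 : (ε * δ) * (ε * δ) ≡ 1ℤ
  εδ²≡1 = trans (swap ε δ) (cong₂ _*_ ε²≡1 δ²≡1)
    where
    swap : ∀ a b → (a * b) * (a * b) ≡ (a * a) * (b * b)
    swap = solve-∀
  R : Fin 2 → Series
  R zero       = (const 1ℤ ⊗ q^ 0) ⊗ (θ (ε * δ) A₀ B₀ ⊗ θ (ε * δ) C₀ D₀)
  R (suc zero) = (const ε ⊗ q^ a) ⊗ (θ (ε * δ) A₁ α ⊗ θ (ε * δ) C₁ β)
  -- As δ² = 1, the sign of n = s - k is that of s + k, so s and k both receive the sign εδ.
  signs : ∀ c s k → pow ε c * (pow (ε * δ) s * pow (ε * δ) k) ≡ pow ε (s + 1ℤ * k + c) * pow δ (s - k)
  signs c s k = sym (begin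
    pow ε (s + 1ℤ * k + c) * pow δ (s - k)
      ≡⟨ cong₂ _*_ (trans (pow-+ ε²≡1 (s + 1ℤ * k) c)
                     (cong (_* pow ε c) (trans (pow-+ ε²≡1 s (1ℤ * k)) (cong (λ x → pow ε s * pow ε x) (ℤ.*-identityˡ k)))))
                   (trans (pow-+ δ²≡1 s (- k)) (cong (pow δ s *_) (pow-neg δ k))) ⟩
    pow ε s * pow ε k * pow ε c * (pow δ s * pow δ k)
      ≡⟨ rearrange (pow ε s) (pow ε k) (pow ε c) (pow δ s) (pow δ k) ⟩
    pow ε c * (pow ε s * pow δ s * (pow ε k * pow δ k))
      ≡⟨ cong (pow ε c *_) (cong₂ _*_ (pow-* ε δ s) (pow-* ε δ k)) ⟨
    pow ε c * (pow (ε * δ) s * pow (ε * δ) k) ∎)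
    where
    open ≡-Reasoning
    rearrange : ∀ a b c d e → a * b * c * (d * e) ≡ c * (a * d * (b * e))
    rearrange = solve-∀
  -- Written so that at a = + m the doublings and quadruplings of a, α and β
  -- compute to the numerals 2 * m and 4 * m of the statement.
  exponents₀ : ∀ a α β s k →
    + 2 * 0ℤ + (((a + (a + 0ℤ)) + β) * (s * s + s) + ((a + (a + 0ℤ)) + ((α + (α + 0ℤ)) + β)) * (s * s - s)
      + (((a + (a + 0ℤ)) + α) * (k * k + k) + ((a + (a + 0ℤ)) + (α + (β + (β + 0ℤ)))) * (k * k - k))) ≡
    a * ((s + 1ℤ * k + 0ℤ) * (s + 1ℤ * k + 0ℤ) + (s + 1ℤ * k + 0ℤ))
    + (a + (α + β)) * ((s + 1ℤ * k + 0ℤ) * (s + 1ℤ * k + 0ℤ) - (s + 1ℤ * k + 0ℤ))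
    + ((a + β) * ((s - k) * (s - k) + (s - k)) + (a + α) * ((s - k) * (s - k) - (s - k)))
  exponents₀ = solve-∀
  exponents₁ : ∀ a α β s k →
    + 2 * a + (((a + (a + (a + (a + 0ℤ)))) + (α + (β + (β + 0ℤ)))) * (s * s + s) + α * (s * s - s)
      + (((a + (a + (a + (a + 0ℤ)))) + ((α + (α + 0ℤ)) + β)) * (k * k + k) + β * (k * k - k))) ≡
    a * ((s + 1ℤ * k + 1ℤ) * (s + 1ℤ * k + 1ℤ) + (s + 1ℤ * k + 1ℤ))
    + (a + (α + β)) * ((s + 1ℤ * k + 1ℤ) * (s + 1ℤ * k + 1ℤ) - (s + 1ℤ * k + 1ℤ))
    + ((a + β) * ((s - k) * (s - k) + (s - k)) + (a + α) * ((s - k) * (s - k) - (s - k)))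
  exponents₁ = solve-∀
  sums : ∀ ρ → SumsTo (λ sk → θ-term ε a b (row ρ (proj₁ sk) (proj₂ sk)) ⊗
                              θ-term δ a₁ b₁ (proj₁ sk - proj₂ sk)) (R ρ)
  sums zero = SumsTo-cong
    (λ (s , k) → θ-term₂-≋ 1ℤ 0 a b a₁ b₁ A₀ B₀ C₀ D₀ (row zero s k) (s - k) s k
      (signs 0ℤ s k) (exponents₀ (+ a) (+ α) (+ β) s k))
    S.refl (SumsTo-θ₂ εδ²≡1 1ℤ 0 A₀ B₀ C₀ D₀)
  sums (suc zero) = SumsTo-cong
    (λ (s , k) → θ-term₂-≋ ε a a b a₁ b₁ A₁ α C₁ β (row (suc zero) s k) (s - k) s k
      (trans (cong (_* (pow (ε * δ) s * pow (ε * δ) k)) (sym (ℤ.*-identityʳ ε))) (signs 1ℤ s k))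
      (exponents₁ (+ a) (+ α) (+ β) s k))
    S.refl (SumsTo-θ₂ εδ²≡1 ε a A₁ α C₁ β)

-- The quadratic parts 2m² and 4n² have ratio 2 = d - 1 for d = 3: with m = s + 2k and n = s - k
-- they become 6s² + 12k². The two outer classes are mirror images of each other and have the same
-- sum.
θ-dissection₃ :
  θ 1ℤ 2 2 ⊗ θ -1ℤ 4 4 ≋ (const 1ℤ ⊗ q^ 2) ⊗ (θ -1ℤ 2 10 ⊗ θ -1ℤ 4 20)
                       ⊕ (θ -1ℤ 6 6 ⊗ θ -1ℤ 12 12 ⊕ (const 1ℤ ⊗ q^ 2) ⊗ (θ -1ℤ 10 2 ⊗ θ -1ℤ 20 4))
θ-dissection₃ = S.trans
  (dissect (jacobi-triple-product refl 2 2) (jacobi-triple-product refl 4 4) R sums)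
  (S.+-congˡ (S.+-cong (const1-⊗-q^0-⊗ _) (S.+-identityʳ _)))
  where
  -- The offset 1 turns the shifts of m into -1, 0 and 1. A shift by 2 would lead to theta functions
  -- with a negative exponent parameter.
  open Dissection 3 1ℤ
  R : Fin 3 → Series
  R zero             = (const 1ℤ ⊗ q^ 2) ⊗ (θ -1ℤ 2 10 ⊗ θ -1ℤ 4 20)
  R (suc zero)       = (const 1ℤ ⊗ q^ 0) ⊗ (θ -1ℤ 6 6 ⊗ θ -1ℤ 12 12)
  R (suc (suc zero)) = (const 1ℤ ⊗ q^ 2) ⊗ (θ -1ℤ 10 2 ⊗ θ -1ℤ 20 4)
  signs : ∀ m s k → 1ℤ * (pow -1ℤ s * pow -1ℤ k) ≡ pow 1ℤ m * pow -1ℤ (s - k)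
  signs m s k = cong₂ _*_ (sym (ℤ.^-zeroˡ ∣ m ∣))
    (sym (trans (pow-+ refl s (- k)) (cong (pow -1ℤ s *_) (pow-neg -1ℤ k))))
  exponents₀ : ∀ s k →
    + 2 * + 2 + (+ 2 * (s * s + s) + + 10 * (s * s - s) + (+ 4 * (k * k + k) + + 20 * (k * k - k))) ≡
    + 2 * ((s + + 2 * k + -1ℤ) * (s + + 2 * k + -1ℤ) + (s + + 2 * k + -1ℤ))
    + + 2 * ((s + + 2 * k + -1ℤ) * (s + + 2 * k + -1ℤ) - (s + + 2 * k + -1ℤ))
    + (+ 4 * ((s - k) * (s - k) + (s - k)) + + 4 * ((s - k) * (s - k) - (s - k)))
  exponents₀ = solve-∀
  exponents₁ : ∀ s k →
    + 2 * + 0 + (+ 6 * (s * s + s) + + 6 * (s * s - s) + (+ 12 * (k * k + k) + + 12 * (k * k - k))) ≡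
    + 2 * ((s + + 2 * k + 0ℤ) * (s + + 2 * k + 0ℤ) + (s + + 2 * k + 0ℤ))
    + + 2 * ((s + + 2 * k + 0ℤ) * (s + + 2 * k + 0ℤ) - (s + + 2 * k + 0ℤ))
    + (+ 4 * ((s - k) * (s - k) + (s - k)) + + 4 * ((s - k) * (s - k) - (s - k)))
  exponents₁ = solve-∀
  exponents₂ : ∀ s k →
    + 2 * + 2 + (+ 10 * (s * s + s) + + 2 * (s * s - s) + (+ 20 * (k * k + k) + + 4 * (k * k - k))) ≡
    + 2 * ((s + + 2 * k + 1ℤ) * (s + + 2 * k + 1ℤ) + (s + + 2 * k + 1ℤ))
    + + 2 * ((s + + 2 * k + 1ℤ) * (s + + 2 * k + 1ℤ) - (s + + 2 * k + 1ℤ))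
    + (+ 4 * ((s - k) * (s - k) + (s - k)) + + 4 * ((s - k) * (s - k) - (s - k)))
  exponents₂ = solve-∀
  sums : ∀ ρ → SumsTo (λ sk → θ-term 1ℤ 2 2 (row ρ (proj₁ sk) (proj₂ sk)) ⊗
                              θ-term -1ℤ 4 4 (proj₁ sk - proj₂ sk)) (R ρ)
  sums zero = SumsTo-cong
    (λ (s , k) → θ-term₂-≋ 1ℤ 2 2 2 4 4 2 10 4 20 (row zero s k) (s - k) s k
      (signs (row zero s k) s k) (exponents₀ s k))
    S.refl (SumsTo-θ₂ refl 1ℤ 2 2 10 4 20)
  sums (suc zero) = SumsTo-cong
    (λ (s , k) → θ-term₂-≋ 1ℤ 0 2 2 4 4 6 6 12 12 (row (suc zero) s k) (s - k) s k
      (signs (row (suc zero) s k) s k) (exponents₁ s k))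
    S.refl (SumsTo-θ₂ refl 1ℤ 0 6 6 12 12)
  sums (suc (suc zero)) = SumsTo-cong
    (λ (s , k) → θ-term₂-≋ 1ℤ 2 2 2 4 4 10 2 20 4 (row (suc (suc zero)) s k) (s - k) s k
      (signs (row (suc (suc zero)) s k) s k) (exponents₂ s k))
    S.refl (SumsTo-θ₂ refl 1ℤ 2 10 2 20 4)

-- The dissection of f₁³ / f₃

module _ {q x₁ x₂ x₃ x₆ y₁ y₂ y₃ y₆ J₁ J₃ : Series}
  (x₁y₁y₂ : x₁ ⊗ y₁ ⊗ y₂ ≋ const 1ℤ)
  (J₁² : J₁ ⊗ J₁ ≋ y₁ ⊗ y₃ ⊗ y₃ ⊗ x₆ ⊗ x₆ ⊕ const (- + 2) ⊗ q ⊗ (y₂ ⊗ y₆ ⊗ y₆ ⊗ x₆ ⊗ x₆))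
  (J₁J₃ : J₁ ⊗ J₃ ≋ y₂ ⊗ y₂ ⊗ x₆ ⊗ x₆ ⊕ const -1ℤ ⊗ q ⊗ (y₁ ⊗ y₁ ⊗ x₆ ⊗ x₆))
  (even : y₂ ⊗ y₃ ⊗ y₃ ⊗ x₆ ⊗ x₆ ⊕ const (+ 2) ⊗ q ⊗ q ⊗ (y₁ ⊗ y₆ ⊗ y₆ ⊗ x₆ ⊗ x₆) ≋
          (y₁ ⊗ y₂ ⊗ x₃ ⊗ x₆) ⊗ (y₁ ⊗ y₂ ⊗ x₃ ⊗ x₆))
  (odd₁ : (x₂ ⊗ x₆ ⊗ y₂ ⊗ y₆) ⊗ (x₂ ⊗ x₆ ⊗ y₂ ⊗ y₆) ≋
          y₁ ⊗ x₃ ⊗ x₃ ⊗ x₆ ⊗ x₆ ⊕ const -1ℤ ⊗ q ⊗ q ⊗ ((x₁ ⊗ y₁ ⊗ x₆ ⊗ y₆) ⊗ (x₁ ⊗ y₁ ⊗ x₆ ⊗ y₆)))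
  (odd₂ : (y₁ ⊗ y₃ ⊗ x₂ ⊗ x₆) ⊗ (y₁ ⊗ y₃ ⊗ x₂ ⊗ x₆) ≋
          x₃ ⊗ x₃ ⊗ x₆ ⊗ x₆ ⊗ y₂ ⊕ const (+ 2) ⊗ q ⊗ q ⊗ (x₁ ⊗ x₆ ⊗ x₆ ⊗ y₆ ⊗ y₆))
  where

  private
    -- After substitution the terms with q² are 2q² `x₁` `y₁` `y₆`² `x₆`⁴ times 1 - `x₁` `y₁` `y₂`,
    -- hence cancel. The remaining ones are 1 and 2 copies of the same product.
    odd-sum : (y₁ ⊗ x₆ ⊗ x₆) ⊗ ((y₁ ⊗ y₃ ⊗ x₂ ⊗ x₆) ⊗ (y₁ ⊗ y₃ ⊗ x₂ ⊗ x₆))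
            ⊕ const (+ 2) ⊗ (y₂ ⊗ x₆ ⊗ x₆) ⊗ ((x₂ ⊗ x₆ ⊗ y₂ ⊗ y₆) ⊗ (x₂ ⊗ x₆ ⊗ y₂ ⊗ y₆)) ≋
            const (+ 3) ⊗ (x₆ ⊗ x₆ ⊗ x₆ ⊗ x₆) ⊗ (x₃ ⊗ x₃) ⊗ (y₁ ⊗ y₂)
    odd-sum = S.trans (S.+-cong (S.*-congˡ odd₂) (S.*-congˡ odd₁))
      (S.trans (expand q x₁ x₃ x₆ y₁ y₂ y₆)
        (S.trans (S.+-congʳ (S.*-congˡ x₁y₁y₂)) (collect q x₁ x₃ x₆ y₁ y₂ y₆)))
      where
      expand : ∀ q x₁ x₃ x₆ y₁ y₂ y₆ → _
      expand = solve 7 (λ q x₁ x₃ x₆ y₁ y₂ y₆ →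
        (y₁ :* x₆ :* x₆) :* (x₃ :* x₃ :* x₆ :* x₆ :* y₂ :+ con (+ 2) :* q :* q :* (x₁ :* x₆ :* x₆ :* y₆ :* y₆))
        :+ con (+ 2) :* (y₂ :* x₆ :* x₆) :* (y₁ :* x₃ :* x₃ :* x₆ :* x₆ :+ con -1ℤ :* q :* q :* ((x₁ :* y₁ :* x₆ :* y₆) :* (x₁ :* y₁ :* x₆ :* y₆)))
        := (con (- + 2) :* q :* q :* (x₁ :* y₁ :* y₆ :* y₆ :* x₆ :* x₆ :* x₆ :* x₆)) :* (x₁ :* y₁ :* y₂)
        :+ (con (+ 2) :* q :* q :* (x₁ :* y₁ :* y₆ :* y₆ :* x₆ :* x₆ :* x₆ :* x₆)
          :+ con (+ 3) :* (x₆ :* x₆ :* x₆ :* x₆) :* (x₃ :* x₃) :* (y₁ :* y₂))) S.refl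
      collect : ∀ q x₁ x₃ x₆ y₁ y₂ y₆ → _
      collect = solve 7 (λ q x₁ x₃ x₆ y₁ y₂ y₆ →
        (con (- + 2) :* q :* q :* (x₁ :* y₁ :* y₆ :* y₆ :* x₆ :* x₆ :* x₆ :* x₆)) :* con 1ℤ
        :+ (con (+ 2) :* q :* q :* (x₁ :* y₁ :* y₆ :* y₆ :* x₆ :* x₆ :* x₆ :* x₆)
          :+ con (+ 3) :* (x₆ :* x₆ :* x₆ :* x₆) :* (x₃ :* x₃) :* (y₁ :* y₂))
        := con (+ 3) :* (x₆ :* x₆ :* x₆ :* x₆) :* (x₃ :* x₃) :* (y₁ :* y₂)) S.refl

  -- The even part of the product is a multiple of the left side of `even`; the odd part, with `x₁`³
  -- `x₂` taken out, is the left side of `odd-sum`. The powers of `x₁` are just enough to remove all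
  -- remaining `y₁` and `y₂` through `x₁y₁y₂`: three times in the even part, once in the odd part.
  cube-product : (J₁ ⊗ J₁) ⊗ (J₁ ⊗ J₃) ⊗ (x₁ ⊗ x₁ ⊗ x₁ ⊗ (x₂ ⊗ x₂ ⊗ x₂)) ≋
                 (x₃ ⊗ x₃ ⊗ x₆ ⊗ x₆ ⊗ x₆ ⊗ x₆) ⊗ (x₂ ⊗ x₂ ⊗ x₂ ⊕ const (- + 3) ⊗ q ⊗ (x₁ ⊗ x₁ ⊗ x₂))
  cube-product = begin
    (J₁ ⊗ J₁) ⊗ (J₁ ⊗ J₃) ⊗ (x₁ ⊗ x₁ ⊗ x₁ ⊗ (x₂ ⊗ x₂ ⊗ x₂))
      ≈⟨ S.*-congʳ (S.*-cong J₁² J₁J₃) ⟩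
    _ ≈⟨ split q x₁ x₂ x₆ y₁ y₂ y₃ y₆ ⟩
    _ ≈⟨ S.+-cong (S.*-congˡ even) (S.*-congˡ odd-sum) ⟩
    _ ≈⟨ merge q x₁ x₂ x₃ x₆ y₁ y₂ ⟩
    _ ≈⟨ S.*-congˡ (S.+-cong (S.*-congˡ (S.*-cong (S.*-cong x₁y₁y₂ x₁y₁y₂) x₁y₁y₂)) (S.*-congˡ x₁y₁y₂)) ⟩
    _ ≈⟨ simplify q x₁ x₂ x₃ x₆ ⟩
    (x₃ ⊗ x₃ ⊗ x₆ ⊗ x₆ ⊗ x₆ ⊗ x₆) ⊗ (x₂ ⊗ x₂ ⊗ x₂ ⊕ const (- + 3) ⊗ q ⊗ (x₁ ⊗ x₁ ⊗ x₂)) ∎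
    where
    open ≋-Reasoning
    split : ∀ q x₁ x₂ x₆ y₁ y₂ y₃ y₆ → _
    split = solve 8 (λ q x₁ x₂ x₆ y₁ y₂ y₃ y₆ →
      (y₁ :* y₃ :* y₃ :* x₆ :* x₆ :+ con (- + 2) :* q :* (y₂ :* y₆ :* y₆ :* x₆ :* x₆))
      :* (y₂ :* y₂ :* x₆ :* x₆ :+ con -1ℤ :* q :* (y₁ :* y₁ :* x₆ :* x₆))
      :* (x₁ :* x₁ :* x₁ :* (x₂ :* x₂ :* x₂))
      := (x₁ :* x₁ :* x₁ :* x₂ :* x₂ :* x₂ :* y₁ :* y₂ :* x₆ :* x₆)
        :* (y₂ :* y₃ :* y₃ :* x₆ :* x₆ :+ con (+ 2) :* q :* q :* (y₁ :* y₆ :* y₆ :* x₆ :* x₆))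
      :+ (con -1ℤ :* q :* (x₁ :* x₁ :* x₁ :* x₂))
        :* ((y₁ :* x₆ :* x₆) :* ((y₁ :* y₃ :* x₂ :* x₆) :* (y₁ :* y₃ :* x₂ :* x₆))
            :+ con (+ 2) :* (y₂ :* x₆ :* x₆) :* ((x₂ :* x₆ :* y₂ :* y₆) :* (x₂ :* x₆ :* y₂ :* y₆)))) S.refl
    merge : ∀ q x₁ x₂ x₃ x₆ y₁ y₂ → _
    merge = solve 7 (λ q x₁ x₂ x₃ x₆ y₁ y₂ →
      (x₁ :* x₁ :* x₁ :* x₂ :* x₂ :* x₂ :* y₁ :* y₂ :* x₆ :* x₆)
        :* ((y₁ :* y₂ :* x₃ :* x₆) :* (y₁ :* y₂ :* x₃ :* x₆))
      :+ (con -1ℤ :* q :* (x₁ :* x₁ :* x₁ :* x₂))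
        :* (con (+ 3) :* (x₆ :* x₆ :* x₆ :* x₆) :* (x₃ :* x₃) :* (y₁ :* y₂))
      := (x₃ :* x₃ :* x₆ :* x₆ :* x₆ :* x₆)
        :* ((x₂ :* x₂ :* x₂) :* ((x₁ :* y₁ :* y₂) :* (x₁ :* y₁ :* y₂) :* (x₁ :* y₁ :* y₂))
            :+ (con (- + 3) :* q :* (x₁ :* x₁ :* x₂)) :* (x₁ :* y₁ :* y₂))) S.refl
    simplify : ∀ q x₁ x₂ x₃ x₆ → _
    simplify = solve 5 (λ q x₁ x₂ x₃ x₆ →
      (x₃ :* x₃ :* x₆ :* x₆ :* x₆ :* x₆)
        :* ((x₂ :* x₂ :* x₂) :* (con 1ℤ :* con 1ℤ :* con 1ℤ) :+ (con (- + 3) :* q :* (x₁ :* x₁ :* x₂)) :* con 1ℤ)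
      := (x₃ :* x₃ :* x₆ :* x₆ :* x₆ :* x₆)
        :* (x₂ :* x₂ :* x₂ :+ con (- + 3) :* q :* (x₁ :* x₁ :* x₂))) S.refl

-- Series with nonnegative coefficients

q^-⊗-at-+ : ∀ e g n → (q^ e ⊗ g) (e ℕ.+ n) ≡ g n
q^-⊗-at-+ zero    g n = at (S.*-identityˡ g) n
q^-⊗-at-+ (suc e) g n = trans (q^-suc-⊗-suc e g (e ℕ.+ n)) (q^-⊗-at-+ e g n)

q^-⊗-at-< : ∀ e g {n} → n ℕ.< e → (q^ e ⊗ g) n ≡ 0ℤ
q^-⊗-at-< (suc e) g {zero}  _         = q^-suc-⊗-zero e g
q^-⊗-at-< (suc e) g {suc n} (s≤s n<e) = trans (q^-suc-⊗-suc e g n) (q^-⊗-at-< e g n<e)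

-- The series 1 / (1 - q^c). Using `reciprocalPrefix` directly makes it total in c, without a proof
-- about the constant term; for c ≠ 0 it is the inverse by `geo-inverse`.
geo : ℕ → Series
geo c n = reciprocalPrefix (one ⊖ q^ c) n zero

geo-inverse : ∀ c .{{_ : NonZero c}} → (1+ -1ℤ q^ c) ⊗ geo c ≋ one
geo-inverse c@(suc _) = S.trans (S.*-congʳ (S.sym (one⊖q^≋ c)))
  (pointwise λ n → trans (⊗-at (one ⊖ q^ c) (geo c) n) (⊛-reciprocal (one ⊖ q^ c) refl n))

geo-step : ∀ c .{{_ : NonZero c}} → geo c ≋ one ⊕ q^ c ⊗ geo c
geo-step c = S.trans (S.sym (S.*-identityˡ (geo c)))
  (S.trans (S.trans (S.*-congʳ (S.sym (cancel one (q^ c)))) (expand one (q^ c) (geo c)))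
           (S.+-congʳ (geo-inverse c)))
  where
  cancel : ∀ o x → (o ⊕ const -1ℤ ⊗ x) ⊕ x ≋ o
  cancel = solve 2 (λ o x → (o :+ con -1ℤ :* x) :+ x := o) S.refl
  expand : ∀ o x g → ((o ⊕ const -1ℤ ⊗ x) ⊕ x) ⊗ g ≋ (o ⊕ const -1ℤ ⊗ x) ⊗ g ⊕ x ⊗ g
  expand = solve 3 (λ o x g → ((o :+ con -1ℤ :* x) :+ x) :* g := (o :+ con -1ℤ :* x) :* g :+ x :* g) S.refl

geo-at-+ : ∀ c .{{_ : NonZero c}} n → geo c (c ℕ.+ n) ≡ geo c n
geo-at-+ c@(suc _) n = begin
  geo c (c ℕ.+ n)                            ≡⟨ at (geo-step c) (c ℕ.+ n) ⟩
  (one ⊕ q^ c ⊗ geo c) (c ℕ.+ n)             ≡⟨ ⊕-at one (q^ c ⊗ geo c) (c ℕ.+ n) ⟩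
  0ℤ + (q^ c ⊗ geo c) (c ℕ.+ n)              ≡⟨ ℤ.+-identityˡ _ ⟩
  (q^ c ⊗ geo c) (c ℕ.+ n)                   ≡⟨ q^-⊗-at-+ c (geo c) n ⟩
  geo c n                                    ∎
  where open ≡-Reasoning

geo-at-< : ∀ c .{{_ : NonZero c}} {n} → n ℕ.< c → geo c n ≡ one n
geo-at-< c {n} n<c = begin
  geo c n                       ≡⟨ at (geo-step c) n ⟩
  (one ⊕ q^ c ⊗ geo c) n        ≡⟨ ⊕-at one (q^ c ⊗ geo c) n ⟩
  one n + (q^ c ⊗ geo c) n      ≡⟨ cong (_+_ (one n)) (q^-⊗-at-< c (geo c) n<c) ⟩
  one n + 0ℤ                    ≡⟨ ℤ.+-identityʳ (one n) ⟩
  one n                         ∎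
  where open ≡-Reasoning

geo-≈ : ∀ c .{{_ : NonZero c}} {N} → N ℕ.≤ c → geo c ≈[ N ] one
geo-≈ c N≤c = mod-q λ n<N → geo-at-< c (ℕ.<-≤-trans n<N N≤c)

ipoch : ℕ → ℕ → ℕ → Series
ipoch a M zero    = one
ipoch a M (suc N) = geo (a ℕ.+ N ℕ.* M) ⊗ ipoch a M N

iP : ℕ → ℕ → Series
iP a M = limit (ipoch a M)

module _ (a M : ℕ) .{{_ : NonZero a}} .{{_ : NonZero M}} where

  private
    exponent≢0 : ∀ N → NonZero (a ℕ.+ N ℕ.* M)
    exponent≢0 N = ℕ.>-nonZero (ℕ.≤-trans (ℕ.>-nonZero⁻¹ a) (ℕ.m≤m+n a (N ℕ.* M)))

  ipoch-≈ : ∀ N → ipoch a M N ≈[ N ] iP a M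
  ipoch-≈ = limit-≈ (ipoch a M) λ N →
    one-⊗-≈ _ (geo-≈ (a ℕ.+ N ℕ.* M) {{exponent≢0 N}} (ℕ.≤-trans (ℕ.m≤m*n N M) (ℕ.m≤n+m _ a)))

  P-iP : P -1ℤ a M ⊗ iP a M ≋ one
  P-iP = S.sym (P-product one (poch -1ℤ a M) (ipoch a M) (poch-≈ -1ℤ a M) ipoch-≈
                 λ N → ≋⇒≈ (S.sym (finite N)))
    where
    finite : ∀ N → poch -1ℤ a M N ⊗ ipoch a M N ≋ one
    finite zero    = S.*-identityˡ one
    finite (suc N) = S.trans (⊗-medial _ _ _ _)
      (S.trans (S.*-cong (geo-inverse (a ℕ.+ N ℕ.* M) {{exponent≢0 N}}) (finite N)) (S.*-identityˡ one))

module _ (m : ℕ) where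

  -- The constant term 1 is part of the invariant so that a strictly positive coefficient of one
  -- factor survives multiplication by the other.
  record Nonneg (g : Series) : Set where
    field
      nonneg : ∀ n → 0ℤ ≤ g n
      sparse : ∀ n → ¬ m ∣ n → g n ≡ 0ℤ
      head≡1 : g 0 ≡ 1ℤ

  Positive : Series → Set
  Positive g = ∀ n → m ∣ n → 0ℤ < g n

open Nonneg

*-nonneg : ∀ {x y} → 0ℤ ≤ x → 0ℤ ≤ y → 0ℤ ≤ x * y
*-nonneg {x} {y} 0≤x 0≤y = subst (_≤ x * y) (ℤ.*-zeroʳ x) (ℤ.*-monoˡ-≤-nonNeg x {{ℤ.nonNegative 0≤x}} 0≤y)

⊛-nonneg : ∀ {g h : Series} → (∀ n → 0ℤ ≤ g n) → (∀ n → 0ℤ ≤ h n) → ∀ n → 0ℤ ≤ (g ⊛ h) n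
⊛-nonneg 0≤g 0≤h zero    = ℤ.+-mono-≤ (*-nonneg (0≤g 0) (0≤h 0)) ℤ.≤-refl
⊛-nonneg 0≤g 0≤h (suc n) = ℤ.+-mono-≤ (*-nonneg (0≤g 0) (0≤h (suc n)))
                                      (⊛-nonneg (λ i → 0≤g (suc i)) 0≤h n)

⊛-zero : ∀ n {g h : Series} → (∀ i j → i ℕ.+ j ≡ n → g i * h j ≡ 0ℤ) → (g ⊛ h) n ≡ 0ℤ
⊛-zero zero    gh≡0 = cong (_+ 0ℤ) (gh≡0 0 0 refl)
⊛-zero (suc n) {g} {h} gh≡0 = cong₂ _+_ (gh≡0 0 (suc n) refl)
  (⊛-zero n {tail g} {h} λ i j i+j≡n → gh≡0 (suc i) j (cong suc i+j≡n))

one-Nonneg : ∀ {m} → Nonneg m one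
one-Nonneg = record
  { nonneg = λ { zero → ℤ.+≤+ z≤n ; (suc _) → ℤ.≤-refl }
  ; sparse = λ { zero m∤0 → contradiction (_ ∣0) m∤0 ; (suc _) _ → refl }
  ; head≡1 = refl
  }

⊗-Nonneg : ∀ {m g h} → Nonneg m g → Nonneg m h → Nonneg m (g ⊗ h)
⊗-Nonneg {m} {g} {h} G H = record
  { nonneg = λ n → subst (0ℤ ≤_) (sym (⊗-at g h n)) (⊛-nonneg (nonneg G) (nonneg H) n)
  ; sparse = λ n m∤n → trans (⊗-at g h n) (⊛-zero n {g} {h} λ i j i+j≡n → product i j (λ m∣i+j → m∤n (subst (m ∣_) i+j≡n m∣i+j)))
  ; head≡1 = trans (⊗-at g h 0) (cong₂ (λ x y → x * y + 0ℤ) (head≡1 G) (head≡1 H))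
  }
  where
  product : ∀ i j → ¬ m ∣ i ℕ.+ j → g i * h j ≡ 0ℤ
  product i j m∤i+j with m ∣? i
  ... | no  m∤i = cong (_* h j) (sparse G i m∤i)
  ... | yes m∣i = trans (cong (g i *_) (sparse H j λ m∣j → m∤i+j (∣m∣n⇒∣m+n m∣i m∣j))) (ℤ.*-zeroʳ (g i))

-- The summand `g 0 * h n` is `h n`, already positive, and all other summands are nonnegative.
-- Strictness comes from the right factor, which governs the order of factors in the products below.
⊗-Positive : ∀ {m g h} → Nonneg m g → Nonneg m h → Positive m h → Positive m (g ⊗ h)
⊗-Positive {m} {g} {h} G H 0<h n m∣n = subst (0ℤ <_) (sym (⊗-at g h n)) (go n m∣n)
  where
  leading : ∀ n → m ∣ n → 0ℤ < g 0 * h n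
  leading n m∣n = subst (0ℤ <_) (sym (trans (cong (_* h n) (head≡1 G)) (ℤ.*-identityˡ (h n)))) (0<h n m∣n)
  go : ∀ n → m ∣ n → 0ℤ < (g ⊛ h) n
  go zero    m∣n = ℤ.+-mono-<-≤ (leading 0 m∣n) ℤ.≤-refl
  go (suc n) m∣n = ℤ.+-mono-<-≤ (leading (suc n) m∣n) (⊛-nonneg (λ i → nonneg G (suc i)) (nonneg H) n)

limit-Nonneg : ∀ {m} {s : ℕ → Series} → (∀ N → Nonneg m (s N)) → Nonneg m (limit s)
limit-Nonneg S = record
  { nonneg = λ n → nonneg (S (suc n)) n
  ; sparse = λ n → sparse (S (suc n)) n
  ; head≡1 = head≡1 (S 1)
  }

split-at : ∀ c n {A : Set} → (n ℕ.< c → A) → (∀ n′ → n ≡ c ℕ.+ n′ → A) → A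
split-at c n below above with n ℕ.<? c
... | yes n<c = below n<c
... | no  n≮c = above (n ∸ c) (sym (ℕ.m+[n∸m]≡n (ℕ.≮⇒≥ n≮c)))

geo-Nonneg : ∀ {m} c .{{_ : NonZero c}} → m ∣ c → Nonneg m (geo c)
geo-Nonneg {m} c@(suc _) m∣c = record
  { nonneg = <-rec _ λ n rec → split-at c n
      (λ n<c → subst (0ℤ ≤_) (sym (geo-at-< c n<c)) (nonneg (one-Nonneg {m}) n))
      (λ { n′ refl → subst (0ℤ ≤_) (sym (geo-at-+ c n′)) (rec (s≤s (ℕ.m≤n+m n′ _))) })
  ; sparse = <-rec _ λ n rec m∤n → split-at c n
      (λ n<c → trans (geo-at-< c n<c) (sparse one-Nonneg n m∤n))
      (λ { n′ refl → trans (geo-at-+ c n′) (rec (s≤s (ℕ.m≤n+m n′ _)) λ m∣n′ → m∤n (∣m∣n⇒∣m+n m∣c m∣n′)) })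
  ; head≡1 = refl
  }

geo-Positive : ∀ m .{{_ : NonZero m}} → Positive m (geo m)
geo-Positive m@(suc _) = <-rec _ λ n rec m∣n → split-at m n
  (λ n<m → subst (0ℤ <_) (sym (geo-at-< m n<m)) (one>0 n n<m m∣n))
  (λ { n′ refl → subst (0ℤ <_) (sym (geo-at-+ m n′)) (rec (s≤s (ℕ.m≤n+m n′ _)) (∣m+n∣m⇒∣n m∣n ∣-refl)) })
  where
  one>0 : ∀ n → n ℕ.< m → m ∣ n → 0ℤ < one n
  one>0 zero    _   _   = ℤ.+<+ (s≤s z≤n)
  one>0 (suc n) n<m m∣n = contradiction (∣⇒≤ m∣n) (ℕ.<⇒≱ n<m)

module _ {m : ℕ} (a M : ℕ) .{{_ : NonZero a}} .{{_ : NonZero M}} (m∣a : m ∣ a) (m∣M : m ∣ M) where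

  private
    exponent≢0 : ∀ N → NonZero (a ℕ.+ N ℕ.* M)
    exponent≢0 N = ℕ.>-nonZero (ℕ.≤-trans (ℕ.>-nonZero⁻¹ a) (ℕ.m≤m+n a (N ℕ.* M)))

    m∣exponent : ∀ N → m ∣ a ℕ.+ N ℕ.* M
    m∣exponent N = ∣m∣n⇒∣m+n m∣a (∣n⇒∣m*n N m∣M)

    ipoch-Nonneg : ∀ N → Nonneg m (ipoch a M N)
    ipoch-Nonneg zero    = one-Nonneg
    ipoch-Nonneg (suc N) = ⊗-Nonneg (geo-Nonneg (a ℕ.+ N ℕ.* M) {{exponent≢0 N}} (m∣exponent N)) (ipoch-Nonneg N)

    factor-Nonneg : ∀ c .{{_ : NonZero c}} → m ∣ c → Nonneg m (1+ 1ℤ q^ c)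
    factor-Nonneg c@(suc _) m∣c = record
      { nonneg = λ n → subst (0ℤ ≤_) (sym (value n)) (ℤ.+-mono-≤ (nonneg (one-Nonneg {m}) n) (monomial-nonneg c n))
      ; sparse = λ n m∤n → trans (value n) (cong₂ _+_ (sparse one-Nonneg n m∤n) (monomial-sparse c n (λ { refl → m∤n m∣c })))
      ; head≡1 = value 0
      }
      where
      value : ∀ n → (1+ 1ℤ q^ c) n ≡ one n + (q^ c) n
      value n = trans (⊕-at one (const 1ℤ ⊗ q^ c) n)
        (cong (_+_ (one n)) (trans (const-⊗ 1ℤ (q^ c) n) (ℤ.*-identityˡ ((q^ c) n))))
      monomial-nonneg : ∀ c n → 0ℤ ≤ (q^ c) n
      monomial-nonneg zero    zero    = ℤ.+≤+ z≤n
      monomial-nonneg (suc c) zero    = ℤ.≤-refl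
      monomial-nonneg zero    (suc n) = ℤ.≤-refl
      monomial-nonneg (suc c) (suc n) = monomial-nonneg c n
      monomial-sparse : ∀ c n → n ≢ c → (q^ c) n ≡ 0ℤ
      monomial-sparse zero    zero    n≢c = contradiction refl n≢c
      monomial-sparse (suc c) zero    n≢c = refl
      monomial-sparse zero    (suc n) n≢c = refl
      monomial-sparse (suc c) (suc n) n≢c = monomial-sparse c n λ n≡c → n≢c (cong suc n≡c)

    poch-Nonneg : ∀ N → Nonneg m (poch 1ℤ a M N)
    poch-Nonneg zero    = one-Nonneg
    poch-Nonneg (suc N) = ⊗-Nonneg (factor-Nonneg (a ℕ.+ N ℕ.* M) {{exponent≢0 N}} (m∣exponent N)) (poch-Nonneg N)

  iP-Nonneg : Nonneg m (iP a M)
  iP-Nonneg = limit-Nonneg ipoch-Nonneg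

  P-Nonneg : Nonneg m (P 1ℤ a M)
  P-Nonneg = limit-Nonneg poch-Nonneg

-- The first factor 1 / (1 - q^m) alone reaches every multiple of m; the other factors are
-- nonnegative with constant term 1. In `ipoch` it is the innermost factor on the right.
iP-Positive : ∀ m M .{{_ : NonZero m}} .{{_ : NonZero M}} → m ∣ M → Positive m (iP m M)
iP-Positive m@(suc _) M m∣M n = finite n n
  where
  g-Nonneg : ∀ N → Nonneg m (geo (m ℕ.+ N ℕ.* M))
  g-Nonneg N = geo-Nonneg (m ℕ.+ N ℕ.* M) (∣m∣n⇒∣m+n ∣-refl (∣n⇒∣m*n N m∣M))
  ip-Nonneg : ∀ N → Nonneg m (ipoch m M N)
  ip-Nonneg zero    = one-Nonneg
  ip-Nonneg (suc N) = ⊗-Nonneg (g-Nonneg N) (ip-Nonneg N)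
  finite : ∀ N → Positive m (ipoch m M (suc N))
  finite zero n m∣n = subst (0ℤ <_)
    (sym (trans (at (S.*-identityʳ (geo (m ℕ.+ 0))) n) (cong (λ c → geo c n) (ℕ.+-identityʳ m))))
    (geo-Positive m n m∣n)
  finite (suc N) = ⊗-Positive (g-Nonneg (suc N)) (ip-Nonneg (suc N)) (finite N)

-- The coefficients of f₁³ / (f₃ f₄⁴)

cancelʳ : ∀ {g h u v} → u ⊗ v ≋ one → g ⊗ u ≋ h ⊗ u → g ≋ h
cancelʳ {g} {h} {u} {v} uv≋1 gu≋hu = S.trans (S.sym (undo g)) (S.trans (S.*-congʳ gu≋hu) (undo h))
  where
  undo : ∀ g → (g ⊗ u) ⊗ v ≋ g
  undo g = S.trans (S.*-assoc g u v) (S.trans (S.*-congˡ uv≋1) (S.*-identityʳ g))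

-- The factor of index 0 is 1 + q⁰ = 2. Theta functions with a parameter 0 thereby contribute the
-- coefficients 2 and -2 of the dissections.
P-zero : ∀ M .{{_ : NonZero M}} → P 1ℤ 0 M ≋ const (+ 2) ⊗ P 1ℤ M M
P-zero M = S.trans (P-head 1ℤ 0 M) (S.*-congʳ (pointwise λ n →
  trans (⊕-at one (const 1ℤ ⊗ q^ 0) n) (trans (cong (_+_ (one n)) (const-⊗ 1ℤ (q^ 0) n)) (two n))))
  where
  two : ∀ n → one n + 1ℤ * one n ≡ const (+ 2) n
  two zero    = refl
  two (suc n) = refl

-- xᵢ and yᵢ are the products of 1 - q^{2k} and of 1 + q^{2k} over gcd(k, 6) = i.
x₁ x₂ x₃ x₆ y₁ y₂ y₃ y₆ q J₁ J₃ p₃ p₆ : Series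
x₁ = P -1ℤ 2 12 ⊗ P -1ℤ 10 12
x₂ = P -1ℤ 4 12 ⊗ P -1ℤ 8 12
x₃ = P -1ℤ 6 12
x₆ = P -1ℤ 12 12
y₁ = P 1ℤ 2 12 ⊗ P 1ℤ 10 12
y₂ = P 1ℤ 4 12 ⊗ P 1ℤ 8 12
y₃ = P 1ℤ 6 12
y₆ = P 1ℤ 12 12
q = q^ 1
J₁ = θ -1ℤ 1 5
J₃ = θ -1ℤ 3 3
p₃ = P -1ℤ 3 6
p₆ = P -1ℤ 6 6

-- The individual dissections and Euler's identity

p₆≋ : p₆ ≋ x₃ ⊗ x₆
p₆≋ = P-bisect -1ℤ 6 6

P44≋ : P -1ℤ 4 4 ≋ x₂ ⊗ x₆
P44≋ = P-trisect -1ℤ 4 4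

q²≋ : const 1ℤ ⊗ q^ 2 ≋ q ⊗ q
q²≋ = S.trans (S.*-congʳ (S.sym one≋const)) (S.trans (S.*-identityˡ (q^ 2)) (q^-+ 1 1))

-- This is `θ-dissection₂` with a = 1, α = 0 and β = 4. The vanishing α produces `θ 1ℤ 12 0`, hence
-- the -2.
J₁²≋ : J₁ ⊗ J₁ ≋ y₁ ⊗ y₃ ⊗ y₃ ⊗ x₆ ⊗ x₆ ⊕ const (- + 2) ⊗ q ⊗ (y₂ ⊗ y₆ ⊗ y₆ ⊗ x₆ ⊗ x₆)
J₁²≋ = begin
  J₁ ⊗ J₁
    ≈⟨ S.*-congˡ (S.*-congʳ (S.*-comm _ _)) ⟩
  θ -1ℤ 1 5 ⊗ θ -1ℤ 5 1
    ≈⟨ θ-dissection₂ refl refl 0 0 4 ⟩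
  θ 1ℤ 6 6 ⊗ θ 1ℤ 2 10 ⊕ (const -1ℤ ⊗ q) ⊗ (θ 1ℤ 12 0 ⊗ θ 1ℤ 8 4)
    ≈⟨ S.+-congˡ (S.*-congˡ (S.*-congʳ (S.*-congʳ (S.*-congˡ (P-zero 12))))) ⟩
  _ ≈⟨ rearrange q x₆ y₁ (P 1ℤ 4 12) (P 1ℤ 8 12) y₃ y₆ ⟩
  _ ∎
  where
  open ≋-Reasoning
  rearrange : ∀ q x₆ y₁ a b y₃ y₆ → _
  rearrange = solve 7 (λ q x₆ y₁ a b y₃ y₆ →
    ((y₃ :* y₃) :* x₆) :* (y₁ :* x₆)
    :+ (con -1ℤ :* q) :* (((y₆ :* (con (+ 2) :* y₆)) :* x₆) :* ((b :* a) :* x₆))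
    := y₁ :* y₃ :* y₃ :* x₆ :* x₆ :+ con (- + 2) :* q :* ((a :* b) :* y₆ :* y₆ :* x₆ :* x₆)) S.refl

J₁J₃≋ : J₁ ⊗ J₃ ≋ y₂ ⊗ y₂ ⊗ x₆ ⊗ x₆ ⊕ const -1ℤ ⊗ q ⊗ (y₁ ⊗ y₁ ⊗ x₆ ⊗ x₆)
J₁J₃≋ = begin
  J₁ ⊗ J₃
    ≈⟨ θ-dissection₂ refl refl 0 2 2 ⟩
  θ 1ℤ 4 8 ⊗ θ 1ℤ 4 8 ⊕ (const -1ℤ ⊗ q) ⊗ (θ 1ℤ 10 2 ⊗ θ 1ℤ 10 2)
    ≈⟨ rearrange q x₆ (P 1ℤ 2 12) (P 1ℤ 10 12) y₂ ⟩
  _ ∎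
  where
  open ≋-Reasoning
  rearrange : ∀ q x₆ a b y₂ → _
  rearrange = solve 5 (λ q x₆ a b y₂ →
    (y₂ :* x₆) :* (y₂ :* x₆) :+ (con -1ℤ :* q) :* (((b :* a) :* x₆) :* ((b :* a) :* x₆))
    := y₂ :* y₂ :* x₆ :* x₆ :+ con -1ℤ :* q :* ((a :* b) :* (a :* b) :* x₆ :* x₆)) S.refl

-- The right side is the square of `θ 1ℤ 2 4`: `y₁` and `y₂` together collect the classes of 2 and 4
-- modulo 6. Its dissection is the left side.
even≋ : y₂ ⊗ y₃ ⊗ y₃ ⊗ x₆ ⊗ x₆ ⊕ const (+ 2) ⊗ q ⊗ q ⊗ (y₁ ⊗ y₆ ⊗ y₆ ⊗ x₆ ⊗ x₆) ≋
        (y₁ ⊗ y₂ ⊗ x₃ ⊗ x₆) ⊗ (y₁ ⊗ y₂ ⊗ x₃ ⊗ x₆)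
even≋ = S.sym (begin
  (y₁ ⊗ y₂ ⊗ x₃ ⊗ x₆) ⊗ (y₁ ⊗ y₂ ⊗ x₃ ⊗ x₆)
    ≈⟨ regroup (P 1ℤ 2 12) (P 1ℤ 10 12) (P 1ℤ 4 12) (P 1ℤ 8 12) x₃ x₆ ⟩
  _ ≈⟨ S.*-cong (S.*-cong (S.*-cong (P-bisect 1ℤ 2 6) (P-bisect 1ℤ 4 6)) p₆≋)
                (S.*-cong (S.*-cong (P-bisect 1ℤ 4 6) (P-bisect 1ℤ 2 6)) p₆≋) ⟨
  θ 1ℤ 2 4 ⊗ θ 1ℤ 4 2
    ≈⟨ θ-dissection₂ refl refl 1 0 2 ⟩
  θ 1ℤ 6 6 ⊗ θ 1ℤ 4 8 ⊕ (const 1ℤ ⊗ q^ 2) ⊗ (θ 1ℤ 12 0 ⊗ θ 1ℤ 10 2)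
    ≈⟨ S.+-congˡ (S.*-cong q²≋ (S.*-congʳ (S.*-congʳ (S.*-congˡ (P-zero 12))))) ⟩
  _ ≈⟨ rearrange q x₆ (P 1ℤ 2 12) (P 1ℤ 10 12) y₂ y₃ y₆ ⟩
  _ ∎)
  where
  open ≋-Reasoning
  regroup : ∀ a b c d x₃ x₆ → _
  regroup = solve 6 (λ a b c d x₃ x₆ →
    ((a :* b) :* (c :* d) :* x₃ :* x₆) :* ((a :* b) :* (c :* d) :* x₃ :* x₆)
    := (((a :* d) :* (c :* b)) :* (x₃ :* x₆)) :* (((c :* b) :* (a :* d)) :* (x₃ :* x₆))) S.refl
  rearrange : ∀ q x₆ a b y₂ y₃ y₆ → _
  rearrange = solve 7 (λ q x₆ a b y₂ y₃ y₆ →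
    ((y₃ :* y₃) :* x₆) :* (y₂ :* x₆)
    :+ (q :* q) :* (((y₆ :* (con (+ 2) :* y₆)) :* x₆) :* ((b :* a) :* x₆))
    := y₂ :* y₃ :* y₃ :* x₆ :* x₆ :+ con (+ 2) :* q :* q :* ((a :* b) :* y₆ :* y₆ :* x₆ :* x₆)) S.refl

-- The product dissected is `θ 1ℤ 2 10 ⊗ θ -1ℤ 6 6` = `y₁` `x₃`² `x₆`². Since α = β, both classes
-- are squares, and the second one is moved to the other side.
odd₁≋ : (x₂ ⊗ x₆ ⊗ y₂ ⊗ y₆) ⊗ (x₂ ⊗ x₆ ⊗ y₂ ⊗ y₆) ≋
        y₁ ⊗ x₃ ⊗ x₃ ⊗ x₆ ⊗ x₆ ⊕ const -1ℤ ⊗ q ⊗ q ⊗ ((x₁ ⊗ y₁ ⊗ x₆ ⊗ y₆) ⊗ (x₁ ⊗ y₁ ⊗ x₆ ⊗ y₆))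
odd₁≋ = S.sym (begin
  _ ≈⟨ expand q x₁ x₃ x₆ y₁ y₆ ⟩
  _ ≈⟨ S.+-congʳ (θ-dissection₂ refl refl 1 4 4) ⟩
  _ ≈⟨ S.+-congʳ (S.+-cong
         (S.*-cong (S.*-cong (S.*-cong (P-∓ 4 12) (P-∓ 8 12)) (P-∓ 12 12)) (S.*-cong (S.*-cong (P-∓ 4 12) (P-∓ 8 12)) (P-∓ 12 12)))
         (S.*-cong q²≋ (S.*-cong (S.*-cong (S.*-cong (P-∓ 10 12) (P-∓ 2 12)) (P-∓ 12 12)) (S.*-cong (S.*-cong (P-∓ 10 12) (P-∓ 2 12)) (P-∓ 12 12))))) ⟩
  _ ≈⟨ collect q (P -1ℤ 2 12) (P -1ℤ 10 12) (P 1ℤ 2 12) (P 1ℤ 10 12)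
                 (P -1ℤ 4 12) (P -1ℤ 8 12) (P 1ℤ 4 12) (P 1ℤ 8 12) x₆ y₆ ⟩
  _ ∎)
  where
  open ≋-Reasoning
  expand : ∀ q x₁ x₃ x₆ y₁ y₆ → _
  expand = solve 6 (λ q x₁ x₃ x₆ y₁ y₆ →
    y₁ :* x₃ :* x₃ :* x₆ :* x₆ :+ con -1ℤ :* q :* q :* ((x₁ :* y₁ :* x₆ :* y₆) :* (x₁ :* y₁ :* x₆ :* y₆))
    := (y₁ :* x₆) :* ((x₃ :* x₃) :* x₆)
       :+ con -1ℤ :* q :* q :* ((x₁ :* y₁ :* x₆ :* y₆) :* (x₁ :* y₁ :* x₆ :* y₆))) S.refl
  collect : ∀ q a b c d a′ b′ c′ d′ x₆ y₆ → _
  collect = solve 11 (λ q a b c d a′ b′ c′ d′ x₆ y₆ →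
    (((a′ :* c′) :* (b′ :* d′)) :* (x₆ :* y₆)) :* (((a′ :* c′) :* (b′ :* d′)) :* (x₆ :* y₆))
    :+ (q :* q) :* ((((b :* d) :* (a :* c)) :* (x₆ :* y₆)) :* (((b :* d) :* (a :* c)) :* (x₆ :* y₆)))
    :+ con -1ℤ :* q :* q :* (((a :* b) :* (c :* d) :* x₆ :* y₆) :* ((a :* b) :* (c :* d) :* x₆ :* y₆))
    := ((a′ :* b′) :* x₆ :* (c′ :* d′) :* y₆) :* ((a′ :* b′) :* x₆ :* (c′ :* d′) :* y₆)) S.refl

z z′ : Series
z  = P -1ℤ 4 8
z′ = P -1ℤ 12 24

P88≋ : P -1ℤ 8 8 ≋ (x₂ ⊗ x₆) ⊗ (y₂ ⊗ y₆)
P88≋ = S.trans (P-∓ 4 4) (S.*-cong P44≋ (P-trisect 1ℤ 4 4))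

-- Euler's theorem on odd and distinct parts in the variable q⁴: `z` runs over odd multiples of 4,
-- and `y₂` `y₆` over all multiples. `z′y₆` is the same in q¹².
zy₂y₆ : z ⊗ (y₂ ⊗ y₆) ≋ one
zy₂y₆ = cancelʳ (S.trans (S.*-congʳ (S.sym P44≋)) (P-iP 4 4)) (begin
  z ⊗ (y₂ ⊗ y₆) ⊗ (x₂ ⊗ x₆)          ≈⟨ S.*-assoc z (y₂ ⊗ y₆) (x₂ ⊗ x₆) ⟩
  z ⊗ ((y₂ ⊗ y₆) ⊗ (x₂ ⊗ x₆))        ≈⟨ S.*-congˡ (S.*-comm (y₂ ⊗ y₆) (x₂ ⊗ x₆)) ⟩
  z ⊗ ((x₂ ⊗ x₆) ⊗ (y₂ ⊗ y₆))        ≈⟨ S.*-congˡ P88≋ ⟨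
  z ⊗ P -1ℤ 8 8                      ≈⟨ P-bisect -1ℤ 4 4 ⟨
  P -1ℤ 4 4                          ≈⟨ P44≋ ⟩
  x₂ ⊗ x₆                            ≈⟨ S.*-identityˡ (x₂ ⊗ x₆) ⟨
  one ⊗ (x₂ ⊗ x₆)                    ∎)
  where open ≋-Reasoning

z′y₆ : z′ ⊗ y₆ ≋ one
z′y₆ = cancelʳ (P-iP 12 12) (begin
  z′ ⊗ y₆ ⊗ x₆            ≈⟨ S.*-assoc z′ y₆ x₆ ⟩
  z′ ⊗ (y₆ ⊗ x₆)          ≈⟨ S.*-congˡ (S.*-comm y₆ x₆) ⟩
  z′ ⊗ (x₆ ⊗ y₆)          ≈⟨ S.*-congˡ (P-∓ 12 12) ⟨
  z′ ⊗ P -1ℤ 24 24        ≈⟨ P-bisect -1ℤ 12 12 ⟨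
  x₆                      ≈⟨ S.*-identityˡ x₆ ⟨
  one ⊗ x₆                ∎)
  where open ≋-Reasoning

-- Since `x₁` `y₁` is the product of 1 - q⁴ᵏ over k prime to 6, and `y₂` that of 1 + q⁴ᵏ over k
-- prime to 3, this is Euler's theorem in q⁴ for parts prime to 3. It is obtained as the quotient of
-- `zy₂y₆` by `z′y₆`.
x₁y₁y₂≋ : x₁ ⊗ y₁ ⊗ y₂ ≋ const 1ℤ
x₁y₁y₂≋ = begin
  x₁ ⊗ y₁ ⊗ y₂
    ≈⟨ S.trans (S.*-identityʳ _) (regroup (P -1ℤ 2 12) (P -1ℤ 10 12) (P 1ℤ 2 12) (P 1ℤ 10 12) y₂) ⟨
  ((P -1ℤ 2 12 ⊗ P 1ℤ 2 12) ⊗ (P -1ℤ 10 12 ⊗ P 1ℤ 10 12) ⊗ y₂) ⊗ one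
    ≈⟨ S.*-cong (S.*-congʳ (S.*-cong (S.sym (P-∓ 2 12)) (S.sym (P-∓ 10 12)))) (S.sym z′y₆) ⟩
  (P -1ℤ 4 24 ⊗ P -1ℤ 20 24 ⊗ y₂) ⊗ (z′ ⊗ y₆)
    ≈⟨ regroup′ (P -1ℤ 4 24) (P -1ℤ 20 24) y₂ z′ y₆ ⟩
  ((P -1ℤ 4 24 ⊗ z′) ⊗ P -1ℤ 20 24) ⊗ (y₂ ⊗ y₆)
    ≈⟨ S.*-congʳ (P-trisect -1ℤ 4 8) ⟨
  z ⊗ (y₂ ⊗ y₆)
    ≈⟨ S.trans zy₂y₆ one≋const ⟩
  const 1ℤ ∎
  where
  open ≋-Reasoning
  regroup : ∀ a b c d y → _
  regroup = solve 5 (λ a b c d y → (a :* c) :* (b :* d) :* y := (a :* b) :* (c :* d) :* y) S.refl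
  regroup′ : ∀ a b y z′ y₆ → _
  regroup′ = solve 5 (λ a b y z′ y₆ → (a :* b :* y) :* (z′ :* y₆) := ((a :* z′) :* b) :* (y :* y₆)) S.refl

-- Multiplication by (`z` `y₂` `y₆`)² = 1 turns the square into `y₂` `y₆` times
-- `θ 1ℤ 2 2 ⊗ θ -1ℤ 4 4`, which fits the dissection of index 3. Its two equal outer classes give
-- the coefficient 2.
odd₂≋ : (y₁ ⊗ y₃ ⊗ x₂ ⊗ x₆) ⊗ (y₁ ⊗ y₃ ⊗ x₂ ⊗ x₆) ≋
        x₃ ⊗ x₃ ⊗ x₆ ⊗ x₆ ⊗ y₂ ⊕ const (+ 2) ⊗ q ⊗ q ⊗ (x₁ ⊗ x₆ ⊗ x₆ ⊗ y₆ ⊗ y₆)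
odd₂≋ = begin
  (y₁ ⊗ y₃ ⊗ x₂ ⊗ x₆) ⊗ (y₁ ⊗ y₃ ⊗ x₂ ⊗ x₆)
    ≈⟨ S.trans (S.*-congˡ (S.*-cong zy₂y₆ zy₂y₆)) (S.trans (S.*-congˡ (S.*-identityˡ one)) (S.*-identityʳ _)) ⟨
  (y₁ ⊗ y₃ ⊗ x₂ ⊗ x₆) ⊗ (y₁ ⊗ y₃ ⊗ x₂ ⊗ x₆) ⊗ ((z ⊗ (y₂ ⊗ y₆)) ⊗ (z ⊗ (y₂ ⊗ y₆)))
    ≈⟨ regroup (P 1ℤ 2 12) (P 1ℤ 10 12) y₃ x₂ x₆ y₂ y₆ z ⟩
  (y₂ ⊗ y₆) ⊗ _
    ≈⟨ S.*-congˡ (S.*-cong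
         (S.*-cong (S.*-cong (P-trisect 1ℤ 2 4) (P-trisect 1ℤ 2 4)) P44≋)
         (S.*-congˡ P88≋)) ⟨
  (y₂ ⊗ y₆) ⊗ (θ 1ℤ 2 2 ⊗ θ -1ℤ 4 4)
    ≈⟨ S.*-congˡ θ-dissection₃ ⟩
  (y₂ ⊗ y₆) ⊗ _
    ≈⟨ S.*-congˡ (S.+-cong (S.*-cong q²≋ (S.*-congˡ (S.*-cong (S.*-cong (P-∓ 2 12) (P-∓ 10 12)) (P-∓ 12 12))))
         (S.+-cong (S.*-congˡ (S.*-congˡ (P-∓ 12 12)))
           (S.*-cong q²≋ (S.*-congˡ (S.*-cong (S.*-cong (P-∓ 10 12) (P-∓ 2 12)) (P-∓ 12 12)))))) ⟩
  (y₂ ⊗ y₆) ⊗ _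
    ≈⟨ collect q (P -1ℤ 2 12) (P -1ℤ 10 12) (P 1ℤ 2 12) (P 1ℤ 10 12) x₃ x₆ y₂ y₆ z′ ⟩
  (x₃ ⊗ x₃ ⊗ x₆ ⊗ x₆ ⊗ y₂) ⊗ ((z′ ⊗ y₆) ⊗ (z′ ⊗ y₆))
  ⊕ (const (+ 2) ⊗ q ⊗ q ⊗ (x₁ ⊗ x₆ ⊗ x₆ ⊗ y₆ ⊗ y₆)) ⊗ (x₁ ⊗ y₁ ⊗ y₂)
    ≈⟨ S.+-cong (S.trans (S.*-congˡ (S.trans (S.*-cong z′y₆ z′y₆) (S.*-identityˡ one))) (S.*-identityʳ _))
                (S.trans (S.*-congˡ (S.trans x₁y₁y₂≋ (S.sym one≋const))) (S.*-identityʳ _)) ⟩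
  _ ∎
  where
  open ≋-Reasoning
  regroup : ∀ a b y₃ x₂ x₆ y₂ y₆ z → _
  regroup = solve 8 (λ a b y₃ x₂ x₆ y₂ y₆ z →
    ((a :* b) :* y₃ :* x₂ :* x₆) :* ((a :* b) :* y₃ :* x₂ :* x₆) :* ((z :* (y₂ :* y₆)) :* (z :* (y₂ :* y₆)))
    := (y₂ :* y₆) :* (((((a :* y₃) :* b) :* ((a :* y₃) :* b)) :* (x₂ :* x₆))
                     :* ((z :* z) :* ((x₂ :* x₆) :* (y₂ :* y₆))))) S.refl
  collect : ∀ q a b c d x₃ x₆ y₂ y₆ z′ → _
  collect = solve 10 (λ q a b c d x₃ x₆ y₂ y₆ z′ →
    (y₂ :* y₆) :* ((q :* q) :* (((a :* b) :* x₆) :* (((a :* c) :* (b :* d)) :* (x₆ :* y₆)))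
      :+ (((x₃ :* x₃) :* x₆) :* ((z′ :* z′) :* (x₆ :* y₆))
      :+ (q :* q) :* (((b :* a) :* x₆) :* (((b :* d) :* (a :* c)) :* (x₆ :* y₆)))))
    := (x₃ :* x₃ :* x₆ :* x₆ :* y₂) :* ((z′ :* y₆) :* (z′ :* y₆))
       :+ (con (+ 2) :* q :* q :* ((a :* b) :* x₆ :* x₆ :* y₆ :* y₆)) :* ((a :* b) :* (c :* d) :* y₂)) S.refl

-- Odd exponents prime to 3 combine with the multiples of 6, that is with `p₆` = `x₃` `x₆`, to `J₁`.
-- Odd multiples of 3 give `p₃`, and even exponents prime to 3 give `x₁` `x₂`.
f₁≋ : f 1 ≋ J₁ ⊗ p₃ ⊗ x₁ ⊗ x₂
f₁≋ = begin
  f 1                    ≈⟨ f≋P 1 ⟩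
  P -1ℤ 1 1              ≈⟨ P-bisect -1ℤ 1 1 ⟩
  P -1ℤ 1 2 ⊗ P -1ℤ 2 2  ≈⟨ S.*-cong (P-trisect -1ℤ 1 2)
                              (S.trans (P-bisect -1ℤ 2 2) (S.*-cong (P-trisect -1ℤ 2 4) P44≋)) ⟩
  _                      ≈⟨ regroup (P -1ℤ 1 6) (P -1ℤ 5 6) p₃ (P -1ℤ 2 12) (P -1ℤ 10 12) x₂ x₃ x₆ ⟩
  _                      ≈⟨ S.*-congʳ (S.*-congʳ (S.*-congʳ (S.*-congˡ p₆≋))) ⟨
  J₁ ⊗ p₃ ⊗ x₁ ⊗ x₂      ∎
  where
  open ≋-Reasoning
  regroup : ∀ a b p₃ c d x₂ x₃ x₆ → _
  regroup = solve 8 (λ a b p₃ c d x₂ x₃ x₆ →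
    ((a :* p₃) :* b) :* (((c :* x₃) :* d) :* (x₂ :* x₆))
    := ((a :* b) :* (x₃ :* x₆)) :* p₃ :* (c :* d) :* x₂) S.refl

f₃≋ : f 3 ≋ p₃ ⊗ p₆
f₃≋ = S.trans (f≋P 3) (P-bisect -1ℤ 3 3)

f₄≋ : f 4 ≋ x₂ ⊗ x₆
f₄≋ = S.trans (f≋P 4) P44≋

-- The extra factor `p₆` completes `p₃`² to `J₃` = `p₃`² `p₆`, so that `cube-product` applies. Its
-- result contains `p₆`² = (`x₃` `x₆`)²: one `p₆` joins `p₃` to form f₃ and the other one is
-- cancelled.
f₁³≋ : f 1 ⊗ f 1 ⊗ f 1 ≋ f 3 ⊗ (x₆ ⊗ x₆ ⊗ (x₂ ⊗ x₂ ⊗ x₂ ⊕ const (- + 3) ⊗ q ⊗ (x₁ ⊗ x₁ ⊗ x₂)))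
f₁³≋ = cancelʳ (P-iP 6 6) (begin
  f 1 ⊗ f 1 ⊗ f 1 ⊗ p₆
    ≈⟨ S.*-congʳ (S.*-cong (S.*-cong f₁≋ f₁≋) f₁≋) ⟩
  _ ≈⟨ regroup J₁ p₃ p₆ x₁ x₂ ⟩
  p₃ ⊗ ((J₁ ⊗ J₁) ⊗ (J₁ ⊗ J₃) ⊗ (x₁ ⊗ x₁ ⊗ x₁ ⊗ (x₂ ⊗ x₂ ⊗ x₂)))
    ≈⟨ S.*-congˡ (cube-product x₁y₁y₂≋ J₁²≋ J₁J₃≋ even≋ odd₁≋ odd₂≋) ⟩
  _ ≈⟨ regroup′ p₃ x₃ x₆ B ⟩
  _ ≈⟨ S.*-congʳ (S.*-congˡ (S.*-cong p₆≋ p₆≋)) ⟨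
  _ ≈⟨ regroup″ p₃ p₆ x₆ B ⟩
  _ ≈⟨ S.*-congʳ (S.*-congʳ f₃≋) ⟨
  f 3 ⊗ (x₆ ⊗ x₆ ⊗ B) ⊗ p₆ ∎)
  where
  open ≋-Reasoning
  B = x₂ ⊗ x₂ ⊗ x₂ ⊕ const (- + 3) ⊗ q ⊗ (x₁ ⊗ x₁ ⊗ x₂)
  regroup : ∀ J p₃ p₆ x₁ x₂ → _
  regroup = solve 5 (λ J p₃ p₆ x₁ x₂ →
    (J :* p₃ :* x₁ :* x₂) :* (J :* p₃ :* x₁ :* x₂) :* (J :* p₃ :* x₁ :* x₂) :* p₆
    := p₃ :* ((J :* J) :* (J :* ((p₃ :* p₃) :* p₆)) :* (x₁ :* x₁ :* x₁ :* (x₂ :* x₂ :* x₂)))) S.refl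
  regroup′ : ∀ p₃ x₃ x₆ B → _
  regroup′ = solve 4 (λ p₃ x₃ x₆ B →
    p₃ :* ((x₃ :* x₃ :* x₆ :* x₆ :* x₆ :* x₆) :* B)
    := (p₃ :* ((x₃ :* x₆) :* (x₃ :* x₆))) :* (x₆ :* x₆ :* B)) S.refl
  regroup″ : ∀ p₃ p₆ x₆ B → _
  regroup″ = solve 4 (λ p₃ p₆ x₆ B →
    (p₃ :* (p₆ :* p₆)) :* (x₆ :* x₆ :* B) := (p₃ :* p₆) :* (x₆ :* x₆ :* B) :* p₆) S.refl

-- The analogues of yᵢ for q⁴, and the inverses of those of x₁x₂, x₃ and x₆.
Y₁ Y₂ Y₃ Y₆ X₃ X₆ i₂ i₃ i₆ : Series
Y₁ = P 1ℤ 4 24 ⊗ P 1ℤ 20 24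
Y₂ = P 1ℤ 16 24 ⊗ P 1ℤ 8 24
Y₃ = P 1ℤ 12 24
Y₆ = P 1ℤ 24 24
X₃ = P -1ℤ 12 24
X₆ = P -1ℤ 24 24
i₂ = (iP 8 24 ⊗ iP 16 24) ⊗ (iP 20 24 ⊗ iP 4 24)
i₃ = iP 12 24
i₆ = i₃ ⊗ iP 24 24

x₆≋ : x₆ ≋ X₃ ⊗ X₆
x₆≋ = P-bisect -1ℤ 12 12

x₂i₂ : x₂ ⊗ i₂ ≋ one
x₂i₂ = begin
  x₂ ⊗ i₂
    ≈⟨ S.*-congʳ (S.*-cong (P-bisect -1ℤ 4 12) (P-bisect -1ℤ 8 12)) ⟩
  _ ≈⟨ regroup (P -1ℤ 4 24) (P -1ℤ 8 24) (P -1ℤ 16 24) (P -1ℤ 20 24) (iP 4 24) (iP 8 24) (iP 16 24) (iP 20 24) ⟩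
  _ ≈⟨ S.*-cong (S.*-cong (P-iP 4 24) (P-iP 8 24)) (S.*-cong (P-iP 16 24) (P-iP 20 24)) ⟩
  (one ⊗ one) ⊗ (one ⊗ one)
    ≈⟨ S.trans (S.*-cong (S.*-identityˡ one) (S.*-identityˡ one)) (S.*-identityˡ one) ⟩
  one ∎
  where
  open ≋-Reasoning
  regroup : ∀ a b c d a′ b′ c′ d′ → _
  regroup = solve 8 (λ a b c d a′ b′ c′ d′ → ((a :* c) :* (b :* d)) :* ((b′ :* c′) :* (d′ :* a′))
    := ((a :* a′) :* (b :* b′)) :* ((c :* c′) :* (d :* d′))) S.refl

x₆i₆ : x₆ ⊗ i₆ ≋ one
x₆i₆ = begin
  x₆ ⊗ i₆                            ≈⟨ S.*-congʳ x₆≋ ⟩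
  (X₃ ⊗ X₆) ⊗ (i₃ ⊗ iP 24 24)        ≈⟨ regroup X₃ X₆ i₃ (iP 24 24) ⟩
  (X₃ ⊗ i₃) ⊗ (X₆ ⊗ iP 24 24)        ≈⟨ S.*-cong (P-iP 12 24) (P-iP 24 24) ⟩
  one ⊗ one                          ≈⟨ S.*-identityˡ one ⟩
  one                                ∎
  where
  open ≋-Reasoning
  regroup : ∀ a b c d → _
  regroup = solve 4 (λ a b c d → (a :* b) :* (c :* d) := (a :* c) :* (b :* d)) S.refl

-- `J₁²≋` with q² in place of q: `x₁` `x₆` is `θ -1ℤ 2 10`, and all parameters of the dissection
-- double. It separates the exponents 0 and 2 modulo 4.
x₁x₆≋ : (x₁ ⊗ x₆) ⊗ (x₁ ⊗ x₆) ≋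
        Y₁ ⊗ Y₃ ⊗ Y₃ ⊗ X₆ ⊗ X₆ ⊕ const (- + 2) ⊗ q^ 2 ⊗ (Y₂ ⊗ Y₆ ⊗ Y₆ ⊗ X₆ ⊗ X₆)
x₁x₆≋ = begin
  (x₁ ⊗ x₆) ⊗ (x₁ ⊗ x₆)
    ≈⟨ S.*-congˡ (S.*-congʳ (S.*-comm _ _)) ⟩
  θ -1ℤ 2 10 ⊗ θ -1ℤ 10 2
    ≈⟨ θ-dissection₂ refl refl 1 0 8 ⟩
  θ 1ℤ 12 12 ⊗ θ 1ℤ 4 20 ⊕ (const -1ℤ ⊗ q^ 2) ⊗ (θ 1ℤ 24 0 ⊗ θ 1ℤ 16 8)
    ≈⟨ S.+-congˡ (S.*-congˡ (S.*-congʳ (S.*-congʳ (S.*-congˡ (P-zero 24))))) ⟩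
  _ ≈⟨ rearrange (q^ 2) X₆ Y₁ Y₂ Y₃ Y₆ ⟩
  _ ∎
  where
  open ≋-Reasoning
  rearrange : ∀ q² x₆ y₁ y₂ y₃ y₆ → _
  rearrange = solve 6 (λ q² x₆ y₁ y₂ y₃ y₆ →
    ((y₃ :* y₃) :* x₆) :* (y₁ :* x₆)
    :+ (con -1ℤ :* q²) :* (((y₆ :* (con (+ 2) :* y₆)) :* x₆) :* (y₂ :* x₆))
    := y₁ :* y₃ :* y₃ :* x₆ :* x₆ :+ con (- + 2) :* q² :* (y₂ :* y₆ :* y₆ :* x₆ :* x₆)) S.refl

-- `W` is `X₆`² / (`x₂`³ `x₆`⁴). The numerator disappears because `x₆` = `X₃` `X₆`, which replaces
-- `X₆` / `x₆` by `i₃`. The 6 in `K` is (-3)(-2), with the -2 of `x₁x₆≋`. The factor `i₂` stands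
-- last in `K₀` and `W` as the source of strict positivity.
W K₀ K₁ K₃ K : Series
W  = (i₂ ⊗ i₂ ⊗ i₆ ⊗ i₆ ⊗ i₃ ⊗ i₃) ⊗ i₂
K₀ = (i₆ ⊗ i₆) ⊗ i₂
K₁ = (Y₁ ⊗ Y₃ ⊗ Y₃) ⊗ W
K₃ = (Y₂ ⊗ Y₆ ⊗ Y₆) ⊗ W
K  = K₀ ⊕ (const (- + 3) ⊗ (q ⊗ K₁) ⊕ const (+ 6) ⊗ (q^ 3 ⊗ K₃))

-- Multiplying `K` by f₄⁴ = (`x₂` `x₆`)⁴ reduces the division to `x₂i₂`, `x₆i₆` and the inverse `i₃`
-- of `X₃`.
f₄⁴K≋ : (x₂ ⊗ x₆) ⊗ (x₂ ⊗ x₆) ⊗ ((x₂ ⊗ x₆) ⊗ (x₂ ⊗ x₆)) ⊗ K ≋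
        x₆ ⊗ x₆ ⊗ (x₂ ⊗ x₂ ⊗ x₂ ⊕ const (- + 3) ⊗ q ⊗ (x₁ ⊗ x₁ ⊗ x₂))
f₄⁴K≋ = S.trans
  (S.trans (S.distribˡ F K₀ _) (S.+-cong partK₀ (S.trans (S.distribˡ F _ _) (S.+-cong partK₁ partK₃))))
  (S.sym (begin
    x₆ ⊗ x₆ ⊗ (x₂ ⊗ x₂ ⊗ x₂ ⊕ const (- + 3) ⊗ q ⊗ (x₁ ⊗ x₁ ⊗ x₂))
      ≈⟨ expand q x₁ x₂ x₆ ⟩
    (x₂ ⊗ x₂ ⊗ x₂) ⊗ (x₆ ⊗ x₆) ⊕ const (- + 3) ⊗ q ⊗ x₂ ⊗ ((x₁ ⊗ x₆) ⊗ (x₁ ⊗ x₆))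
      ≈⟨ S.+-congˡ (S.*-congˡ x₁x₆≋) ⟩
    _ ≈⟨ split q (q^ 2) x₂ x₆ Y₁ Y₂ Y₃ Y₆ X₆ ⟩
    _ ≈⟨ S.+-congˡ (S.+-congˡ (S.*-congˡ (S.*-congʳ (S.sym (q^-+ 1 2))))) ⟩
    (x₂ ⊗ x₂ ⊗ x₂) ⊗ (x₆ ⊗ x₆)
    ⊕ (const (- + 3) ⊗ (q ⊗ ((Y₁ ⊗ Y₃ ⊗ Y₃) ⊗ (x₂ ⊗ (X₆ ⊗ X₆))))
    ⊕ const (+ 6) ⊗ (q^ 3 ⊗ ((Y₂ ⊗ Y₆ ⊗ Y₆) ⊗ (x₂ ⊗ (X₆ ⊗ X₆))))) ∎))
  where
  open ≋-Reasoning
  F = (x₂ ⊗ x₆) ⊗ (x₂ ⊗ x₆) ⊗ ((x₂ ⊗ x₆) ⊗ (x₂ ⊗ x₆))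
  expand : ∀ q x₁ x₂ x₆ → _
  expand = solve 4 (λ q x₁ x₂ x₆ →
    x₆ :* x₆ :* (x₂ :* x₂ :* x₂ :+ con (- + 3) :* q :* (x₁ :* x₁ :* x₂))
    := (x₂ :* x₂ :* x₂) :* (x₆ :* x₆) :+ con (- + 3) :* q :* x₂ :* ((x₁ :* x₆) :* (x₁ :* x₆))) S.refl
  split : ∀ q q² x₂ x₆ y₁ y₂ y₃ y₆ X₆ → _
  split = solve 9 (λ q q² x₂ x₆ y₁ y₂ y₃ y₆ X₆ →
    (x₂ :* x₂ :* x₂) :* (x₆ :* x₆) :+ con (- + 3) :* q :* x₂ :*
      (y₁ :* y₃ :* y₃ :* X₆ :* X₆ :+ con (- + 2) :* q² :* (y₂ :* y₆ :* y₆ :* X₆ :* X₆))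
    := (x₂ :* x₂ :* x₂) :* (x₆ :* x₆)
    :+ (con (- + 3) :* (q :* ((y₁ :* y₃ :* y₃) :* (x₂ :* (X₆ :* X₆))))
    :+ con (+ 6) :* ((q :* q²) :* ((y₂ :* y₆ :* y₆) :* (x₂ :* (X₆ :* X₆)))))) S.refl
  ones : ∀ g → g ⊗ ((x₂ ⊗ i₂) ⊗ (x₆ ⊗ i₆) ⊗ (x₆ ⊗ i₆)) ≋ g
  ones g = S.trans (S.*-congˡ (S.trans (S.*-cong (S.*-cong x₂i₂ x₆i₆) x₆i₆)
    (S.trans (S.*-congʳ (S.*-identityˡ one)) (S.*-identityˡ one)))) (S.*-identityʳ g)
  partK₀ : F ⊗ K₀ ≋ (x₂ ⊗ x₂ ⊗ x₂) ⊗ (x₆ ⊗ x₆)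
  partK₀ = S.trans (regroup x₂ x₆ i₂ i₆) (ones _)
    where
    regroup : ∀ x₂ x₆ i₂ i₆ → _
    regroup = solve 4 (λ x₂ x₆ i₂ i₆ →
      (x₂ :* x₆) :* (x₂ :* x₆) :* ((x₂ :* x₆) :* (x₂ :* x₆)) :* ((i₆ :* i₆) :* i₂)
      := ((x₂ :* x₂ :* x₂) :* (x₆ :* x₆)) :* ((x₂ :* i₂) :* (x₆ :* i₆) :* (x₆ :* i₆))) S.refl
  FW : F ⊗ W ≋ x₂ ⊗ (X₆ ⊗ X₆)
  FW = begin
    F ⊗ W
      ≈⟨ regroup x₂ x₆ i₂ i₃ i₆ ⟩
    _ ≈⟨ ones _ ⟩
    _ ≈⟨ S.*-cong (S.*-congʳ (S.*-cong x₂i₂ x₂i₂)) (S.*-cong (S.*-congʳ x₆≋) (S.*-congʳ x₆≋)) ⟩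
    _ ≈⟨ regroup′ x₂ X₃ X₆ i₃ one ⟩
    _ ≈⟨ S.*-congˡ (S.*-cong (S.*-cong (S.*-identityˡ one) (P-iP 12 24)) (P-iP 12 24)) ⟩
    _ ≈⟨ S.trans (S.*-congˡ (S.trans (S.*-congʳ (S.*-identityˡ one)) (S.*-identityˡ one))) (S.*-identityʳ _) ⟩
    x₂ ⊗ (X₆ ⊗ X₆) ∎
    where
    regroup : ∀ x₂ x₆ i₂ i₃ i₆ → _
    regroup = solve 5 (λ x₂ x₆ i₂ i₃ i₆ →
      (x₂ :* x₆) :* (x₂ :* x₆) :* ((x₂ :* x₆) :* (x₂ :* x₆)) :* ((i₂ :* i₂ :* i₆ :* i₆ :* i₃ :* i₃) :* i₂)
      := (((x₂ :* i₂) :* (x₂ :* i₂)) :* x₂ :* ((x₆ :* i₃) :* (x₆ :* i₃))) :* ((x₂ :* i₂) :* (x₆ :* i₆) :* (x₆ :* i₆))) S.refl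
    regroup′ : ∀ x₂ X₃ X₆ i₃ o → _
    regroup′ = solve 5 (λ x₂ X₃ X₆ i₃ o →
      ((o :* o) :* x₂) :* (((X₃ :* X₆) :* i₃) :* ((X₃ :* X₆) :* i₃))
      := (x₂ :* (X₆ :* X₆)) :* ((o :* o) :* (X₃ :* i₃) :* (X₃ :* i₃))) S.refl
  pull : ∀ c e y → F ⊗ (c ⊗ (e ⊗ (y ⊗ W))) ≋ c ⊗ (e ⊗ (y ⊗ (x₂ ⊗ (X₆ ⊗ X₆))))
  pull c e y = S.trans (swap F c e y W) (S.*-congˡ (S.*-congˡ (S.*-congˡ FW)))
    where
    swap : ∀ F c e y W → _
    swap = solve 5 (λ F c e y W → F :* (c :* (e :* (y :* W))) := c :* (e :* (y :* (F :* W)))) S.refl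
  partK₁ = pull (const (- + 3)) q (Y₁ ⊗ Y₃ ⊗ Y₃)
  partK₃ = pull (const (+ 6)) (q^ 3) (Y₂ ⊗ Y₆ ⊗ Y₆)

⊛≋⊗ : ∀ g h → g ⊛ h ≋ g ⊗ h
⊛≋⊗ g h = pointwise λ n → sym (⊗-at g h n)

cong-⊛ : ∀ {g g′ h h′} → g ≋ g′ → h ≋ h′ → g ⊛ h ≋ g′ ⊗ h′
cong-⊛ g≋g′ h≋h′ = S.trans (⊛≋⊗ _ _) (S.*-cong g≋g′ h≋h′)

a≋K : a-1³3⁻¹4⁻⁴ ≋ K
a≋K = begin
  a-1³3⁻¹4⁻⁴
    ≈⟨ cong-⊛ numerator S.refl ⟩
  (f 1 ⊗ f 1 ⊗ f 1) ⊗ r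
    ≈⟨ S.*-congʳ (S.trans f₁³≋ (S.*-congˡ (S.trans (S.sym f₄⁴K≋) (S.*-congʳ (S.sym f₄⁴≋))))) ⟩
  (f 3 ⊗ (f 4 ^ 4 ⊗ K)) ⊗ r
    ≈⟨ regroup (f 3) (f 4 ^ 4) K r ⟩
  K ⊗ ((f 3 ⊗ f 4 ^ 4) ⊗ r)
    ≈⟨ S.*-congˡ (S.trans (S.*-congʳ (S.sym (⊛≋⊗ (f 3) (f 4 ^ 4))))
         (S.trans (S.sym (⊛≋⊗ (f 3 ⊛ f 4 ^ 4) r)) (pointwise (⊛-reciprocal (f 3 ⊛ f 4 ^ 4) refl)))) ⟩
  K ⊗ one
    ≈⟨ S.*-identityʳ K ⟩
  K ∎
  where
  open ≋-Reasoning
  r = reciprocal (f 3 ⊛ f 4 ^ 4) refl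
  regroup : ∀ a b c d → _
  regroup = solve 4 (λ a b c d → (a :* (b :* c)) :* d := c :* ((a :* b) :* d)) S.refl
  numerator : f 1 ^ 3 ≋ f 1 ⊗ f 1 ⊗ f 1
  numerator = S.trans (cong-⊛ S.refl (cong-⊛ S.refl (S.trans (⊛≋⊗ (f 1) one) (S.*-identityʳ (f 1)))))
                      (S.sym (S.*-assoc (f 1) (f 1) (f 1)))
  f₄⁴≋ : f 4 ^ 4 ≋ (x₂ ⊗ x₆) ⊗ (x₂ ⊗ x₆) ⊗ ((x₂ ⊗ x₆) ⊗ (x₂ ⊗ x₆))
  f₄⁴≋ = S.trans (cong-⊛ f₄≋ (cong-⊛ f₄≋ (cong-⊛ f₄≋ (S.trans (cong-⊛ f₄≋ S.refl) (S.*-identityʳ _)))))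
                 (assoc (x₂ ⊗ x₆))
    where
    assoc : ∀ g → _
    assoc = solve 1 (λ g → g :* (g :* (g :* g)) := g :* g :* (g :* g)) S.refl

-- Signs in the residue classes modulo 4

i₂-Nonneg : Nonneg 4 i₂
i₂-Nonneg = ⊗-Nonneg (⊗-Nonneg (iP-Nonneg 8 24 (divides 2 refl) (divides 6 refl)) (iP-Nonneg 16 24 (divides 4 refl) (divides 6 refl)))
                     (⊗-Nonneg (iP-Nonneg 20 24 (divides 5 refl) (divides 6 refl)) (iP-Nonneg 4 24 (divides 1 refl) (divides 6 refl)))

i₃-Nonneg : Nonneg 4 i₃
i₃-Nonneg = iP-Nonneg 12 24 (divides 3 refl) (divides 6 refl)

i₆-Nonneg : Nonneg 4 i₆
i₆-Nonneg = ⊗-Nonneg i₃-Nonneg (iP-Nonneg 24 24 (divides 6 refl) (divides 6 refl))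

-- The last factor `iP 4 24` contains 1 / (1 - q⁴), which is positive at every multiple of 4.
i₂-Positive : Positive 4 i₂
i₂-Positive = ⊗-Positive
  (⊗-Nonneg (iP-Nonneg 8 24 (divides 2 refl) (divides 6 refl)) (iP-Nonneg 16 24 (divides 4 refl) (divides 6 refl)))
  (⊗-Nonneg (iP-Nonneg 20 24 (divides 5 refl) (divides 6 refl)) (iP-Nonneg 4 24 (divides 1 refl) (divides 6 refl)))
  (⊗-Positive (iP-Nonneg 20 24 (divides 5 refl) (divides 6 refl)) (iP-Nonneg 4 24 (divides 1 refl) (divides 6 refl))
    (iP-Positive 4 24 (divides 6 refl)))

W-factor-Nonneg : Nonneg 4 (i₂ ⊗ i₂ ⊗ i₆ ⊗ i₆ ⊗ i₃ ⊗ i₃)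
W-factor-Nonneg = ⊗-Nonneg (⊗-Nonneg (⊗-Nonneg (⊗-Nonneg (⊗-Nonneg i₂-Nonneg i₂-Nonneg) i₆-Nonneg) i₆-Nonneg) i₃-Nonneg) i₃-Nonneg

W-Nonneg : Nonneg 4 W
W-Nonneg = ⊗-Nonneg W-factor-Nonneg i₂-Nonneg

W-Positive : Positive 4 W
W-Positive = ⊗-Positive W-factor-Nonneg i₂-Nonneg i₂-Positive

Y₁-Nonneg : Nonneg 4 (Y₁ ⊗ Y₃ ⊗ Y₃)
Y₁-Nonneg = ⊗-Nonneg (⊗-Nonneg (⊗-Nonneg (P-Nonneg 4 24 (divides 1 refl) (divides 6 refl)) (P-Nonneg 20 24 (divides 5 refl) (divides 6 refl)))
  (P-Nonneg 12 24 (divides 3 refl) (divides 6 refl))) (P-Nonneg 12 24 (divides 3 refl) (divides 6 refl))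

Y₂-Nonneg : Nonneg 4 (Y₂ ⊗ Y₆ ⊗ Y₆)
Y₂-Nonneg = ⊗-Nonneg (⊗-Nonneg (⊗-Nonneg (P-Nonneg 16 24 (divides 4 refl) (divides 6 refl)) (P-Nonneg 8 24 (divides 2 refl) (divides 6 refl)))
  (P-Nonneg 24 24 (divides 6 refl) (divides 6 refl))) (P-Nonneg 24 24 (divides 6 refl) (divides 6 refl))

shift-zero : ∀ {m g} → Nonneg m g → ∀ e n → (∀ n′ → n ≡ e ℕ.+ n′ → ¬ m ∣ n′) → (q^ e ⊗ g) n ≡ 0ℤ
shift-zero {g = g} G e n m∤ = split-at e n (q^-⊗-at-< e g)
  λ { n′ refl → trans (q^-⊗-at-+ e g n′) (sparse G n′ (m∤ n′ refl)) }

residue : ∀ {n r e j} → 4 ℕ.* n ℕ.+ r ≡ e ℕ.+ j ℕ.* 4 → r % 4 ≡ e % 4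
residue {n} {r} {e} {j} eq = begin
  r % 4                  ≡⟨ [m+kn]%n≡m%n r n 4 ⟨
  (r ℕ.+ n ℕ.* 4) % 4    ≡⟨ cong (_% 4) (trans (ℕ.+-comm r (n ℕ.* 4)) (cong (ℕ._+ r) (ℕ.*-comm n 4))) ⟩
  (4 ℕ.* n ℕ.+ r) % 4    ≡⟨ cong (_% 4) eq ⟩
  (e ℕ.+ j ℕ.* 4) % 4    ≡⟨ [m+kn]%n≡m%n e j 4 ⟩
  e % 4                  ∎
  where open ≡-Reasoning

a-at : ∀ n → a-1³3⁻¹4⁻⁴ n ≡ K₀ n + (- + 3 * (q ⊗ K₁) n + + 6 * (q^ 3 ⊗ K₃) n)
a-at n = begin
  a-1³3⁻¹4⁻⁴ n              ≡⟨ at a≋K n ⟩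
  K n                       ≡⟨ ⊕-at K₀ _ n ⟩
  K₀ n + (const (- + 3) ⊗ (q ⊗ K₁) ⊕ const (+ 6) ⊗ (q^ 3 ⊗ K₃)) n
    ≡⟨ cong (_+_ (K₀ n)) (⊕-at (const (- + 3) ⊗ (q ⊗ K₁)) (const (+ 6) ⊗ (q^ 3 ⊗ K₃)) n) ⟩
  K₀ n + ((const (- + 3) ⊗ (q ⊗ K₁)) n + (const (+ 6) ⊗ (q^ 3 ⊗ K₃)) n)
    ≡⟨ cong (_+_ (K₀ n)) (cong₂ _+_ (const-⊗ (- + 3) (q ⊗ K₁) n) (const-⊗ (+ 6) (q^ 3 ⊗ K₃) n)) ⟩
  K₀ n + (- + 3 * (q ⊗ K₁) n + + 6 * (q^ 3 ⊗ K₃) n) ∎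
  where open ≡-Reasoning

K₀-Nonneg : Nonneg 4 K₀
K₀-Nonneg = ⊗-Nonneg (⊗-Nonneg i₆-Nonneg i₆-Nonneg) i₂-Nonneg
K₁-Nonneg : Nonneg 4 K₁
K₁-Nonneg = ⊗-Nonneg Y₁-Nonneg W-Nonneg
K₃-Nonneg : Nonneg 4 K₃
K₃-Nonneg = ⊗-Nonneg Y₂-Nonneg W-Nonneg

K₀-Positive : Positive 4 K₀
K₀-Positive = ⊗-Positive (⊗-Nonneg i₆-Nonneg i₆-Nonneg) i₂-Nonneg i₂-Positive
K₁-Positive : Positive 4 K₁
K₁-Positive = ⊗-Positive Y₁-Nonneg W-Nonneg W-Positive
K₃-Positive : Positive 4 K₃
K₃-Positive = ⊗-Positive Y₂-Nonneg W-Nonneg W-Positive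

module _ (n : ℕ) (r : ℕ) where

  K₀-vanishes : r % 4 ≢ 0 → K₀ (4 ℕ.* n ℕ.+ r) ≡ 0ℤ
  K₀-vanishes r≢0 = sparse K₀-Nonneg _ λ { (divides j eq) → r≢0 (residue {n} {r} {0} {j} eq) }

  shift-vanishes : ∀ {g} → Nonneg 4 g → ∀ e → r % 4 ≢ e % 4 → (q^ e ⊗ g) (4 ℕ.* n ℕ.+ r) ≡ 0ℤ
  shift-vanishes G e r≢e = shift-zero G e (4 ℕ.* n ℕ.+ r)
    λ { n′ eq (divides j refl) → r≢e (residue {n} {r} {e} {j} eq) }

shift-value : ∀ g e n → (q^ e ⊗ g) (4 ℕ.* n ℕ.+ e) ≡ g (4 ℕ.* n)
shift-value g e n = trans (cong (q^ e ⊗ g) (ℕ.+-comm (4 ℕ.* n) e)) (q^-⊗-at-+ e g (4 ℕ.* n))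

a-value : ∀ {n k₀ k₁ k₃} → K₀ n ≡ k₀ → (q ⊗ K₁) n ≡ k₁ → (q^ 3 ⊗ K₃) n ≡ k₃ →
          a-1³3⁻¹4⁻⁴ n ≡ k₀ + (- + 3 * k₁ + + 6 * k₃)
a-value {n} refl refl refl = a-at n

theorem4p9 : (n : ℕ) →
    (a-1³3⁻¹4⁻⁴ (4 ℕ.* n) > 0ℤ)
    × (a-1³3⁻¹4⁻⁴ (4 ℕ.* n ℕ.+ 1) < 0ℤ)
    × (a-1³3⁻¹4⁻⁴ (4 ℕ.* n ℕ.+ 2) ≡ 0ℤ)
    × (a-1³3⁻¹4⁻⁴ (4 ℕ.* n ℕ.+ 3) > 0ℤ)
theorem4p9 n = residue₀ , residue₁ , residue₂ , residue₃
  where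
  4∣4n : 4 ∣ 4 ℕ.* n
  4∣4n = divides n (ℕ.*-comm 4 n)

  residue₀ : a-1³3⁻¹4⁻⁴ (4 ℕ.* n) > 0ℤ
  -- The vanishing lemmas speak of indices 4n + r, so 4n is treated as 4n + 0.
  residue₀ = subst (λ m → a-1³3⁻¹4⁻⁴ m > 0ℤ) (ℕ.+-identityʳ (4 ℕ.* n))
    (subst (0ℤ <_) (sym (trans (a-value {4 ℕ.* n ℕ.+ 0} refl
        (shift-vanishes n 0 K₁-Nonneg 1 λ ()) (shift-vanishes n 0 K₃-Nonneg 3 λ ()))
        (ℤ.+-identityʳ (K₀ (4 ℕ.* n ℕ.+ 0)))))
      (K₀-Positive (4 ℕ.* n ℕ.+ 0) (subst (4 ∣_) (sym (ℕ.+-identityʳ (4 ℕ.* n))) 4∣4n)))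

  residue₁ : a-1³3⁻¹4⁻⁴ (4 ℕ.* n ℕ.+ 1) < 0ℤ
  residue₁ = subst (_< 0ℤ) (sym (trans (a-value {4 ℕ.* n ℕ.+ 1} (K₀-vanishes n 1 λ ())
        (shift-value K₁ 1 n) (shift-vanishes n 1 K₃-Nonneg 3 λ ()))
        (trans (ℤ.+-identityˡ _) (ℤ.+-identityʳ (- + 3 * K₁ (4 ℕ.* n))))))
      (ℤ.*-monoˡ-<-neg (- + 3) (K₁-Positive (4 ℕ.* n) 4∣4n))

  residue₂ : a-1³3⁻¹4⁻⁴ (4 ℕ.* n ℕ.+ 2) ≡ 0ℤ
  residue₂ = a-value {4 ℕ.* n ℕ.+ 2} (K₀-vanishes n 2 λ ())
    (shift-vanishes n 2 K₁-Nonneg 1 λ ()) (shift-vanishes n 2 K₃-Nonneg 3 λ ())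

  residue₃ : a-1³3⁻¹4⁻⁴ (4 ℕ.* n ℕ.+ 3) > 0ℤ
  residue₃ = subst (0ℤ <_) (sym (trans (a-value {4 ℕ.* n ℕ.+ 3} (K₀-vanishes n 3 λ ())
        (shift-vanishes n 3 K₁-Nonneg 1 λ ()) (shift-value K₃ 3 n))
        (trans (ℤ.+-identityˡ _) (ℤ.+-identityˡ (+ 6 * K₃ (4 ℕ.* n))))))
      (ℤ.*-monoˡ-<-pos (+ 6) (K₃-Positive (4 ℕ.* n) 4∣4n))
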